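{- Let $n\ge1$ and let $T$ be a good tree on the vertex set $[n+1]$. If the polynomial $P_n^{\mathcal{S}}(x_{ij})$ is a reduced form of the commutative monomial $m^{\mathcal{S}}[T]$, then $$P_n^{\mathcal{S}}(x_{ij}=1)=\sum_{m=0}^{n-1}f_{T,n-m}\,\beta^m,$$ where $f_{T,k}$ is the number of noncrossing alternating spanning forests $F$ of $\overline{T}$ with $k$ edges containing the edge $(1,n+1)$, at least one edge of the form $(i_1,j)$ with $i_1\le i$ for each right pseudo-component of $T$ on $[i,j]$, and at least one edge of the form $(i,j_1)$ with $j\le j_1$ for each left pseudo-component of $T$ on $[i,j]$.
   Context: Graphs have vertex set $[n+1]=\{1,\ldots,n+1\}$; an edge joining $i<j$ is written $(i,j)$, and $(i,j)_a$ is the edge $(i,j)$ with label $a$. A graph is noncrossing if there are no $i<j<k<l$ with $(i,k),(j,l)$ both edges; alternating if there are no $i<j<k$ with $(i,j),(j,k)$ both edges. The transitive closure $\overline{G}$ has as edges all $(i,j)$ for which there are edges $(i,i_1),(i_1,i_2),\ldots,(i_r,j)$ of $G$ with $i<i_1<\cdots<i_r<j$ (edges of $G$ included). A spanning forest of $\overline{T}$ is a forest with vertex set $[n+1]$ (isolated vertices allowed) with all edges in $\overline{T}$. A forest $H$ on $[n+1]$ with $k$ edges labeled $1,\ldots,k$ is good if: (i) if $(i,j)_a,(j,k)_b$ are edges, $i<j<k$, then $a<b$; (ii) if $(i,j)_a,(i,k)_b$ are edges with $i<j<k$, then $a>b$; (iii) if $(i,j)_a,(k,j)_b$ are edges with $i<k<j$,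 then $a>b$; (iv) $H$ is noncrossing. A good tree is a good forest that is a tree. Pseudo-components of a noncrossing tree $T$ (on a finite set of integers) are defined inductively. The simple path $P$ in $T$ from the smallest to the largest vertex of $T$ (from $1$ to $n+1$ when the vertex set is $[n+1]$) is a pseudo-component. The graph $T\setminus P$ (edges of $P$ removed) is an edge-disjoint union of trees $T_1,\ldots,T_k$ such that if $v$ is a vertex of $P$ and $v\in T_l$, then $v$ is either the minimal or the maximal vertex of $T_l$, and such that no $k-1$ trees with edge-disjoint union $T\setminus P$ satisfy these requirements. The set of pseudo-components is $ps(T)=\{P\}\cup ps(T_1)\cup\cdots\cup ps(T_k)$. A pseudo-component is on $[i,j]$, $i<j$, if it is a path with endpoints $i$ and $j$. A pseudo-component on $[i,j]$ is a left pseudo-component of $T$ if there is no edge $(s,i)\in E(T)$ with $s<i$, and a right pseudo-component of $T$ if there is no edge $(j,s)\in E(T)$ with $j<s$ (it may be both). $m^{\mathcal{S}}[T]=\prod_{(i,j)\in E(T)}x_{ij}$ in commuting variables $x_{ij}$, $1\le i<j\le n+1$. The reduction rule is $x_{ij}x_{jk}\to x_{ik}x_{ij}+x_{jk}x_{ik}+\beta x_{ik}$ for $i<j<k$ ($\beta$ a further variable), applied in one monomial of a polynomial at a time. A reduced form of a monomial is a polynomial obtained by successive applications of the rule until no monomial is divisible by any $x_{ij}x_{jk}$, $i<j<k$. -}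

module Defs where

open import Data.Nat.Base as ℕ using (ℕ; zero; suc; z≤n; s≤s)
import Data.Nat.Properties as ℕ
open import Data.Nat.Induction using (<-wellFounded)
open import Data.Fin.Base using (Fin; zero; suc; fromℕ; _<_; _≤_)
open import Data.Fin.Properties
  using (_≟_; _<?_; _≤?_; all?; any?; <-trans; injective⇒≤)
open import Data.Fin.Induction using (>-wellFounded)
open import Data.List.Base
  using (List; []; _∷_; _++_; map; mapMaybe; concat; concatMap;
         cartesianProductWith; replicate; length; lookup; filter; zip; take;
         drop; head; last; upTo; allFin)
open import Data.List.Properties using (filter-notAll; length-++)
open import Data.List.Membership.Propositional using (_∈_; find; lose)
import Data.List.Membership.DecPropositional as DecMembership
open import Data.List.Membership.Propositional.Properties
  using (∈-allFin; ∈-cartesianProductWith⁺; ∈-concat⁺′; ∈-lookup; ∈-∃++)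
open import Data.List.Relation.Unary.All as All using (All; []; _∷_)
open import Data.List.Relation.Unary.AllPairs using ([]; _∷_)
open import Data.List.Relation.Unary.Any as Any using (Any; here; there; satisfied)
open import Data.List.Relation.Unary.Linked as Linked using (Linked; _∷_)
open import Data.List.Relation.Unary.Unique.Propositional using (Unique)
import Data.List.Relation.Unary.Unique.DecPropositional as DecUnique
open import Data.List.Relation.Binary.Permutation.Propositional
  using (_↭_; prep; ↭-refl; ↭-sym; ↭-trans; ↭-setoid)
open import Data.List.Relation.Binary.Permutation.Propositional.Properties
  using (∈-resp-↭; shift; drop-mid; ↭-length; ↭-empty-inv)
open import Data.Maybe.Base using (Maybe; just; nothing)
import Data.Maybe.Properties as Maybe
open import Data.Product using (Σ; ∃; ∃-syntax; _×_; _,_; proj₁; proj₂)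
open import Data.Sum using (_⊎_; inj₁; inj₂)
open import Function using (_∘_)
open import Induction.WellFounded using (Acc; acc)
open import Level using (0ℓ)
open import Relation.Nullary
  using (¬_; Dec; yes; no; ¬?; contradiction; recompute; map′; _×-dec_; _⊎-dec_; _→-dec_)
open import Relation.Unary using (Pred; Decidable)
open import Relation.Binary.Definitions using (DecidableEquality)
open import Relation.Binary.PropositionalEquality
  using (_≡_; _≢_; refl; sym; cong; subst)
open import Relation.Binary.Construct.Closure.Transitive using (TransClosure; [_]; _∷_)
open import Relation.Binary.Construct.Closure.ReflexiveTransitive using (Star)
import Data.List.Relation.Binary.Permutation.Setoid as PermutationSetoid

private variable n : ℕ

-- The vertex set [n+1] = {1,…,n+1} is Fin (suc n), shifted by one.
Vertex : ℕ → Set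
Vertex n = Fin (suc n)

record Edge (n : ℕ) : Set where
  constructor edge
  field
    src tgt  : Vertex n
    .src<tgt : src < tgt
open Edge public

-- A graph is a list of distinct edges (distinctness is part of IsForest).
-- In a labelled graph, the label of an edge is its position in the list.
Graph : ℕ → Set
Graph n = List (Edge n)

HasEdge : Graph n → Vertex n → Vertex n → Set
HasEdge G i j = Any (λ e → src e ≡ i × tgt e ≡ j) G

Joins : Edge n → Vertex n → Vertex n → Set
Joins e u v = (src e ≡ u × tgt e ≡ v) ⊎ (src e ≡ v × tgt e ≡ u)

Adj : Graph n → Vertex n → Vertex n → Set
Adj G u v = Any (λ e → Joins e u v) G

NonCrossing : Graph n → Set
NonCrossing G = ∀ e f → e ∈ G → f ∈ G →
                ¬ (src e < src f × src f < tgt e × tgt e < tgt f)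

Alternating : Graph n → Set
Alternating G = ∀ e f → e ∈ G → f ∈ G → tgt e ≢ src f

-- Edges of G are increasing, so chains of edges (i,i₁),(i₁,i₂),…,(iᵣ,j)
-- automatically satisfy i < i₁ < ⋯ < iᵣ < j.
InClosure : Graph n → Edge n → Set
InClosure G e = TransClosure (HasEdge G) (src e) (tgt e)

IsPath : Graph n → Vertex n → List (Vertex n) → Vertex n → Set
IsPath G u vs v = head vs ≡ just u × last vs ≡ just v × Linked (Adj G) vs × Unique vs

IsCycle : Graph n → List (Vertex n) → Set
IsCycle G vs = 3 ℕ.≤ length vs × Unique vs × Linked (Adj G) (vs ++ take 1 vs)

IsForest : Graph n → Set
IsForest G = Unique G × (∀ vs → ¬ IsCycle G vs)

IsTreeOn : List (Vertex n) → Graph n → Set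
IsTreeOn V G = IsForest G × (∀ u v → u ∈ V → v ∈ V → ∃[ vs ] IsPath G u vs v)

record IsGoodForest (H : Graph n) : Set where
  field
    forest      : IsForest H
    chain       : ∀ a b → tgt (lookup H a) ≡ src (lookup H b) → a < b
    sameSource  : ∀ a b → src (lookup H a) ≡ src (lookup H b) →
                  tgt (lookup H a) < tgt (lookup H b) → b < a
    sameTarget  : ∀ a b → tgt (lookup H a) ≡ tgt (lookup H b) →
                  src (lookup H a) < src (lookup H b) → b < a
    noncrossing : NonCrossing H

IsGoodTree : Graph n → Set
IsGoodTree T = IsGoodForest T × IsTreeOn (allFin _) T

vertices : Graph n → List (Vertex n)
vertices = concatMap (λ e → src e ∷ tgt e ∷ [])

IsMin IsMax : Graph n → Vertex n → Set
IsMin G v = v ∈ vertices G × All (v ≤_) (vertices G)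
IsMax G v = v ∈ vertices G × All (_≤ v) (vertices G)

-- The path P visits its vertices in order from the smallest to the largest.
IsMainPath : Graph n → List (Vertex n) → Set
IsMainPath T P = ∃[ u ] ∃[ v ] IsMin T u × IsMax T v × IsPath T u P v

Traverses : List (Vertex n) → Edge n → Set
Traverses P e = Any (λ (u , v) → Joins e u v) (zip P (drop 1 P))

joins? : (e : Edge n) (u v : Vertex n) → Dec (Joins e u v)
joins? e u v = (src e ≟ u ×-dec tgt e ≟ v) ⊎-dec (src e ≟ v ×-dec tgt e ≟ u)

traverses? : (P : List (Vertex n)) → Decidable (Traverses P)
traverses? P e = Any.any? (λ (u , v) → joins? e u v) (zip P (drop 1 P))

_∖_ : Graph n → List (Vertex n) → Graph n
T ∖ P = filter (¬? ∘ traverses? P) T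

IsNonemptyTree : Graph n → Set
IsNonemptyTree S = S ≢ [] × IsTreeOn (vertices S) S

MeetsAtExtremes : List (Vertex n) → Graph n → Set
MeetsAtExtremes P S = All (λ v → v ∈ vertices S → IsMin S v ⊎ IsMax S v) P

-- Trees without edges may be left out: deleting one from a decomposition
-- leaves a decomposition with one tree fewer.
IsDecomposition : Graph n → List (Vertex n) → List (Graph n) → Set
IsDecomposition T P Ts =
  concat Ts ↭ T ∖ P × All (λ S → IsNonemptyTree S × MeetsAtExtremes P S) Ts

IsMinimalDecomposition : Graph n → List (Vertex n) → List (Graph n) → Set
IsMinimalDecomposition T P Ts =
  IsDecomposition T P Ts ×
  ¬ (∃[ Ts′ ] IsDecomposition T P Ts′ × suc (length Ts′) ≡ length Ts)

data PseudoComponent (C : List (Vertex n)) : Graph n → Set where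
  main : ∀ {T} → IsMainPath T C → PseudoComponent C T
  part : ∀ {T P Ts S} → IsMainPath T P → IsMinimalDecomposition T P Ts →
         S ∈ Ts → PseudoComponent C S → PseudoComponent C T

PseudoComponentOn : Graph n → Vertex n → Vertex n → Set
PseudoComponentOn T i j =
  i < j × ∃[ C ] PseudoComponent C T × head C ≡ just i × last C ≡ just j

LeftPseudoComponentOn RightPseudoComponentOn : Graph n → Vertex n → Vertex n → Set
LeftPseudoComponentOn  T i j = PseudoComponentOn T i j × ∀ s → s < i → ¬ HasEdge T s i
RightPseudoComponentOn T i j = PseudoComponentOn T i j × ∀ s → j < s → ¬ HasEdge T j s

record Counted (T : Graph n) (k : ℕ) (F : Graph n) : Set where
  constructor counted
  field
    size        : length F ≡ k
    forest      : IsForest F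
    noncrossing : NonCrossing F
    alternating : Alternating F
    inClosure   : All (InClosure T) F
    longest     : HasEdge F zero (fromℕ _)
    right       : ∀ i j → RightPseudoComponentOn T i j → ∃[ i₁ ] i₁ ≤ i × HasEdge F i₁ j
    left        : ∀ i j → LeftPseudoComponentOn T i j → ∃[ j₁ ] j ≤ j₁ × HasEdge F i j₁

data Variable (n : ℕ) : Set where
  x[_] : Edge n → Variable n
  β    : Variable n

-- A monomial is a multiset of variables and a polynomial a multiset of
-- monomials, both represented by lists: multiplying monomials and adding
-- polynomials are concatenation.  The reduction rule has no negative
-- coefficients, so natural number coefficients suffice.
Monomial Polynomial : ℕ → Set
Monomial n   = List (Variable n)
Polynomial n = List (Monomial n)

open module PolynomialEquality {n} = PermutationSetoid (↭-setoid {A = Variable n})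
  using () renaming (_↭_ to infix 3 _≈_) public

infix  6 β^_
infixr 5 _·_

_·_ : ℕ → Monomial n → Polynomial n
_·_ = replicate

β^_ : ℕ → Monomial n
β^ m = replicate m β

sumBelow : ℕ → (ℕ → Polynomial n) → Polynomial n
sumBelow b p = concatMap p (upTo b)

infix 4 sumBelow
syntax sumBelow b (λ m → p) = Σ[ m < b ] p

m[_] : Graph n → Monomial n
m[ T ] = map x[_] T

-- xᵢⱼ xⱼₖ N + R → xᵢₖ xᵢⱼ N + xⱼₖ xᵢₖ N + β xᵢₖ N + R
-- The rule rewrites one copy of a monomial; rewriting a monomial together
-- with its whole coefficient is an iteration of this step.
data _⟶_ (P Q : Polynomial n) : Set where
  reduce : ∀ {i j k} (i<j : i < j) (j<k : j < k) →
           let xᵢⱼ = x[ edge i j i<j ]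
               xⱼₖ = x[ edge j k j<k ]
               xᵢₖ = x[ edge i k (<-trans i<j j<k) ]
           in ∀ N R →
           P ≈ (xᵢⱼ ∷ xⱼₖ ∷ N) ∷ R →
           Q ≈ (xᵢₖ ∷ xᵢⱼ ∷ N) ∷ (xⱼₖ ∷ xᵢₖ ∷ N) ∷ (β ∷ xᵢₖ ∷ N) ∷ R →
           P ⟶ Q

_⟶*_ : Polynomial n → Polynomial n → Set
_⟶*_ = Star _⟶_

IsReduced : Polynomial n → Set
IsReduced = All λ M → ∀ e f → tgt e ≡ src f → ¬ (∃[ N ] M ↭ x[ e ] ∷ x[ f ] ∷ N)

IsReducedFormOf : Polynomial n → Monomial n → Set
IsReducedFormOf P M = ∃[ Q ] (M ∷ []) ⟶* Q × Q ≈ P × IsReduced P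

dropX : Monomial n → Monomial n
dropX []           = []
dropX (x[ _ ] ∷ M) = dropX M
dropX (β ∷ M)      = β ∷ dropX M

_∣x=1 : Polynomial n → Polynomial n
P ∣x=1 = map dropX P

-- The decision procedures up to counted? only serve to make f a filter; the
-- value of f depends on Counted alone.

_≟ᴱ_ : DecidableEquality (Edge n)
edge i j _ ≟ᴱ edge k l _ =
  map′ (λ { (refl , refl) → refl }) (λ { refl → refl , refl }) (i ≟ k ×-dec j ≟ l)

src<tgt! : (e : Edge n) → src e < tgt e
src<tgt! (edge i j i<j) = recompute (i <? j) i<j

module _ {A : Set} where

  boundedLists : ℕ → List A → List (List A)
  boundedLists zero    xs = [] ∷ []
  boundedLists (suc m) xs = [] ∷ cartesianProductWith _∷_ xs (boundedLists m xs)

  Bounded : ℕ → List A → List A → Set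
  Bounded m xs ys = length ys ℕ.≤ m × All (_∈ xs) ys

  ∈-boundedLists : ∀ m {xs ys} → Bounded m xs ys → ys ∈ boundedLists m xs
  ∈-boundedLists zero    {ys = []}     _                       = here refl
  ∈-boundedLists (suc m) {ys = []}     _                       = here refl
  ∈-boundedLists (suc m) {ys = _ ∷ _} (s≤s |ys|≤m , y∈ ∷ ys∈) =
    there (∈-cartesianProductWith⁺ _∷_ y∈ (∈-boundedLists m (|ys|≤m , ys∈)))

  anyList? : ∀ {P : Pred (List A) 0ℓ} m xs → (∀ {ys} → P ys → Bounded m xs ys) →
             Decidable P → Dec (∃ P)
  anyList? m xs bounded P? =
    map′ satisfied (λ (_ , p) → lose (∈-boundedLists m (bounded p)) p)
         (Any.any? P? (boundedLists m xs))

  any∈? : ∀ {P : Pred A 0ℓ} xs → (∀ {x} → x ∈ xs → Dec (P x)) → Dec (Any P xs)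
  any∈? []       P? = no λ ()
  any∈? (x ∷ xs) P? =
    map′ Any.fromSum Any.toSum (P? (here refl) ⊎-dec any∈? xs (P? ∘ there))

  all∈? : ∀ {P : Pred A 0ℓ} xs → Decidable P → Dec (∀ x → x ∈ xs → P x)
  all∈? xs P? = map′ (λ ps _ → All.lookup ps) (λ h → All.tabulate (h _)) (All.all? P? xs)

module _ {A : Set} (_≟ᴬ_ : DecidableEquality A) where
  open DecMembership _≟ᴬ_ using (_∈?_)

  _↭?_ : (xs ys : List A) → Dec (xs ↭ ys)
  []       ↭? []      = yes ↭-refl
  []       ↭? (y ∷ _) = no λ p → contradiction (↭-empty-inv (↭-sym p)) λ ()
  (x ∷ xs) ↭? ys with x ∈? ys
  ... | no  x∉ys = no λ p → x∉ys (∈-resp-↭ p (here refl))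
  ... | yes x∈ys with as , bs , refl ← ∈-∃++ x∈ys =
    map′ (λ p → ↭-trans (prep x p) (↭-sym (shift x as bs))) (drop-mid [] as)
         (xs ↭? (as ++ bs))

unique-lookup : ∀ {A : Set} {xs : List A} → Unique xs → ∀ {a b} →
                lookup xs a ≡ lookup xs b → a ≡ b
unique-lookup (_ ∷ _)  {zero}  {zero}  _  = refl
unique-lookup (x∉ ∷ _) {zero}  {suc b} eq = contradiction eq (All.lookup x∉ (∈-lookup b))
unique-lookup (x∉ ∷ _) {suc a} {zero}  eq = contradiction (sym eq) (All.lookup x∉ (∈-lookup a))
unique-lookup (_ ∷ u)  {suc a} {suc b} eq = cong suc (unique-lookup u eq)

unique-bounded : ∀ {m} {vs : List (Fin m)} → Unique vs → Bounded m (allFin m) vs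
unique-bounded u = injective⇒≤ (unique-lookup u) , All.universal ∈-allFin _

infix 4 _≟ᴹ_
_≟ᴹ_ : DecidableEquality (Maybe (Vertex n))
_≟ᴹ_ = Maybe.≡-dec _≟_

unique? : Decidable {A = List (Vertex n)} Unique
unique? = DecUnique.unique? _≟_

hasEdge? : (G : Graph n) (i j : Vertex n) → Dec (HasEdge G i j)
hasEdge? G i j = Any.any? (λ e → src e ≟ i ×-dec tgt e ≟ j) G

adj? : (G : Graph n) (u v : Vertex n) → Dec (Adj G u v)
adj? G u v = Any.any? (λ e → joins? e u v) G

isPath? : (G : Graph n) (u v : Vertex n) → Decidable (λ vs → IsPath G u vs v)
isPath? G u v vs = head vs ≟ᴹ just u ×-dec last vs ≟ᴹ just v ×-dec
                   Linked.linked? (adj? G) vs ×-dec unique? vs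

isForest? : Decidable (IsForest {n})
isForest? {n} G = DecUnique.unique? _≟ᴱ_ G ×-dec
  map′ (λ none vs c → none (vs , c)) (λ f (vs , c) → f vs c)
    (¬? (anyList? (suc n) (allFin _) (λ (_ , u , _) → unique-bounded u)
      (λ vs → 3 ℕ.≤? length vs ×-dec unique? vs ×-dec
              Linked.linked? (adj? G) (vs ++ take 1 vs))))

isTreeOn? : (V : List (Vertex n)) → Decidable (IsTreeOn V)
isTreeOn? {n} V G = isForest? G ×-dec
  map′ (λ h u v u∈ v∈ → h u u∈ v v∈) (λ h u u∈ v v∈ → h u v u∈ v∈)
    (all∈? V λ u → all∈? V λ v →
      anyList? (suc n) (allFin _) (λ (_ , _ , _ , u) → unique-bounded u) (isPath? G u v))

nonCrossing? : Decidable (NonCrossing {n})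
nonCrossing? G =
  map′ (λ h e f e∈ f∈ → h e e∈ f f∈) (λ h e e∈ f f∈ → h e f e∈ f∈)
    (all∈? G λ e → all∈? G λ f →
      ¬? (src e <? src f ×-dec src f <? tgt e ×-dec tgt e <? tgt f))

alternating? : Decidable (Alternating {n})
alternating? G =
  map′ (λ h e f e∈ f∈ → h e e∈ f f∈) (λ h e e∈ f f∈ → h e f e∈ f∈)
    (all∈? G λ e → all∈? G λ f → ¬? (tgt e ≟ src f))

hasEdge⇒< : ∀ (G : Graph n) {i j} → HasEdge G i j → i < j
hasEdge⇒< G p with e , refl , refl ← satisfied p = src<tgt! e

inClosure? : (G : Graph n) → Decidable (InClosure G)
inClosure? {n} G e = go (src e) (tgt e) (>-wellFounded (src e))
  where
  Closure = TransClosure (HasEdge G)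
  fold : ∀ {i j} → HasEdge G i j ⊎ (∃[ k ] Σ (HasEdge G i k) λ _ → Closure k j) → Closure i j
  fold (inj₁ p)           = [ p ]
  fold (inj₂ (_ , p , c)) = p ∷ c
  unfold : ∀ {i j} → Closure i j → HasEdge G i j ⊎ (∃[ k ] Σ (HasEdge G i k) λ _ → Closure k j)
  unfold [ p ]   = inj₁ p
  unfold (p ∷ c) = inj₂ (_ , p , c)
  go : ∀ i j → Acc (λ u v → v < u) i → Dec (Closure i j)
  go i j (acc rs) = map′ fold unfold (hasEdge? G i j ⊎-dec any? step)
    where
    step : ∀ k → Dec (Σ (HasEdge G i k) λ _ → Closure k j)
    step k with hasEdge? G i k
    ... | no ¬p = no (¬p ∘ proj₁)
    ... | yes p = map′ (p ,_) proj₂ (go k j (rs (hasEdge⇒< G p)))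

isMin? : (G : Graph n) → Decidable (IsMin G)
isMin? G v = v ∈? vertices G ×-dec All.all? (v ≤?_) (vertices G)
  where open DecMembership _≟_ using (_∈?_)

isMax? : (G : Graph n) → Decidable (IsMax G)
isMax? G v = v ∈? vertices G ×-dec All.all? (_≤? v) (vertices G)
  where open DecMembership _≟_ using (_∈?_)

isMainPath? : (T : Graph n) → Decidable (IsMainPath T)
isMainPath? T P = any? λ u → any? λ v → isMin? T u ×-dec isMax? T v ×-dec isPath? T u v P

isMainPath-bounded : ∀ {T : Graph n} {P} → IsMainPath T P → Bounded (suc n) (allFin _) P
isMainPath-bounded (_ , _ , _ , _ , _ , _ , _ , u) = unique-bounded u

isNonemptyTree? : Decidable (IsNonemptyTree {n})
isNonemptyTree? []        = no λ (ne , _) → ne refl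
isNonemptyTree? S@(_ ∷ _) = yes (λ ()) ×-dec isTreeOn? (vertices S) S

isDecomposition? : (T : Graph n) (P : List (Vertex n)) → Decidable (IsDecomposition T P)
isDecomposition? T P Ts =
  _↭?_ _≟ᴱ_ (concat Ts) (T ∖ P) ×-dec
  All.all? (λ S → isNonemptyTree? S ×-dec
    All.all? (λ v → v ∈? vertices S →-dec (isMin? S v ⊎-dec isMax? S v)) P) Ts
  where open DecMembership _≟_ using (_∈?_)

∈⇒length≤concat : ∀ {A : Set} {xs : List A} {xss} → xs ∈ xss → length xs ℕ.≤ length (concat xss)
∈⇒length≤concat {xs = xs} {xss = _ ∷ xss} (here refl) =
  subst (length xs ℕ.≤_) (sym (length-++ xs)) (ℕ.m≤m+n _ _)
∈⇒length≤concat {xss = ys ∷ xss} (there xs∈) =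
  subst (_ ℕ.≤_) (sym (length-++ ys)) (ℕ.m≤n⇒m≤o+n (length ys) (∈⇒length≤concat xs∈))

length≤length-concat : ∀ {A : Set} {xss : List (List A)} →
                       All (_≢ []) xss → length xss ℕ.≤ length (concat xss)
length≤length-concat []                           = z≤n
length≤length-concat {xss = [] ∷ _} (ne ∷ _)      = contradiction refl ne
length≤length-concat {xss = (_ ∷ xs) ∷ _} (_ ∷ p) =
  s≤s (subst (_ ℕ.≤_) (sym (length-++ xs)) (ℕ.m≤n⇒m≤o+n (length xs) (length≤length-concat p)))

isDecomposition-bounded : ∀ (T : Graph n) P {Ts} → IsDecomposition T P Ts →
  Bounded (length (T ∖ P)) (boundedLists (length (T ∖ P)) (T ∖ P)) Ts
isDecomposition-bounded T P {Ts} (p , trees) =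
  below (length≤length-concat (All.map (proj₁ ∘ proj₁) trees)) ,
  All.tabulate λ S∈ → ∈-boundedLists (length (T ∖ P))
    (below (∈⇒length≤concat S∈) , All.tabulate λ e∈ → ∈-resp-↭ p (∈-concat⁺′ e∈ S∈))
  where
  below : ∀ {m} → m ℕ.≤ length (concat Ts) → m ℕ.≤ length (T ∖ P)
  below = subst (_ ℕ.≤_) (↭-length p)

anyDecomposition? : (T : Graph n) (P : List (Vertex n)) {Q : Pred (List (Graph n)) 0ℓ} →
                    (∀ {Ts} → Q Ts → IsDecomposition T P Ts) → Decidable Q → Dec (∃ Q)
anyDecomposition? T P q = anyList? _ _ (isDecomposition-bounded T P ∘ q)

isMinimalDecomposition? : (T : Graph n) (P : List (Vertex n)) →
                          Decidable (IsMinimalDecomposition T P)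
isMinimalDecomposition? T P Ts = isDecomposition? T P Ts ×-dec
  ¬? (anyDecomposition? T P proj₁ λ Ts′ →
        isDecomposition? T P Ts′ ×-dec suc (length Ts′) ℕ.≟ length Ts)

min≢max : ∀ (T : Graph n) {u v} → IsMin T u → IsMax T v → u ≢ v
min≢max (e ∷ _) (_ , u≤s ∷ _) (_ , _ ∷ t≤v ∷ _) refl =
  ℕ.<⇒≱ (src<tgt! e) (ℕ.≤-trans t≤v u≤s)

∖-shorter : ∀ {T : Graph n} {P} → IsMainPath T P → length (T ∖ P) ℕ.< length T
∖-shorter {P = []}             (_ , _ , _ , _ , () , _)
∖-shorter {T = T} {_ ∷ []}     (_ , _ , min , max , refl , refl , _) =
  contradiction refl (min≢max T min max)
∖-shorter {T = T} {_ ∷ _ ∷ _} (_ , _ , _ , _ , _ , _ , uw ∷ _ , _) =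
  filter-notAll _ T (Any.map (λ joins ¬traverses → ¬traverses (here joins)) uw)

subtree-shorter : ∀ {T : Graph n} {P Ts S} → IsMainPath T P → IsDecomposition T P Ts →
                  S ∈ Ts → length S ℕ.< length T
subtree-shorter P-main (p , _) S∈ =
  ℕ.≤-<-trans (subst (_ ℕ.≤_) (↭-length p) (∈⇒length≤concat S∈)) (∖-shorter P-main)

pseudoComponentOn? : (T : Graph n) (i j : Vertex n) → Dec (PseudoComponentOn T i j)
pseudoComponentOn? {n} T i j = i <? j ×-dec go T (<-wellFounded (length T))
  where
  Ends : List (Vertex n) → Set
  Ends C = head C ≡ just i × last C ≡ just j

  Found : Graph n → Set
  Found T = ∃[ C ] PseudoComponent C T × Ends C

  Main Part : Graph n → Set
  Main T = ∃[ C ] IsMainPath T C × Ends C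
  Part T = ∃[ P ] Σ (IsMainPath T P) λ _ →
           ∃[ Ts ] Σ (IsMinimalDecomposition T P Ts) λ _ → Any Found Ts

  fold : ∀ {T} → Main T ⊎ Part T → Found T
  fold (inj₁ (C , m , ends)) = C , main m , ends
  fold (inj₂ (P , m , Ts , d , found))
    with _ , S∈ , C , c , ends ← find found = C , part m d S∈ c , ends

  unfold : ∀ {T} → Found T → Main T ⊎ Part T
  unfold (C , main m , ends)        = inj₁ (C , m , ends)
  unfold (C , part m d S∈ c , ends) = inj₂ (_ , m , _ , d , lose S∈ (C , c , ends))

  go : ∀ T → Acc ℕ._<_ (length T) → Dec (Found T)
  go T (acc rs) = map′ fold unfold
    (anyList? (suc n) (allFin _) (isMainPath-bounded {T = T} ∘ proj₁)
       (λ C → isMainPath? T C ×-dec head C ≟ᴹ just i ×-dec last C ≟ᴹ just j)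
     ⊎-dec
     anyList? (suc n) (allFin _) (isMainPath-bounded {T = T} ∘ proj₁) below)
    where
    within : ∀ {P} → IsMainPath T P → ∀ Ts →
             Dec (Σ (IsMinimalDecomposition T P Ts) λ _ → Any Found Ts)
    within {P} m Ts with isMinimalDecomposition? T P Ts
    ... | no ¬d = no (¬d ∘ proj₁)
    ... | yes d = map′ (d ,_) proj₂
      (any∈? Ts λ {S} S∈ → go S (rs (subtree-shorter m (proj₁ d) S∈)))

    below : ∀ P → Dec (Σ (IsMainPath T P) λ _ →
                       ∃[ Ts ] Σ (IsMinimalDecomposition T P Ts) λ _ → Any Found Ts)
    below P with isMainPath? T P
    ... | no ¬m = no (¬m ∘ proj₁)
    ... | yes m = map′ (m ,_) proj₂ (anyDecomposition? T P (proj₁ ∘ proj₁) (within m))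

leftPseudoComponentOn? : (T : Graph n) (i j : Vertex n) → Dec (LeftPseudoComponentOn T i j)
leftPseudoComponentOn? T i j = pseudoComponentOn? T i j ×-dec
  all? λ s → s <? i →-dec ¬? (hasEdge? T s i)

rightPseudoComponentOn? : (T : Graph n) (i j : Vertex n) → Dec (RightPseudoComponentOn T i j)
rightPseudoComponentOn? T i j = pseudoComponentOn? T i j ×-dec
  all? λ s → j <? s →-dec ¬? (hasEdge? T j s)

counted? : (T : Graph n) (k : ℕ) → Decidable (Counted T k)
counted? T k F =
  map′ (λ (s , fo , nc , al , cl , lo , ri , le) → counted s fo nc al cl lo ri le)
       (λ (counted s fo nc al cl lo ri le) → s , fo , nc , al , cl , lo , ri , le)
    (length F ℕ.≟ k ×-dec isForest? F ×-dec nonCrossing? F ×-dec alternating? F ×-dec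
     All.all? (inClosure? T) F ×-dec hasEdge? F zero (fromℕ _) ×-dec
     (all? λ i → all? λ j → rightPseudoComponentOn? T i j →-dec
       any? λ i₁ → i₁ ≤? i ×-dec hasEdge? F i₁ j) ×-dec
     (all? λ i → all? λ j → leftPseudoComponentOn? T i j →-dec
       any? λ j₁ → j ≤? j₁ ×-dec hasEdge? F i j₁))

edge? : (i j : Vertex n) → Maybe (Edge n)
edge? i j with i <? j
... | yes i<j = just (edge i j i<j)
... | no _    = nothing

edges : ∀ n → List (Edge n)
edges n = concatMap (λ i → mapMaybe (edge? i) (allFin (suc n))) (allFin (suc n))

sublists : ∀ {A : Set} → List A → List (List A)
sublists []       = [] ∷ []
sublists (x ∷ xs) = map (x ∷_) (sublists xs) ++ sublists xs

-- edges n lists every edge once, so each edge set occurs once in sublists (edges n).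
f : Graph n → ℕ → ℕ
f {n} T k = length (filter (counted? T k) (sublists (edges n)))

{-# OPTIONS --safe #-}

-- Give the edges of a graph positive integers c_e and consider the vector
-- Σ c_(i,j) (e_i − e_j).  One reduction splits the flows on a graph according to
-- cᵢⱼ > cⱼₖ, cᵢⱼ < cⱼₖ or cᵢⱼ = cⱼₖ, keeping this vector, so the flows on T
-- correspond to the flows on the monomials of any reduced form.  They also
-- correspond to the flows on the noncrossing alternating forests of the theorem:
-- joining the longest incoming to the longest outgoing edge at a vertex turns
-- a flow on T into one on such a forest, which is unique because the shortest
-- edge of a noncrossing alternating flow is determined by the vector; the
-- forests that occur are those whose edges, seen as increasing paths of T,
-- cover T, and this is what the pseudo-component conditions express.  The total
-- of an alternating flow depends on the vector only, and compositions of r into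
-- k parts are unitriangular in (r , k), so both families contain equally many
-- members of each size.

module Submission where

open import Defs
open import Algebra.Bundles using (AbelianGroup)
open import Algebra.Properties.Group using (∙-cancelˡ)
open import Data.Bool.Base using (Bool; true; false; if_then_else_)
import Data.Bool.Properties as Bool
open import Data.Fin.Base using (zero; suc; toℕ; fromℕ; _<_; _≤_)
open import Data.Fin.Induction using (<-wellFounded; >-wellFounded)
open import Data.Fin.Properties
  using (_≟_; _<?_; _≤?_; <-trans; <-cmp; toℕ-injective; toℕ<n; ≤fromℕ)
open import Data.Integer.Base as ℤ using (ℤ; +_)
import Data.Integer.Properties as ℤ
open import Data.Integer.Tactic.RingSolver using (solve-∀)
open import Data.List.Base
  using (List; []; _∷_; _++_; map; replicate; length; last; head; filter; allFin; concat;
         concatMap; upTo; mapMaybe)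
open import Data.List.Properties as List
  using (length-++; length-replicate; length-map; length-tabulate; map-++; filter-++;
         filter-all; filter-none; filter-accept; filter-reject; concat-map-[_])
import Data.List.Membership.DecPropositional as DecMembership
open import Data.List.Membership.Propositional using (_∈_; _∉_; find; lose)
open import Data.List.Membership.Propositional.Properties
  using (∈-map⁺; ∈-map⁻; ∈-++⁺ˡ; ∈-++⁺ʳ; ∈-++⁻; ∈-∃++; ∈-filter⁺; ∈-filter⁻; ∈-allFin;
         ∈-concat⁺′; ∈-concat⁻′; ∈-concatMap⁺; ∈-concatMap⁻; ∈-upTo⁺; ∈-upTo⁻)
open import Data.List.Relation.Binary.Pointwise as Pointwise using (Pointwise; []; _∷_)
import Data.List.Relation.Binary.Permutation.Homogeneous as H
open import Data.List.Relation.Binary.Permutation.Propositional as ↭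
  using (_↭_; prep; swap; ↭-refl; ↭-reflexive; ↭-sym; ↭-trans; ↭-setoid; ↭⇒↭ₛ)
open import Data.List.Relation.Binary.Permutation.Propositional.Properties
  using (∈-resp-↭; All-resp-↭; ↭-length; filter-↭; map⁺; shift; shifts; ++⁺ˡ)
import Data.List.Relation.Binary.Permutation.Setoid.Properties as Permutationₛ
open import Data.List.Relation.Unary.All as All using (All; []; _∷_)
import Data.List.Relation.Unary.All.Properties as All
open import Data.List.Relation.Unary.AllPairs using ([]; _∷_)
open import Data.List.Relation.Unary.Any as Any using (Any; here; there)
open import Data.List.Relation.Unary.Linked as Linked using (Linked; []; [-]; _∷_)
open import Data.List.Relation.Unary.Unique.Propositional using (Unique)
import Data.List.Relation.Unary.Unique.Propositional.Properties as Unique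
open import Data.Maybe.Base using (just)
open import Data.Maybe.Properties using (just-injective)
open import Data.Nat.Base as ℕ using (ℕ; zero; suc; z≤n; s≤s; _≥_; _∸_)
import Data.Nat.Induction as ℕ
open import Data.Nat.ListAction using (sum)
open import Data.Nat.ListAction.Properties using (sum-↭)
import Data.Nat.Properties as ℕ
open import Data.Product using (∃-syntax; _×_; _,_; proj₁; proj₂)
open import Data.Sum as Sum using (_⊎_; inj₁; inj₂)
open import Data.Unit.Base using (⊤; tt)
open import Function.Base using (_∘_; id; case_of_)
open import Induction.WellFounded using (Acc; acc)
open import Level using (0ℓ)
open import Relation.Binary.Construct.Closure.ReflexiveTransitive as Star
  using (Star; ε; _◅_; _◅◅_)
open import Relation.Binary.Construct.Closure.Transitive as TransClosure
  using (TransClosure; [_]; _∷_)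
open import Relation.Binary.Definitions using (tri<; tri≈; tri>)
open import Relation.Binary.PropositionalEquality
  using (_≡_; _≢_; refl; sym; trans; cong; cong₂; subst; subst₂; setoid; module ≡-Reasoning)
open import Relation.Nullary
  using (¬_; Dec; yes; no; does; ¬?; contradiction; _×-dec_; decidable-stable)
open import Relation.Nullary.Decidable using (dec-true; dec-false)
open import Relation.Unary using (Pred; Decidable)

-- The order of reductions can produce monomials whose edges cross, so the monomials need not match
-- the counted forests one by one. Both families are therefore compared only through `T`, and only
-- by how many positive flows of each total they carry. Equality of vectors is tested against
-- integer potentials on the vertices, because every fact needed about a vector comes from a
-- potential with values 0 and 1. The set of sources of an alternating bag yields its total. A
-- single vertex, or the complement of one, detects an edge starting or ending there. One side of
-- the cut of `T` at an edge e yields the flow through e. An increasing chain in `T` can cross that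
-- cut only by using e, so positivity of the flow through e turns into the statement that some edge
-- of the forest has e on its chain; this is how covering is read off the vector.

private variable n : ℕ

-- Flows and reductions

-- A list of edges also serves as a bag in which an edge may occur several times.

drop-in : (Vertex n → ℤ) → Edge n → ℤ
drop-in φ e = φ (src e) ℤ.- φ (tgt e)

pairing : (Vertex n → ℤ) → Graph n → ℤ
pairing φ []      = + 0
pairing φ (e ∷ D) = drop-in φ e ℤ.+ pairing φ D

-- Pairing with all potentials φ determines Σ (e_i − e_j) over the edges (i,j)
-- of a bag.
infix 4 _~_
record _~_ (D E : Graph n) : Set where
  field at : ∀ φ → pairing φ D ≡ pairing φ E
open _~_

~-refl : {D : Graph n} → D ~ D
~-refl .at φ = refl

~-sym : {D E : Graph n} → D ~ E → E ~ D
~-sym p .at φ = sym (at p φ)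

~-trans : {D E F : Graph n} → D ~ E → E ~ F → D ~ F
~-trans p q .at φ = trans (at p φ) (at q φ)

pairing-++ : ∀ φ (D E : Graph n) → pairing φ (D ++ E) ≡ pairing φ D ℤ.+ pairing φ E
pairing-++ φ []      E = sym (ℤ.+-identityˡ _)
pairing-++ φ (e ∷ D) E =
  trans (cong (λ t → drop-in φ e ℤ.+ t) (pairing-++ φ D E)) (sym (ℤ.+-assoc (drop-in φ e) _ _))

~-++ : {D D′ E E′ : Graph n} → D ~ D′ → E ~ E′ → D ++ E ~ D′ ++ E′
~-++ {D = D} {D′} {E} {E′} p q .at φ =
  trans (pairing-++ φ D E) (trans (cong₂ ℤ._+_ (at p φ) (at q φ)) (sym (pairing-++ φ D′ E′)))

exchange : ∀ (x y z : ℤ) → x ℤ.+ (y ℤ.+ z) ≡ y ℤ.+ (x ℤ.+ z)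
exchange = solve-∀

↭⇒~ : {D E : Graph n} → D ↭ E → D ~ E
↭⇒~ ↭.refl       .at φ = refl
↭⇒~ (prep e p) .at φ = cong (λ t → drop-in φ e ℤ.+ t) (at (↭⇒~ p) φ)
↭⇒~ (swap e f p) .at φ =
  trans (exchange (drop-in φ e) (drop-in φ f) _)
        (cong (λ t → drop-in φ f ℤ.+ (drop-in φ e ℤ.+ t)) (at (↭⇒~ p) φ))
↭⇒~ (↭.trans p q) .at φ = trans (at (↭⇒~ p) φ) (at (↭⇒~ q) φ)

telescope : ∀ (x y z : ℤ) → x ℤ.- z ≡ (x ℤ.- y) ℤ.+ (y ℤ.- z)
telescope = solve-∀

pairing-replicate : ∀ φ m (e : Edge n) → pairing φ (replicate m e) ≡ + m ℤ.* drop-in φ e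
pairing-replicate φ zero    e = sym (ℤ.*-zeroˡ (drop-in φ e))
pairing-replicate φ (suc m) e = trans (cong (λ t → drop-in φ e ℤ.+ t) (pairing-replicate φ m e))
  (sym (ℤ.suc-* (+ m) (drop-in φ e)))

-- The entry a stands for the value suc a, so that flows are positive.
Flow : Graph n → Set
Flow = All (λ _ → ℕ)

bag : {G : Graph n} → Flow G → Graph n
bag []                  = []
bag (_∷_ {x = e} a c) = replicate (suc a) e ++ bag c

-- An element of `Any Flow Gs` is a position in `Gs` with a flow on the graph there. Equal graphs at
-- different positions count separately, as equal monomials of a polynomial must.
bagᴾ : {Gs : List (Graph n)} → Any Flow Gs → Graph n
bagᴾ (here c)  = bag c
bagᴾ (there q) = bagᴾ q

-- Exactly what moves a `Model` from `a` to `b`: `to` carries the existence of a flow for each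
-- vector, while `from` and its injectivity carry soundness and uniqueness.
record Reindex {A B : Set} (a : A → Graph n) (b : B → Graph n) : Set where
  field
    to       : A → B
    to-~     : ∀ x → b (to x) ~ a x
    from     : B → A
    from-~   : ∀ y → a (from y) ~ b y
    from-inj : ∀ {y y′} → from y ≡ from y′ → y ≡ y′
open Reindex

module _ {A B C : Set} {a : A → Graph n} {b : B → Graph n} {c : C → Graph n} where
  reindex-trans : Reindex a b → Reindex b c → Reindex a c
  reindex-trans f g .to x       = to g (to f x)
  reindex-trans f g .to-~ x     = ~-trans (to-~ g _) (to-~ f x)
  reindex-trans f g .from y     = from f (from g y)
  reindex-trans f g .from-~ y   = ~-trans (from-~ f _) (from-~ g y)
  reindex-trans f g .from-inj p = from-inj g (from-inj f p)

reindex-refl : {A : Set} {a : A → Graph n} → Reindex a a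
reindex-refl .to x       = x
reindex-refl .to-~ x     = ~-refl
reindex-refl .from x     = x
reindex-refl .from-~ x   = ~-refl
reindex-refl .from-inj p = p

bagOf : (G : Graph n) → Flow G → Graph n
bagOf G c = bag c

∷-inj : ∀ {e} {G : Graph n} {a b : ℕ} {c d : Flow G} →
        _≡_ {A = Flow (e ∷ G)} (a ∷ c) (b ∷ d) → a ≡ b × c ≡ d
∷-inj refl = refl , refl

reindex-↭ : {G H : Graph n} → G ↭ H → Reindex (bagOf G) (bagOf H)
reindex-↭ ↭.refl        = reindex-refl
reindex-↭ (↭.trans p q) = reindex-trans (reindex-↭ p) (reindex-↭ q)
reindex-↭ (prep e p)  = record
  { to       = λ { (a ∷ c) → a ∷ to r c }
  ; to-~     = λ { (a ∷ c) → ~-++ {D = replicate (suc a) e} ~-refl (to-~ r c) }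
  ; from     = λ { (a ∷ c) → a ∷ from r c }
  ; from-~   = λ { (a ∷ c) → ~-++ {D = replicate (suc a) e} ~-refl (from-~ r c) }
  ; from-inj = λ { {a ∷ c} {b ∷ d} eq → cong₂ _∷_ (proj₁ (∷-inj eq)) (from-inj r (proj₂ (∷-inj eq))) }
  }
  where r = reindex-↭ p
reindex-↭ (swap e f p) = record
  { to       = λ { (a ∷ b ∷ c) → b ∷ a ∷ to r c }
  ; to-~     = λ { (a ∷ b ∷ c) → swap-~ f b e a (to-~ r c) }
  ; from     = λ { (b ∷ a ∷ c) → a ∷ b ∷ from r c }
  ; from-~   = λ { (b ∷ a ∷ c) → swap-~ e a f b (from-~ r c) }
  ; from-inj = λ { {b ∷ a ∷ c} {b′ ∷ a′ ∷ c′} eq → case ∷-inj eq of λ { (refl , eq′) →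
                   cong₂ (λ x y → x ∷ a ∷ y) (proj₁ (∷-inj eq′)) (from-inj r (proj₂ (∷-inj eq′))) } }
  }
  where
  r = reindex-↭ p
  swap-~ : ∀ e a f b {D E : Graph _} → D ~ E →
           replicate (suc a) e ++ replicate (suc b) f ++ D ~ replicate (suc b) f ++ replicate (suc a) e ++ E
  swap-~ e a f b {D} {E} D~E .at φ = begin
    pairing φ (A ++ B ++ D)
      ≡⟨ trans (pairing-++ φ A (B ++ D)) (cong (λ t → pairing φ A ℤ.+ t) (pairing-++ φ B D)) ⟩
    pairing φ A ℤ.+ (pairing φ B ℤ.+ pairing φ D)
      ≡⟨ exchange (pairing φ A) (pairing φ B) (pairing φ D) ⟩
    pairing φ B ℤ.+ (pairing φ A ℤ.+ pairing φ D)
      ≡⟨ cong (λ t → pairing φ B ℤ.+ (pairing φ A ℤ.+ t)) (at D~E φ) ⟩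
    pairing φ B ℤ.+ (pairing φ A ℤ.+ pairing φ E)
      ≡⟨ sym (trans (pairing-++ φ B (A ++ E)) (cong (λ t → pairing φ B ℤ.+ t) (pairing-++ φ A E))) ⟩
    pairing φ (B ++ A ++ E) ∎
    where
    open ≡-Reasoning
    A = replicate (suc a) e
    B = replicate (suc b) f

bagᴾOf : (Gs : List (Graph n)) → Any Flow Gs → Graph n
bagᴾOf Gs q = bagᴾ q

there-injective : ∀ {G : Graph n} {Gs} {p q : Any Flow Gs} →
                  _≡_ {A = Any Flow (G ∷ Gs)} (there p) (there q) → p ≡ q
there-injective refl = refl

here-injective : ∀ {G : Graph n} {Gs} {p q : Flow G} →
                 _≡_ {A = Any Flow (G ∷ Gs)} (here p) (here q) → p ≡ q
here-injective refl = refl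

reindex-∷ : {G H : Graph n} {Gs Hs : List (Graph n)} → Reindex (bagOf G) (bagOf H) →
            Reindex (bagᴾOf Gs) (bagᴾOf Hs) → Reindex (bagᴾOf (G ∷ Gs)) (bagᴾOf (H ∷ Hs))
reindex-∷ r s = record
  { to       = λ { (here c) → here (to r c) ; (there q) → there (to s q) }
  ; to-~     = λ { (here c) → to-~ r c ; (there q) → to-~ s q }
  ; from     = λ { (here c) → here (from r c) ; (there q) → there (from s q) }
  ; from-~   = λ { (here c) → from-~ r c ; (there q) → from-~ s q }
  ; from-inj = λ { {here c}  {here d}  eq → cong here (from-inj r (here-injective eq))
                 ; {there p} {there q} eq → cong there (from-inj s (there-injective eq))
                 ; {here c} {there q} ()
                 ; {there p} {here d} () }
  }

reindex-swap : {G H : Graph n} {Gs : List (Graph n)} →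
               Reindex (bagᴾOf (G ∷ H ∷ Gs)) (bagᴾOf (H ∷ G ∷ Gs))
reindex-swap = record
  { to = exch ; to-~ = exch-~ ; from = exch ; from-~ = exch-~
  ; from-inj = λ {p} {q} eq → trans (sym (exch-invol p)) (trans (cong exch eq) (exch-invol q)) }
  where
  exch : ∀ {G H : Graph _} {Gs} → Any Flow (G ∷ H ∷ Gs) → Any Flow (H ∷ G ∷ Gs)
  exch (here c)          = there (here c)
  exch (there (here c))  = here c
  exch (there (there q)) = there (there q)
  exch-~ : ∀ {G H : Graph _} {Gs} (q : Any Flow (G ∷ H ∷ Gs)) → bagᴾ (exch q) ~ bagᴾ q
  exch-~ (here c)          = ~-refl
  exch-~ (there (here c))  = ~-refl
  exch-~ (there (there q)) = ~-refl
  exch-invol : ∀ {G H : Graph _} {Gs} (q : Any Flow (G ∷ H ∷ Gs)) → exch (exch q) ≡ q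
  exch-invol (here c)          = refl
  exch-invol (there (here c))  = refl
  exch-invol (there (there q)) = refl

-- The power of `β` is forgotten here and recovered at the end from the degree, which reductions
-- preserve.
edgesOf : Monomial n → Graph n
edgesOf []           = []
edgesOf (x[ e ] ∷ M) = e ∷ edgesOf M
edgesOf (β ∷ M)      = edgesOf M

edgesOf-↭ : {M N : Monomial n} → M ↭ N → edgesOf M ↭ edgesOf N
edgesOf-↭ ↭.refl                   = ↭.refl
edgesOf-↭ (prep x[ e ] p)          = prep e (edgesOf-↭ p)
edgesOf-↭ (prep β p)               = edgesOf-↭ p
edgesOf-↭ (swap x[ e ] x[ f ] p)   = swap e f (edgesOf-↭ p)
edgesOf-↭ (swap x[ e ] β p)        = prep e (edgesOf-↭ p)
edgesOf-↭ (swap β x[ f ] p)        = prep f (edgesOf-↭ p)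
edgesOf-↭ (swap β β p)             = edgesOf-↭ p
edgesOf-↭ (↭.trans p q)              = ↭.trans (edgesOf-↭ p) (edgesOf-↭ q)

edgesOf-m : (G : Graph n) → edgesOf m[ G ] ≡ G
edgesOf-m []      = refl
edgesOf-m (e ∷ G) = cong (e ∷_) (edgesOf-m G)

Flows : (P : Polynomial n) → Any Flow (map edgesOf P) → Graph n
Flows P = bagᴾOf (map edgesOf P)

reindex-≈ : {P Q : Polynomial n} → P ≈ Q → Reindex (Flows P) (Flows Q)
reindex-≈ (H.refl pw)    = pointwise pw
  where
  pointwise : {P Q : Polynomial _} → Pointwise _↭_ P Q → Reindex (Flows P) (Flows Q)
  pointwise []       = reindex-refl
  pointwise (p ∷ ps) = reindex-∷ (reindex-↭ (edgesOf-↭ p)) (pointwise ps)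
reindex-≈ (H.prep p ps)  = reindex-∷ (reindex-↭ (edgesOf-↭ p)) (reindex-≈ ps)
reindex-≈ (H.swap p q r) =
  reindex-trans (reindex-∷ (reindex-↭ (edgesOf-↭ p)) (reindex-∷ (reindex-↭ (edgesOf-↭ q)) (reindex-≈ r)))
                reindex-swap
reindex-≈ (H.trans p q)  = reindex-trans (reindex-≈ p) (reindex-≈ q)

-- With cᵢⱼ and cⱼₖ the two values on a reduced pair, the three new monomials
-- correspond to cᵢⱼ > cⱼₖ, cᵢⱼ < cⱼₖ and cᵢⱼ = cⱼₖ.
module _ {i j k : Vertex n} (i<j : i < j) (j<k : j < k) (N : Graph n) (R : List (Graph n)) where
  private
    ij = edge i j i<j
    jk = edge j k j<k
    ik = edge i k (<-trans i<j j<k)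
    Old New : List (Graph n)
    Old = (ij ∷ jk ∷ N) ∷ R
    New = (ik ∷ ij ∷ N) ∷ (jk ∷ ik ∷ N) ∷ (ik ∷ N) ∷ R

    to′ : Any Flow Old → Any Flow New
    to′ (there q)               = there (there (there q))
    to′ (here (a ∷ b ∷ c)) with ℕ.compare a b
    ... | ℕ.less a d    = there (here (d ∷ a ∷ c))
    ... | ℕ.equal a     = there (there (here (a ∷ c)))
    ... | ℕ.greater b d = here (b ∷ d ∷ c)

    from′ : Any Flow New → Any Flow Old
    -- The entries `a` and `b` stand for a+1 and b+1, so the sum a+b+2 of the two flows has the
    -- entry `suc (a + b)`.
    from′ (here (a ∷ b ∷ c))         = here (suc (a ℕ.+ b) ∷ a ∷ c)
    from′ (there (here (b ∷ a ∷ c))) = here (a ∷ suc (a ℕ.+ b) ∷ c)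
    from′ (there (there (here (a ∷ c)))) = here (a ∷ a ∷ c)
    from′ (there (there (there q)))  = there q

    three : ∀ φ m e p f (D : Graph n) → pairing φ (replicate m e ++ replicate p f ++ D) ≡
            + m ℤ.* drop-in φ e ℤ.+ (+ p ℤ.* drop-in φ f ℤ.+ pairing φ D)
    three φ m e p f D = trans (pairing-++ φ (replicate m e) _)
      (cong₂ ℤ._+_ (pairing-replicate φ m e)
        (trans (pairing-++ φ (replicate p f) D) (cong (ℤ._+ _) (pairing-replicate φ p f))))

    two : ∀ φ m e (D : Graph n) → pairing φ (replicate m e ++ D) ≡ + m ℤ.* drop-in φ e ℤ.+ pairing φ D
    two φ m e D = trans (pairing-++ φ (replicate m e) D) (cong (ℤ._+ _) (pairing-replicate φ m e))

    split : ∀ a b → + suc (suc (a ℕ.+ b)) ≡ + suc a ℤ.+ + suc b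
    split a b = cong +_ (cong suc (sym (ℕ.+-suc a b)))

    identity₁ : ∀ a b x y z t →
      a ℤ.* (x ℤ.- z) ℤ.+ (b ℤ.* (x ℤ.- y) ℤ.+ t) ≡
      (a ℤ.+ b) ℤ.* (x ℤ.- y) ℤ.+ (a ℤ.* (y ℤ.- z) ℤ.+ t)
    identity₁ = solve-∀

    identity₂ : ∀ a b x y z t →
      b ℤ.* (y ℤ.- z) ℤ.+ (a ℤ.* (x ℤ.- z) ℤ.+ t) ≡
      a ℤ.* (x ℤ.- y) ℤ.+ ((a ℤ.+ b) ℤ.* (y ℤ.- z) ℤ.+ t)
    identity₂ = solve-∀

    identity₃ : ∀ a x y z t →
      a ℤ.* (x ℤ.- z) ℤ.+ t ≡ a ℤ.* (x ℤ.- y) ℤ.+ (a ℤ.* (y ℤ.- z) ℤ.+ t)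
    identity₃ = solve-∀

    from′-~ : ∀ q → bagᴾ (from′ q) ~ bagᴾ q
    from′-~ (here (a ∷ b ∷ c)) .at φ = sym (trans (three φ (suc a) ik (suc b) ij (bag c))
      (trans (identity₁ (+ suc a) (+ suc b) (φ i) (φ j) (φ k) _)
        (trans (cong (λ t → t ℤ.* drop-in φ ij ℤ.+ (+ suc a ℤ.* drop-in φ jk ℤ.+ pairing φ (bag c)))
                     (sym (split a b)))
          (sym (three φ (suc (suc (a ℕ.+ b))) ij (suc a) jk (bag c))))))
    from′-~ (there (here (b ∷ a ∷ c))) .at φ = sym (trans (three φ (suc b) jk (suc a) ik (bag c))
      (trans (identity₂ (+ suc a) (+ suc b) (φ i) (φ j) (φ k) _)
        (trans (cong (λ t → + suc a ℤ.* drop-in φ ij ℤ.+ (t ℤ.* drop-in φ jk ℤ.+ pairing φ (bag c)))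
                     (sym (split a b)))
          (sym (three φ (suc a) ij (suc (suc (a ℕ.+ b))) jk (bag c))))))
    from′-~ (there (there (here (a ∷ c)))) .at φ = sym (trans (two φ (suc a) ik (bag c))
      (trans (identity₃ (+ suc a) (φ i) (φ j) (φ k) _) (sym (three φ (suc a) ij (suc a) jk (bag c)))))
    from′-~ (there (there (there q))) .at φ = refl

    from∘to : ∀ q → from′ (to′ q) ≡ q
    from∘to (there q) = refl
    from∘to (here (a ∷ b ∷ c)) with ℕ.compare a b
    ... | ℕ.less a d    = refl
    ... | ℕ.equal a     = refl
    ... | ℕ.greater b d = refl

    pair-inj : ∀ {a b a′ b′ : ℕ} {c c′ : Flow N} →
               _≡_ {A = Any Flow Old} (here (a ∷ b ∷ c)) (here (a′ ∷ b′ ∷ c′)) →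
               a ≡ a′ × b ≡ b′ × c ≡ c′
    pair-inj refl = refl , refl , refl

    exceeds : ∀ a b → suc (a ℕ.+ b) ≢ a
    exceeds a b eq = ℕ.<⇒≢ (ℕ.s≤s (ℕ.m≤m+n a b)) (sym eq)

    crossed : ∀ a b a′ b′ → suc (a ℕ.+ b) ≡ a′ → a ≢ suc (a′ ℕ.+ b′)
    crossed a b a′ b′ p q =
      ℕ.<-asym (ℕ.≤-trans (ℕ.s≤s (ℕ.m≤m+n a b)) (ℕ.≤-reflexive p))
               (ℕ.≤-trans (ℕ.s≤s (ℕ.m≤m+n a′ b′)) (ℕ.≤-reflexive (sym q)))

    from′-inj : ∀ {q q′} → from′ q ≡ from′ q′ → q ≡ q′
    from′-inj {here (a ∷ b ∷ c)} {here (a′ ∷ b′ ∷ c′)} eq with pair-inj eq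
    ... | p , refl , refl = cong (λ t → here (a ∷ t ∷ c)) (ℕ.+-cancelˡ-≡ a _ _ (ℕ.suc-injective p))
    from′-inj {here (a ∷ b ∷ c)} {there (here (b′ ∷ a′ ∷ c′))} eq with pair-inj eq
    ... | p , q , _ = contradiction q (crossed a b a′ b′ p)
    from′-inj {here (a ∷ b ∷ c)} {there (there (here (a′ ∷ c′)))} eq with pair-inj eq
    ... | p , refl , _ = contradiction p (exceeds a b)
    from′-inj {there (here (b ∷ a ∷ c))} {here (a′ ∷ b′ ∷ c′)} eq with pair-inj eq
    ... | p , q , _ = contradiction (sym q) (crossed a′ b′ a b (sym p))
    from′-inj {there (here (b ∷ a ∷ c))} {there (here (b′ ∷ a′ ∷ c′))} eq with pair-inj eq
    ... | refl , p , refl =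
      cong (λ t → there (here (t ∷ a ∷ c))) (ℕ.+-cancelˡ-≡ a _ _ (ℕ.suc-injective p))
    from′-inj {there (here (b ∷ a ∷ c))} {there (there (here (a′ ∷ c′)))} eq with pair-inj eq
    ... | refl , p , _ = contradiction p (exceeds a b)
    from′-inj {there (there (here (a ∷ c)))} {here (a′ ∷ b′ ∷ c′)} eq with pair-inj eq
    ... | p , refl , _ = contradiction (sym p) (exceeds a′ b′)
    from′-inj {there (there (here (a ∷ c)))} {there (here (b′ ∷ a′ ∷ c′))} eq with pair-inj eq
    ... | refl , p , _ = contradiction (sym p) (exceeds a b′)
    from′-inj {there (there (here (a ∷ c)))} {there (there (here (a′ ∷ c′)))} eq with pair-inj eq
    ... | refl , _ , refl = refl
    from′-inj {there (there (there q))} {there (there (there q′))} eq =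
      cong (λ t → there (there (there t))) (there-injective eq)
    from′-inj {here (_ ∷ _ ∷ _)} {there (there (there _))} ()
    from′-inj {there (here (_ ∷ _ ∷ _))} {there (there (there _))} ()
    from′-inj {there (there (here (_ ∷ _)))} {there (there (there _))} ()
    from′-inj {there (there (there _))} {here (_ ∷ _ ∷ _)} ()
    from′-inj {there (there (there _))} {there (here (_ ∷ _ ∷ _))} ()
    from′-inj {there (there (there _))} {there (there (here (_ ∷ _)))} ()

  reindex-⟶ : Reindex (bagᴾOf Old) (bagᴾOf New)
  reindex-⟶ = record
    { to       = to′
    ; to-~     = λ q → ~-trans (~-sym (from′-~ (to′ q)))
                   (subst (λ p → bagᴾ (from′ (to′ q)) ~ bagᴾ p) (from∘to q) ~-refl)
    ; from     = from′
    ; from-~   = from′-~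
    ; from-inj = from′-inj
    }

reindex-⟶* : {P Q : Polynomial n} → P ⟶* Q → Reindex (Flows P) (Flows Q)
reindex-⟶* ε = reindex-refl
reindex-⟶* (reduce i<j j<k N R P≈ Q≈ ◅ steps) =
  reindex-trans (reindex-≈ P≈)
    (reindex-trans (reindex-⟶ i<j j<k (edgesOf N) (map edgesOf R))
      (reindex-trans (reindex-≈ (H.sym ↭-sym Q≈)) (reindex-⟶* steps)))

-- Counting alternating flows

module _ {A : Set} where

  ∈⇒↭ : ∀ {x : A} {xs} → x ∈ xs → ∃[ ys ] xs ↭ x ∷ ys
  ∈⇒↭ {x} x∈ with as , bs , refl ← ∈-∃++ x∈ = as ++ bs , shift x as bs

  unique-⊆⇒length≤ : ∀ {xs ys : List A} → Unique xs → (∀ {x} → x ∈ xs → x ∈ ys) →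
                     length xs ℕ.≤ length ys
  unique-⊆⇒length≤ []       ⊆ = z≤n
  unique-⊆⇒length≤ {x ∷ xs} (x∉ ∷ u) ⊆ with zs , p ← ∈⇒↭ (⊆ (here refl)) =
    ℕ.≤-trans (s≤s (unique-⊆⇒length≤ u λ y∈ → other y∈ (∈-resp-↭ p (⊆ (there y∈)))))
              (ℕ.≤-reflexive (sym (↭-length p)))
    where
    other : ∀ {y} → y ∈ xs → y ∈ x ∷ zs → y ∈ zs
    other y∈ (here refl) = contradiction refl (All.lookup x∉ y∈)
    other y∈ (there y∈′) = y∈′

  minimal : (μ : A → ℕ) {P : Pred A 0ℓ} → Decidable P → ∀ {xs} → Any P xs →
            ∃[ x ] x ∈ xs × P x × (∀ {y} → y ∈ xs → P y → μ x ℕ.≤ μ y)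
  minimal μ {P} P? {x ∷ xs} any with Any.any? P? xs
  ... | no ¬any = x , here refl , at-head any , λ
    { (here refl) _ → ℕ.≤-refl
    ; (there y∈) py → contradiction (lose y∈ py) ¬any }
    where
    at-head : Any P (x ∷ xs) → P x
    at-head (here px)   = px
    at-head (there pxs) = contradiction pxs ¬any
  ... | yes any′ with y , y∈ , py , least ← minimal μ P? any′ with P? x
  ...   | no ¬px = y , there y∈ , py , λ
    { (here refl) pz → contradiction pz ¬px ; (there z∈) pz → least z∈ pz }
  ...   | yes px with ℕ.≤-total (μ x) (μ y)
  ...     | inj₁ x≤y = x , here refl , px , λ
    { (here refl) _ → ℕ.≤-refl ; (there z∈) pz → ℕ.≤-trans x≤y (least z∈ pz) }
  ...     | inj₂ y≤x = y , there y∈ , py , λ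
    { (here refl) _ → y≤x ; (there z∈) pz → least z∈ pz }

-- For positive arguments this is the binomial coefficient of r-1 over k-1. The recursion asks
-- whether the first part is 1 or can be lowered by 1.
compositions : ℕ → ℕ → ℕ
compositions zero    zero    = 1
compositions zero    (suc k) = 0
compositions (suc r) zero    = 0
compositions (suc r) (suc k) = compositions r k ℕ.+ compositions r (suc k)

compositions-diagonal : ∀ k → 1 ℕ.≤ compositions k k
compositions-diagonal zero    = s≤s z≤n
compositions-diagonal (suc k) = ℕ.≤-trans (compositions-diagonal k) (ℕ.m≤m+n _ _)

compositions-positive : ∀ r k → 1 ℕ.≤ compositions r k → k ℕ.≤ r
compositions-positive r       zero    _ = z≤n
compositions-positive (suc r) (suc k) p with compositions r k in eq
... | suc _ = s≤s (compositions-positive r k (subst (1 ℕ.≤_) (sym eq) (s≤s z≤n)))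
... | zero  = ℕ.m≤n⇒m≤1+n (compositions-positive r (suc k) p)

total : ℕ → List ℕ → ℕ
total r ks = sum (map (compositions r) ks)

total-↭ : ∀ r {ks ls} → ks ↭ ls → total r ks ≡ total r ls
total-↭ r p = sum-↭ (map⁺ (compositions r) p)

total-∈ : ∀ {k ks} → k ∈ ks → 1 ℕ.≤ total k ks
total-∈ {k} {ks} k∈ with _ , p ← ∈⇒↭ k∈ =
  subst (1 ℕ.≤_) (sym (total-↭ k p)) (ℕ.≤-trans (compositions-diagonal k) (ℕ.m≤m+n _ _))

total-positive : ∀ r ks → 1 ℕ.≤ total r ks → ∃[ k ] k ∈ ks × k ℕ.≤ r
total-positive r (k ∷ ks) p with compositions r k in eq
... | suc _ = k , here refl , compositions-positive r k (subst (1 ℕ.≤_) (sym eq) (s≤s z≤n))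
... | zero with l , l∈ , l≤r ← total-positive r ks p = l , there l∈ , l≤r

-- compositions is unitriangular, so the smallest size can be split off.
total-injective : ∀ ks ls → (∀ r → total r ks ≡ total r ls) → ks ↭ ls
total-injective ks ls = go (length ks) ks refl ls
  where
  go : ∀ m ks → length ks ≡ m → ∀ ls → (∀ r → total r ks ≡ total r ls) → ks ↭ ls
  go m       []       _  []       eq = ↭-refl
  go m       []       _  (l ∷ ls) eq =
    contradiction (subst (1 ℕ.≤_) (sym (eq l)) (total-∈ {l} {l ∷ ls} (here refl))) λ ()
  go (suc m) ks@(_ ∷ _) len ls eq
    -- The least size `k` of `ks` makes the total at `k` positive, so `ls` has a size `l` at most
    -- `k`; symmetrically `ks` has a size `j` at most `l`. Minimality of `k` then forces `l` and `k`
    -- to agree.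
    with k , k∈ , _ , least ← minimal id {λ _ → ⊤} (λ _ → yes tt) {ks} (here tt)
    with l , l∈ , l≤k ← total-positive k ls (subst (1 ℕ.≤_) (eq k) (total-∈ k∈))
    with j , j∈ , j≤l ← total-positive l ks (subst (1 ℕ.≤_) (sym (eq l)) (total-∈ l∈))
    with refl ← ℕ.≤-antisym l≤k (ℕ.≤-trans (least j∈ tt) j≤l)
    with ks′ , p ← ∈⇒↭ k∈ | ls′ , q ← ∈⇒↭ l∈ =
    ↭-trans p (↭-trans (prep k (go m ks′ (ℕ.suc-injective (trans (sym (↭-length p)) len)) ls′ λ r →
      ℕ.+-cancelˡ-≡ (compositions r k) _ _
        (trans (sym (total-↭ r p)) (trans (eq r) (total-↭ r q))))) (↭-sym q))

-- Enumeration of positive flows and comparison of models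

increment : ∀ {e} {G : Graph n} → Flow (e ∷ G) → Flow (e ∷ G)
increment (a ∷ c) = suc a ∷ c

-- The recursion copies that of `compositions`: the first edge carries flow 1, which is the entry 0,
-- or its flow can be lowered.
flows : ℕ → (G : Graph n) → List (Flow G)
flows zero    []      = [] ∷ []
flows (suc r) []      = []
flows zero    (e ∷ G) = []
flows (suc r) (e ∷ G) = map (0 ∷_) (flows r G) ++ map increment (flows r (e ∷ G))

length-flows : ∀ r (G : Graph n) → length (flows r G) ≡ compositions r (length G)
length-flows zero    []      = refl
length-flows (suc r) []      = refl
length-flows zero    (e ∷ G) = refl
length-flows (suc r) (e ∷ G) = trans (length-++ (map (0 ∷_) (flows r G)))
  (cong₂ ℕ._+_ (trans (length-map (0 ∷_) (flows r G)) (length-flows r G))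
               (trans (length-map increment (flows r (e ∷ G))) (length-flows r (e ∷ G))))

unique-flows : ∀ r (G : Graph n) → Unique (flows r G)
unique-flows zero    []      = [] ∷ []
unique-flows (suc r) []      = []
unique-flows zero    (e ∷ G) = []
unique-flows (suc r) (e ∷ G) = Unique.++⁺
  (Unique.map⁺ (proj₂ ∘ ∷-inj) (unique-flows r G))
  (Unique.map⁺ (λ { {_ ∷ _} {_ ∷ _} refl → refl }) (unique-flows r (e ∷ G)))
  λ (p , q) → case ∈-map⁻ (0 ∷_) p , ∈-map⁻ increment q of λ
    { ((_ , _ , refl) , ((_ ∷ _) , _ , ())) }

∈-flows : ∀ {G : Graph n} (c : Flow G) → c ∈ flows (length (bag c)) G
∈-flows c = go _ c refl
  where
  go : ∀ r {G : Graph n} (c : Flow G) → length (bag c) ≡ r → c ∈ flows r G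
  go zero    []          eq = here refl
  go (suc r) (zero ∷ c)  eq = ∈-++⁺ˡ (∈-map⁺ (0 ∷_) (go r c (ℕ.suc-injective eq)))
  go (suc r) {e ∷ G} (suc a ∷ c) eq =
    ∈-++⁺ʳ (map (0 ∷_) (flows r G)) (∈-map⁺ increment (go r (a ∷ c) (ℕ.suc-injective eq)))

∈-flows⁻ : ∀ r {G : Graph n} {c : Flow G} → c ∈ flows r G → length (bag c) ≡ r
∈-flows⁻ zero    {[]}    (here refl) = refl
∈-flows⁻ (suc r) {e ∷ G} c∈ with ∈-++⁻ (map (0 ∷_) (flows r G)) c∈
... | inj₁ p with d , d∈ , refl ← ∈-map⁻ (0 ∷_) p = cong suc (∈-flows⁻ r d∈)
... | inj₂ p with (a ∷ d) , d∈ , refl ← ∈-map⁻ increment p = cong suc (∈-flows⁻ r d∈)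

hereᶠ : {G : Graph n} {Gs : List (Graph n)} → Flow G → Any Flow (G ∷ Gs)
hereᶠ = here

thereᶠ : {G : Graph n} {Gs : List (Graph n)} → Any Flow Gs → Any Flow (G ∷ Gs)
thereᶠ = there

flowsᴾ : ℕ → (Gs : List (Graph n)) → List (Any Flow Gs)
flowsᴾ r []       = []
flowsᴾ r (G ∷ Gs) = map hereᶠ (flows r G) ++ map thereᶠ (flowsᴾ r Gs)

length-flowsᴾ : ∀ r (Gs : List (Graph n)) → length (flowsᴾ r Gs) ≡ total r (map length Gs)
length-flowsᴾ r []       = refl
length-flowsᴾ r (G ∷ Gs) = trans (length-++ (map hereᶠ (flows r G)))
  (cong₂ ℕ._+_ (trans (length-map hereᶠ (flows r G)) (length-flows r G))
               (trans (length-map thereᶠ (flowsᴾ r Gs)) (length-flowsᴾ r Gs)))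

unique-flowsᴾ : ∀ r (Gs : List (Graph n)) → Unique (flowsᴾ r Gs)
unique-flowsᴾ r []       = []
unique-flowsᴾ r (G ∷ Gs) = Unique.++⁺
  (Unique.map⁺ here-injective (unique-flows r G))
  (Unique.map⁺ there-injective (unique-flowsᴾ r Gs))
  λ (p , q) → case ∈-map⁻ hereᶠ p , ∈-map⁻ thereᶠ q of λ { ((_ , _ , refl) , (_ , _ , ())) }

∈-flowsᴾ : ∀ {Gs : List (Graph n)} (q : Any Flow Gs) → q ∈ flowsᴾ (length (bagᴾ q)) Gs
∈-flowsᴾ (here c) = ∈-++⁺ˡ (∈-map⁺ hereᶠ (∈-flows c))
∈-flowsᴾ {Gs = G ∷ _} (there q) = ∈-++⁺ʳ (map hereᶠ (flows (length (bagᴾ q)) G)) (∈-map⁺ thereᶠ (∈-flowsᴾ q))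

∈-flowsᴾ⁻ : ∀ r {Gs : List (Graph n)} {q : Any Flow Gs} → q ∈ flowsᴾ r Gs → length (bagᴾ q) ≡ r
∈-flowsᴾ⁻ r {G ∷ Gs} q∈ with ∈-++⁻ (map hereᶠ (flows r G)) q∈
... | inj₁ p with _ , c∈ , refl ← ∈-map⁻ hereᶠ p = ∈-flows⁻ r c∈
... | inj₂ p with _ , c∈ , refl ← ∈-map⁻ thereᶠ p = ∈-flowsᴾ⁻ r c∈

-- Every vector Σ c_e (e_i − e_j) with c positive on T arises from exactly one
-- member of Gs and exactly one positive flow on it.
record Model (T : Graph n) (Gs : List (Graph n)) : Set where
  field
    onto   : ∀ (c : Flow T) → ∃[ q ] bagᴾ {Gs = Gs} q ~ bag c
    into   : ∀ (q : Any Flow Gs) → ∃[ c ] bagᴾ q ~ bag {G = T} c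
    unique : ∀ {q q′ : Any Flow Gs} → bagᴾ q ~ bagᴾ q′ → q ≡ q′
open Model

indicator : (Vertex n → Bool) → Vertex n → ℤ
indicator χ v = if χ v then + 1 else + 0

drop-in≤1 : ∀ χ (e : Edge n) → drop-in (indicator χ) e ℤ.≤ + 1
drop-in≤1 χ e with χ (src e) | χ (tgt e)
... | true  | true  = ℤ.+≤+ z≤n
... | true  | false = ℤ.+≤+ (s≤s z≤n)
... | false | true  = ℤ.-≤+
... | false | false = ℤ.+≤+ z≤n

pairing≤length : ∀ χ (D : Graph n) → pairing (indicator χ) D ℤ.≤ + length D
pairing≤length χ []      = ℤ.+≤+ z≤n
pairing≤length χ (e ∷ D) = ℤ.+-mono-≤ (drop-in≤1 χ e) (pairing≤length χ D)

pairing≡length : ∀ χ (D : Graph n) → (∀ {e} → e ∈ D → χ (src e) ≡ true × χ (tgt e) ≡ false) →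
                 pairing (indicator χ) D ≡ + length D
pairing≡length χ []      h = refl
pairing≡length χ (e ∷ D) h with χ (src e) | χ (tgt e) | h (here refl)
... | true | false | _ = cong (λ t → + 1 ℤ.+ t) (pairing≡length χ D (h ∘ there))

-- Pairing with the indicator of the sources of D gives |D| for an alternating
-- D, and at most the cardinality for any bag.
alternating⇒length≤ : {D E : Graph n} → Alternating D → D ~ E → length D ℕ.≤ length E
alternating⇒length≤ {n} {D} {E} alt D~E = ℤ.drop‿+≤+
  (ℤ.≤-trans (ℤ.≤-reflexive (trans (sym (pairing≡length χ D sides)) (at D~E _))) (pairing≤length χ E))
  where
  source? : Decidable (λ v → Any (λ e → src e ≡ v) D)
  source? v = Any.any? (λ e → src e ≟ v) D
  χ : Vertex n → Bool
  χ v = does (source? v)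
  sides : ∀ {e} → e ∈ D → χ (src e) ≡ true × χ (tgt e) ≡ false
  sides {e} e∈ = dec-true (source? (src e)) (lose e∈ refl) , dec-false (source? (tgt e)) λ s →
    case find s of λ (f , f∈ , eq) → alt e f e∈ f∈ (sym eq)

bag⊆ : ∀ {G : Graph n} (c : Flow G) {e} → e ∈ bag c → e ∈ G
bag⊆ {G = g ∷ G} (a ∷ c) e∈ with ∈-++⁻ (replicate (suc a) g) e∈
... | inj₁ p = here (replicated (suc a) p)
  where
  replicated : ∀ m {e} → e ∈ replicate m g → e ≡ g
  replicated (suc m) (here refl) = refl
  replicated (suc m) (there p)   = replicated m p
... | inj₂ p = there (bag⊆ c p)

alternating-⊆ : {D E : Graph n} → (∀ {e} → e ∈ D → e ∈ E) → Alternating E → Alternating D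
alternating-⊆ ⊆ alt e f e∈ f∈ = alt e f (⊆ e∈) (⊆ f∈)

noncrossing-⊆ : {D E : Graph n} → (∀ {e} → e ∈ D → e ∈ E) → NonCrossing E → NonCrossing D
noncrossing-⊆ ⊆ nc e f e∈ f∈ = nc e f (⊆ e∈) (⊆ f∈)

alternating-bagᴾ : {Gs : List (Graph n)} → All Alternating Gs → (q : Any Flow Gs) →
                   Alternating (bagᴾ q)
alternating-bagᴾ (alt ∷ _)  (here c)  = alternating-⊆ (bag⊆ c) alt
alternating-bagᴾ (_ ∷ alts) (there q) = alternating-bagᴾ alts q

module _ {T : Graph n} {Gs Hs : List (Graph n)} (M : Model T Gs) (N : Model T Hs)
         (altG : All Alternating Gs) (altH : All Alternating Hs) where

  private
    transfer : (q : Any Flow Gs) → ∃[ q′ ] bagᴾ {Gs = Hs} q′ ~ bagᴾ q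
    transfer q with c , q~c ← into M q with q′ , q′~c ← onto N c = q′ , ~-trans q′~c (~-sym q~c)

    τ : Any Flow Gs → Any Flow Hs
    τ q = proj₁ (transfer q)

    τ-injective : ∀ {p q} → τ p ≡ τ q → p ≡ q
    τ-injective {p} {q} eq = unique M (~-trans (~-sym (proj₂ (transfer p)))
      (subst (λ t → bagᴾ t ~ bagᴾ q) (sym eq) (proj₂ (transfer q))))

    length-τ : ∀ q → length (bagᴾ (τ q)) ≡ length (bagᴾ q)
    length-τ q = ℕ.≤-antisym
      (alternating⇒length≤ (alternating-bagᴾ altH (τ q)) (proj₂ (transfer q)))
      (alternating⇒length≤ (alternating-bagᴾ altG q) (~-sym (proj₂ (transfer q))))

  -- Going from `Gs` to `T` and on to `Hs` is injective because `Gs` has one flow per vector. It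
  -- keeps the total because both ends are alternating, so the flows of total `r` on `Gs` embed into
  -- those on `Hs`.
  total≤ : ∀ r → total r (map length Gs) ℕ.≤ total r (map length Hs)
  total≤ r = subst₂ ℕ._≤_ (trans (length-map τ (flowsᴾ r Gs)) (length-flowsᴾ r Gs)) (length-flowsᴾ r Hs)
    (unique-⊆⇒length≤ (Unique.map⁺ τ-injective (unique-flowsᴾ r Gs)) λ q∈ →
      case ∈-map⁻ τ q∈ of λ { (q , q∈ , refl) →
        subst (λ s → τ q ∈ flowsᴾ s Hs) (trans (length-τ q) (∈-flowsᴾ⁻ r q∈)) (∈-flowsᴾ (τ q)) })

alternating-models : ∀ {T : Graph n} {Gs Hs} → Model T Gs → Model T Hs →
                     All Alternating Gs → All Alternating Hs → map length Gs ↭ map length Hs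
alternating-models M N altG altH = total-injective _ _ λ r →
  ℕ.≤-antisym (total≤ M N altG altH r) (total≤ N M altH altG r)

model-reindex : ∀ {T : Graph n} {Gs Hs} → Model T Gs → Reindex (bagᴾOf Gs) (bagᴾOf Hs) → Model T Hs
model-reindex M r .onto c with q , q~c ← onto M c = to r q , ~-trans (to-~ r q) q~c
model-reindex M r .into q with c , q~c ← into M (from r q) = c , ~-trans (~-sym (from-~ r q)) q~c
model-reindex M r .unique {q} {q′} q~q′ =
  from-inj r (unique M (~-trans (from-~ r q) (~-trans q~q′ (~-sym (from-~ r q′)))))

-- Forests and cuts

joins-sym : ∀ {e : Edge n} {u v} → Joins e u v → Joins e v u
joins-sym = Sum.swap

edge-≡ : {e f : Edge n} → src e ≡ src f → tgt e ≡ tgt f → e ≡ f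
edge-≡ refl refl = refl

joins-injective : ∀ {e f : Edge n} {u v} → Joins e u v → Joins f u v → e ≡ f
joins-injective (inj₁ (refl , refl)) (inj₁ (p , q)) = sym (edge-≡ p q)
joins-injective (inj₂ (refl , refl)) (inj₂ (p , q)) = sym (edge-≡ p q)
joins-injective {e = e} {f} (inj₁ (refl , refl)) (inj₂ (p , q)) =
  contradiction (subst₂ _<_ p q (src<tgt! f)) (ℕ.<-asym (src<tgt! e))
joins-injective {e = e} {f} (inj₂ (refl , refl)) (inj₁ (p , q)) =
  contradiction (subst₂ _<_ p q (src<tgt! f)) (ℕ.<-asym (src<tgt! e))

adj-sym : ∀ {G : Graph n} {u v} → Adj G u v → Adj G v u
adj-sym = Any.map λ {e} → joins-sym {e = e}

adj-⊆ : ∀ {G H : Graph n} → (∀ {e} → e ∈ G → e ∈ H) → ∀ {u v} → Adj G u v → Adj H u v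
adj-⊆ ⊆ a with e , e∈ , j ← find a = lose (⊆ e∈) j

adj-edge : ∀ {G : Graph n} {e} → e ∈ G → Adj G (src e) (tgt e)
adj-edge e∈ = lose e∈ (inj₁ (refl , refl))

Connected : Graph n → Vertex n → Vertex n → Set
Connected G = Star (Adj G)

isPath-suffix : ∀ {G : Graph n} {u v vs} → u ∈ vs → last vs ≡ just v → Linked (Adj G) vs →
                Unique vs → ∃[ ws ] IsPath G u ws v
isPath-suffix (here refl) l L U = _ , refl , l , L , U
isPath-suffix {vs = _ ∷ _ ∷ _} (there u∈) l (_ ∷ L) (_ ∷ U) = isPath-suffix u∈ l L U

-- Loop erasure: if the new first vertex already occurs on the path, everything before that
-- occurrence is dropped.
connected⇒path : ∀ {G : Graph n} {u v} → Connected G u v → ∃[ vs ] IsPath G u vs v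
connected⇒path {u = u} ε = u ∷ [] , refl , refl , [-] , [] ∷ []
connected⇒path {u = u} (a ◅ as) with w ∷ ws , refl , l , L , U ← connected⇒path as
  with u ∈? (w ∷ ws)
  where open DecMembership _≟_ using (_∈?_)
... | yes u∈ = isPath-suffix u∈ l L U
... | no  u∉ = u ∷ w ∷ ws , refl , l , a ∷ L , All.¬Any⇒All¬ _ u∉ ∷ U

path⇒connected : ∀ {G : Graph n} {u v vs} → IsPath G u vs v → Connected G u v
path⇒connected {vs = _ ∷ []}     (refl , refl , _ , _)     = ε
path⇒connected {vs = _ ∷ _ ∷ _} (refl , l , a ∷ L , _ ∷ U) = a ◅ path⇒connected (refl , l , L , U)

linked-snoc : ∀ {R : Vertex n → Vertex n → Set} {vs v w} → Linked R vs → last vs ≡ just v → R v w →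
              Linked R (vs ++ w ∷ [])
linked-snoc {vs = _ ∷ []}     [-]     refl r = r ∷ [-]
linked-snoc {vs = _ ∷ _ ∷ _} (a ∷ L) l    r = a ∷ linked-snoc L l r

-- A path in `G` between the ends of `e` is closed up by `e`. It has at least three vertices, since
-- a path with two would use `e` itself.
cycle : ∀ {T G : Graph n} {e} → e ∈ T → (∀ {f} → f ∈ G → f ∈ T × f ≢ e) →
        Connected G (src e) (tgt e) → ∃[ vs ] IsCycle T vs
cycle {e = e} e∈ G⊆ c with connected⇒path c
... | _ ∷ [] , refl , l , _ = contradiction (just-injective l) (ℕ.<⇒≢ (src<tgt! e) ∘ cong toℕ)
... | _ ∷ _ ∷ [] , refl , refl , a ∷ _ , _ with f , f∈ , j ← find a =
  contradiction (joins-injective j (inj₁ (refl , refl))) (proj₂ (G⊆ f∈))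
... | vs@(_ ∷ _ ∷ _ ∷ _) , refl , l , L , U =
  vs , s≤s (s≤s (s≤s z≤n)) , U ,
  linked-snoc (Linked.map (adj-⊆ (proj₁ ∘ G⊆)) L) l (adj-sym (adj-edge e∈))

isCycle-⊆ : ∀ {G H : Graph n} {vs} → (∀ {e} → e ∈ G → e ∈ H) → IsCycle G vs → IsCycle H vs
isCycle-⊆ ⊆ (l , U , L) = l , U , Linked.map (adj-⊆ ⊆) L

-- Components, the size of a forest, and cuts

module _ (s t : Vertex n) where
  merge : Vertex n → Vertex n
  merge v = if does (v ≟ t) then s else v

  merge-≡ : ∀ {v} → v ≡ t → merge v ≡ s
  merge-≡ {v} p rewrite dec-true (v ≟ t) p = refl

  merge-≢ : ∀ {v} → v ≢ t → merge v ≡ v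
  merge-≢ {v} p rewrite dec-false (v ≟ t) p = refl

  merge-view : ∀ v → (v ≡ t × merge v ≡ s) ⊎ (v ≢ t × merge v ≡ v)
  merge-view v = case v ≟ t of λ
    { (yes p) → inj₁ (p , merge-≡ p) ; (no p) → inj₂ (p , merge-≢ p) }

-- A canonical vertex of the component of a vertex, by union-find.
rep : Graph n → Vertex n → Vertex n
rep []      v = v
rep (e ∷ G) v = merge (rep G (src e)) (rep G (tgt e)) (rep G v)

rep-edge : ∀ {G : Graph n} {e} → e ∈ G → rep G (src e) ≡ rep G (tgt e)
rep-edge {G = e ∷ G} (here refl) with merge-view (rep G (src e)) (rep G (tgt e)) (rep G (src e))
... | inj₁ (p , _) = cong (merge (rep G (src e)) (rep G (tgt e))) p
... | inj₂ (_ , q) = trans q (sym (merge-≡ _ (rep G (tgt e)) refl))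
rep-edge {G = e ∷ G} (there e∈) = cong (merge _ _) (rep-edge e∈)

rep-adj : ∀ {G : Graph n} {u v} → Adj G u v → rep G u ≡ rep G v
rep-adj a with find a
... | e , e∈ , inj₁ (refl , refl) = rep-edge e∈
... | e , e∈ , inj₂ (refl , refl) = sym (rep-edge e∈)

rep-connected : ∀ {G : Graph n} {u v} → Connected G u v → rep G u ≡ rep G v
rep-connected ε        = refl
rep-connected (a ◅ as) = trans (rep-adj a) (rep-connected as)

connected-rep : ∀ (G : Graph n) v → Connected G v (rep G v)
connected-rep []      v = ε
connected-rep (e ∷ G) v with merge-view (rep G (src e)) (rep G (tgt e)) (rep G v)
... | inj₂ (_ , q) = subst (Connected _ v) (sym q) (Star.map there (connected-rep G v))
... | inj₁ (p , q) = subst (Connected _ v) (sym q)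
  (Star.map there (subst (Connected G v) p (connected-rep G v)) ◅◅
   Star.reverse adj-sym (Star.map there (connected-rep G (tgt e))) ◅◅
   adj-sym (adj-edge (here refl)) ◅ Star.map there (connected-rep G (src e)))

rep≡⇒connected : ∀ (G : Graph n) {u v} → rep G u ≡ rep G v → Connected G u v
rep≡⇒connected G {u} {v} p = connected-rep G u ◅◅
  subst (λ w → Connected G w v) (sym p) (Star.reverse adj-sym (connected-rep G v))

rep-idem : ∀ (G : Graph n) v → rep G (rep G v) ≡ rep G v
rep-idem G v = sym (rep-connected (connected-rep G v))

fixed? : (G : Graph n) (v : Vertex n) → Dec (rep G v ≡ v)
fixed? G v = rep G v ≟ v

-- As `rep G` is idempotent and constant exactly on components, it has one fixed point in each of
-- them; the length of this list is the number of components.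
fixed : Graph n → List (Vertex n)
fixed G = filter (fixed? G) (allFin _)

∈-fixed : ∀ {G : Graph n} {v} → rep G v ≡ v → v ∈ fixed G
∈-fixed {G = G} = ∈-filter⁺ (fixed? G) (∈-allFin _)

∈-fixed⁻ : ∀ {G : Graph n} {v} → v ∈ fixed G → rep G v ≡ v
∈-fixed⁻ {G = G} = proj₂ ∘ ∈-filter⁻ (fixed? G) {xs = allFin _}

unique-fixed : ∀ (G : Graph n) → Unique (fixed G)
unique-fixed G = Unique.filter⁺ (fixed? G) (Unique.allFin⁺ _)

isForest-tail : ∀ {e} {G : Graph n} → IsForest (e ∷ G) → IsForest G
isForest-tail (_ ∷ U , acyclic) = U , λ vs c → acyclic vs (isCycle-⊆ there c)

forest-head : ∀ {e} {G : Graph n} → IsForest (e ∷ G) → rep G (src e) ≢ rep G (tgt e)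
forest-head {e = e} {G} (e∉ ∷ _ , acyclic) p with vs , c ←
  cycle {e = e} (here refl) (λ f∈ → there f∈ , λ { refl → All.lookup e∉ f∈ refl }) (rep≡⇒connected G p) =
  acyclic vs c

-- Components and edges of a forest add up to the number of vertices. A further edge joins two
-- different components, and of the fixed points exactly the representative of its target is lost.
length-fixed : ∀ {G : Graph n} → IsForest G → length (fixed G) ℕ.+ length G ≡ suc n
length-fixed {n} {[]} _ = trans (ℕ.+-identityʳ _) (ℕ.≤-antisym
  (subst (length (fixed {n} []) ℕ.≤_) (length-tabulate {n = suc n} id)
    (unique-⊆⇒length≤ (unique-fixed {n} []) (λ _ → ∈-allFin _)))
  (subst (ℕ._≤ length (fixed {n} [])) (length-tabulate {n = suc n} id)
    (unique-⊆⇒length≤ (Unique.allFin⁺ (suc n)) (λ _ → ∈-fixed {G = []} refl))))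
length-fixed {n} {e ∷ G} forest = trans (ℕ.+-suc _ (length G))
  (trans (cong (ℕ._+ length G) (ℕ.≤-antisym (unique-⊆⇒length≤ (t∉ ∷ unique-fixed (e ∷ G)) shrink)
                                            (unique-⊆⇒length≤ (unique-fixed G) grow)))
         (length-fixed (isForest-tail forest)))
  where
  s = rep G (src e)
  t = rep G (tgt e)
  s≢t : s ≢ t
  s≢t = forest-head forest
  kept : ∀ {v} → rep (e ∷ G) v ≡ v → v ≢ t × rep G v ≡ v
  kept {v} p with merge-view s t (rep G v)
  ... | inj₁ (q , r) = contradiction (trans (sym (rep-idem G (src e)))
                  (trans (cong (rep G) (trans (sym r) p)) q)) s≢t
  ... | inj₂ (q , r) = (λ v≡t → q (trans (trans (sym r) p) v≡t)) , trans (sym r) p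
  t∉ : All (t ≢_) (fixed (e ∷ G))
  t∉ = All.tabulate λ v∈ t≡v → proj₁ (kept (∈-fixed⁻ {G = e ∷ G} v∈)) (sym t≡v)
  shrink : ∀ {v} → v ∈ t ∷ fixed (e ∷ G) → v ∈ fixed G
  shrink (here refl) = ∈-fixed {G = G} (rep-idem G (tgt e))
  shrink (there v∈)  = ∈-fixed {G = G} (proj₂ (kept (∈-fixed⁻ {G = e ∷ G} v∈)))
  grow : ∀ {v} → v ∈ fixed G → v ∈ t ∷ fixed (e ∷ G)
  grow {v} v∈ with v ≟ t
  ... | yes refl = here refl
  ... | no v≢t  = there (∈-fixed {G = e ∷ G} (trans (cong (merge s t) p) (merge-≢ s t v≢t)))
    where
    p : rep G v ≡ v
    p = ∈-fixed⁻ {G = G} v∈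

1≤fixed : ∀ (G : Graph n) → 1 ℕ.≤ length (fixed G)
1≤fixed G with fixed G | ∈-fixed {G = G} (rep-idem G zero)
... | _ ∷ _ | _ = s≤s z≤n

forest-size : ∀ {F : Graph n} → IsForest F → length F ℕ.≤ n
forest-size {F = F} forest = ℕ.+-cancelˡ-≤ 1 _ _
  (ℕ.≤-trans (ℕ.+-monoˡ-≤ (length F) (1≤fixed F)) (ℕ.≤-reflexive (length-fixed forest)))

tree-size : ∀ {T : Graph n} → IsTreeOn (allFin _) T → length T ≡ n
tree-size {T = T} (forest , connected) = ℕ.suc-injective
  (trans (cong (ℕ._+ length T) (ℕ.≤-antisym (1≤fixed T) (unique-⊆⇒length≤ (unique-fixed T) single)))
         (length-fixed forest))
  where
  single : ∀ {v} → v ∈ fixed T → v ∈ rep T zero ∷ []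
  single {v} v∈ = here (trans (sym (∈-fixed⁻ {G = T} v∈))
    (rep-connected (path⇒connected (proj₂ (connected v zero (∈-allFin v) (∈-allFin zero))))))

-- The indicator of `side` drops by 1 along `e` and is constant along all other edges of `T`.
-- Pairing with it therefore reads the flow through `e` off a vector.
record Cut (T : Graph n) (e : Edge n) : Set where
  field
    side       : Vertex n → Bool
    side-src   : side (src e) ≡ true
    side-tgt   : side (tgt e) ≡ false
    side-other : ∀ {f} → f ∈ T → f ≢ e → side (src f) ≡ side (tgt f)

-- The side is the component of the source after deleting `e`; the target cannot lie in it, as `e`
-- would then close a cycle.
cut : ∀ {T : Graph n} {e} → IsForest T → e ∈ T → Cut T e
cut {T = T} {e} (_ , acyclic) e∈ = record
  { side       = λ v → does (rep G v ≟ rep G (src e))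
  ; side-src   = dec-true (rep G (src e) ≟ rep G (src e)) refl
  ; side-tgt   = dec-false (_ ≟ _) λ p → case cycle e∈ (∈-filter⁻ other? {xs = T})
                   (rep≡⇒connected G (sym p)) of λ (vs , c) → acyclic vs c
  ; side-other = λ f∈ f≢e → cong (λ w → does (w ≟ rep G (src e)))
                   (rep-edge (∈-filter⁺ other? f∈ f≢e))
  }
  where
  other? = λ f → ¬? (f ≟ᴱ e)
  G = filter other? T

module _ {A : Set} {R : A → A → Set} where
  linked-last : ∀ {h} x xs → Linked R (x ∷ xs ++ h ∷ []) → ∃[ z ] z ∈ x ∷ xs × R z h
  linked-last x []       (r ∷ _) = x , here refl , r
  linked-last x (y ∷ xs) (_ ∷ L) with z , z∈ , r ← linked-last y xs L = z , there z∈ , r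

  -- For a cycle read from its first vertex, `p` and `h` are both that vertex. The two neighbours
  -- can then coincide only when `xs` is a single vertex, which the fourth hypothesis excludes.
  linked-neighbours : ∀ {h v} p xs → Linked R (p ∷ xs ++ h ∷ []) → Unique (p ∷ xs) → h ∉ xs →
    (∀ x → xs ≡ x ∷ [] → p ≢ h) → v ∈ xs →
    ∃[ a ] ∃[ b ] R a v × R v b × a ≢ b × a ∈ p ∷ xs × b ∈ xs ++ h ∷ []
  linked-neighbours p (x ∷ []) (r ∷ r′ ∷ _) U h∉ p≢h (here refl) =
    p , _ , r , r′ , p≢h x refl , here refl , there (here refl)
  linked-neighbours p (x ∷ y ∷ xs) (r ∷ r′ ∷ _) ((_ ∷ p≢y ∷ _) ∷ _) h∉ _ (here refl) =
    p , y , r , r′ , p≢y , here refl , there (here refl)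
  linked-neighbours p (x ∷ xs) (_ ∷ L) (_ ∷ U) h∉ _ (there v∈)
    with a , b , r , r′ , a≢b , a∈ , b∈ ← linked-neighbours x xs L U (h∉ ∘ there)
                                            (λ { _ _ refl → h∉ (here refl) }) v∈ =
    a , b , r , r′ , a≢b , there a∈ , there b∈

cycle-neighbours : ∀ {G : Graph n} {vs v} → IsCycle G vs → v ∈ vs →
                   ∃[ a ] ∃[ b ] a ≢ b × a ∈ vs × b ∈ vs × Adj G v a × Adj G v b
cycle-neighbours {vs = _ ∷ []} (s≤s () , _)
cycle-neighbours {vs = _ ∷ _ ∷ []} (s≤s (s≤s ()) , _)
cycle-neighbours {vs = x ∷ y ∷ z ∷ vs} (_ , _ ∷ y∉ ∷ _ , r ∷ _ ∷ L) (here refl)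
  with w , w∈ , r′ ← linked-last z vs L =
  y , w , All.lookup y∉ w∈ , there (here refl) , there (there w∈) , r , adj-sym r′
cycle-neighbours {vs = x ∷ y ∷ z ∷ vs} (_ , x∉ ∷ U , L) (there v∈)
  with a , b , r , r′ , a≢b , a∈ , b∈ ← linked-neighbours x (y ∷ z ∷ vs) L (x∉ ∷ U)
         (λ x∈ → All.lookup x∉ x∈ refl) (λ _ ()) v∈ =
  a , b , a≢b , a∈ , back (∈-++⁻ (y ∷ z ∷ vs) b∈) , adj-sym r , r′
  where
  back : ∀ {b} → b ∈ y ∷ z ∷ vs ⊎ b ∈ x ∷ [] → b ∈ x ∷ y ∷ z ∷ vs
  back (inj₁ b∈)          = there b∈
  back (inj₂ (here refl)) = here refl

span : Edge n → ℕ
span e = toℕ (tgt e) ℕ.∸ toℕ (src e)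

extends-right : ∀ {e g : Edge n} → src g ≡ src e → span e ℕ.≤ span g → g ≢ e → tgt e < tgt g
extends-right {e = e} {g} refl e≤g g≢e = ℕ.≤∧≢⇒<
  (subst₂ ℕ._≤_ (ℕ.m∸n+n≡m (ℕ.<⇒≤ (src<tgt! e))) (ℕ.m∸n+n≡m (ℕ.<⇒≤ (src<tgt! g)))
    (ℕ.+-monoˡ-≤ (toℕ (src e)) e≤g))
  (λ p → g≢e (edge-≡ refl (toℕ-injective (sym p))))

extends-left : ∀ {e h : Edge n} → tgt h ≡ tgt e → span e ℕ.≤ span h → h ≢ e → src h < src e
extends-left {e = e} {h} refl e≤h h≢e = ℕ.≤∧≢⇒<
  (ℕ.∸-cancelʳ-≤ (ℕ.<⇒≤ (src<tgt! h)) e≤h)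
  (λ p → h≢e (edge-≡ (toℕ-injective p) refl))

-- A shortest edge spanned by a cycle would be crossed by the other two edges
-- at its endpoints.
noncrossing-alternating⇒forest : ∀ {F : Graph n} → Unique F → NonCrossing F → Alternating F → IsForest F
noncrossing-alternating⇒forest {F = F} U nc alt = U , acyclic
  where
  open DecMembership _≟_ using (_∈?_)
  acyclic : ∀ vs → ¬ IsCycle F vs
  acyclic vs c = nc h g h∈ g∈ (subst (src h <_) (sym g≡) h<e , subst₂ _<_ (sym g≡) (sym h≡) (src<tgt! e) ,
                               subst (_< tgt g) (sym h≡) e<g)
    where
    Inside : Edge _ → Set
    Inside e = src e ∈ vs × tgt e ∈ vs
    some : ∀ {vs} → IsCycle F vs → ∃[ v ] v ∈ vs
    some {v ∷ _} _ = v , here refl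
    inside : Any Inside F
    inside with v , v∈ ← some c with a , _ , _ , a∈ , _ , va , _ ← cycle-neighbours c v∈ | find va
    ... | e , e∈ , inj₁ (refl , refl) = lose e∈ (v∈ , a∈)
    ... | e , e∈ , inj₂ (refl , refl) = lose e∈ (a∈ , v∈)
    shortest = minimal span (λ e → src e ∈? vs ×-dec tgt e ∈? vs) inside
    e   = proj₁ shortest
    e∈  = proj₁ (proj₂ shortest)
    e∈c = proj₁ (proj₂ (proj₂ shortest))
    least = proj₂ (proj₂ (proj₂ shortest))
    neighbour≢ : ∀ {v} w → v ∈ vs → ∃[ a ] a ≢ w × a ∈ vs × Adj F v a
    neighbour≢ w v∈ with a , b , a≢b , a∈ , b∈ , va , vb ← cycle-neighbours c v∈ | a ≟ w
    ... | no a≢w   = a , a≢w , a∈ , va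
    ... | yes refl = b , a≢b ∘ sym , b∈ , vb
    right : ∃[ g ] g ∈ F × src g ≡ src e × tgt e < tgt g
    right with y , y≢ , y∈ , a ← neighbour≢ (tgt e) (proj₁ e∈c) | find a
    ... | g , g∈ , inj₁ (p , refl) = g , g∈ , p ,
      extends-right p (least g∈ (subst (_∈ vs) (sym p) (proj₁ e∈c) , y∈)) (λ q → y≢ (cong tgt {g} {e} q))
    ... | g , g∈ , inj₂ (refl , p)    = contradiction p (alt g e g∈ e∈)
    left : ∃[ h ] h ∈ F × tgt h ≡ tgt e × src h < src e
    left with x , x≢ , x∈ , a ← neighbour≢ (src e) (proj₂ e∈c) | find a
    ... | h , h∈ , inj₁ (p , refl)    = contradiction (sym p) (alt e h e∈ h∈)
    ... | h , h∈ , inj₂ (refl , p) = h , h∈ , p ,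
      extends-left p (least h∈ (x∈ , subst (_∈ vs) (sym p) (proj₂ e∈c))) (λ q → x≢ (cong src {h} {e} q))
    g  = proj₁ right
    g∈ = proj₁ (proj₂ right)
    g≡ = proj₁ (proj₂ (proj₂ right))
    e<g = proj₂ (proj₂ (proj₂ right))
    h  = proj₁ left
    h∈ = proj₁ (proj₂ left)
    h≡ = proj₁ (proj₂ (proj₂ left))
    h<e = proj₂ (proj₂ (proj₂ left))

-- Noncrossing alternating bags

∈-replicate⁻ : ∀ {A : Set} m {x y : A} → y ∈ replicate m x → y ≡ x
∈-replicate⁻ (suc m) (here refl) = refl
∈-replicate⁻ (suc m) (there p)   = ∈-replicate⁻ m p

⊆bag : ∀ {G : Graph n} (c : Flow G) {e} → e ∈ G → e ∈ bag c
⊆bag (a ∷ c) (here refl) = here refl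
⊆bag {G = g ∷ _} (a ∷ c) (there e∈) = ∈-++⁺ʳ (replicate (suc a) g) (⊆bag c e∈)

extract : ∀ e (D : Graph n) → ∃[ m ] ∃[ D′ ] D ↭ replicate m e ++ D′ × e ∉ D′
extract e []      = 0 , [] , ↭-refl , λ ()
extract e (f ∷ D) with m , D′ , p , e∉ ← extract e D | f ≟ᴱ e
... | yes refl = suc m , D′ , prep e p , e∉
... | no  f≢e  = m , f ∷ D′ , ↭-trans (prep f p) (↭-sym (shift f (replicate m e) D′)) , λ
  { (here refl) → f≢e refl ; (there e∈) → e∉ e∈ }

-- Multiplicities in `D` become the values of the flow: they are positive because every edge of `G`
-- occurs in `D`, and nothing is left over because `D` has no other edges.
regroup : ∀ {G D : Graph n} → Unique G → (∀ {e} → e ∈ D → e ∈ G) → (∀ {e} → e ∈ G → e ∈ D) →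
          ∃[ c ] bag {G = G} c ↭ D
regroup {G = []} {[]}    _ _ _ = [] , ↭-refl
regroup {G = []} {_ ∷ _} _ ⊆ _ = contradiction (⊆ (here refl)) λ ()
regroup {G = e ∷ G} {D} (e∉G ∷ U) D⊆ G⊆ with m , D′ , p , e∉ ← extract e D
  with c , q ← regroup {G = G} {D′} U
    (λ f∈ → case D⊆ (∈-resp-↭ (↭-sym p) (∈-++⁺ʳ (replicate m e) f∈)) of λ
      { (here refl) → contradiction f∈ e∉ ; (there f∈G) → f∈G })
    (λ f∈ → case ∈-++⁻ (replicate m e) (∈-resp-↭ p (G⊆ (there f∈))) of λ
      { (inj₁ r) → contradiction (sym (∈-replicate⁻ m r)) (All.lookup e∉G f∈) ; (inj₂ f∈′) → f∈′ })
  with m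
... | zero  = contradiction (∈-resp-↭ p (G⊆ (here refl))) e∉
... | suc a = a ∷ c , ↭-trans (++⁺ˡ (replicate (suc a) e) q) (↭-sym p)

count : Edge n → Graph n → ℕ
count e D = length (filter (_≟ᴱ e) D)

count-replicate : ∀ (e : Edge n) m D → count e (replicate m e ++ D) ≡ m ℕ.+ count e D
count-replicate e m D = trans (cong length (filter-++ (_≟ᴱ e) (replicate m e) D))
  (trans (length-++ (filter (_≟ᴱ e) (replicate m e)))
    (cong (ℕ._+ count e D) (trans (cong length (filter-all (_≟ᴱ e)
      (All.tabulate (∈-replicate⁻ m)))) (length-replicate m))))

count-∉ : ∀ {e : Edge n} {D} → (∀ {f} → f ∈ D → f ≢ e) → count e D ≡ 0
count-∉ {e = e} h = cong length (filter-none (_≟ᴱ e) (All.tabulate h))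

count-skip : ∀ {e f : Edge n} → f ≢ e → ∀ m D → count e (replicate m f ++ D) ≡ count e D
count-skip {e = e} {f} f≢e m D = trans (cong length (filter-++ (_≟ᴱ e) (replicate m f) D))
  (trans (length-++ (filter (_≟ᴱ e) (replicate m f)))
    (cong (ℕ._+ count e D) (count-∉ λ g∈ g≡e → f≢e (trans (sym (∈-replicate⁻ m g∈)) g≡e))))

flow-ext : ∀ {G : Graph n} → Unique G → {c d : Flow G} →
           (∀ {e} → e ∈ G → count e (bag c) ≡ count e (bag d)) → c ≡ d
flow-ext _ {[]} {[]} _ = refl
flow-ext {G = e ∷ G} (e∉ ∷ U) {a ∷ c} {b ∷ d} h = cong₂ _∷_
  (ℕ.suc-injective (trans (sym (at-head a c)) (trans (h (here refl)) (at-head b d))))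
  (flow-ext U λ {f} f∈ → trans (sym (count-skip (All.lookup e∉ f∈) (suc a) (bag c)))
    (trans (h (there f∈)) (count-skip (All.lookup e∉ f∈) (suc b) (bag d))))
  where
  at-head : ∀ a (c : Flow G) → count e (replicate (suc a) e ++ bag c) ≡ suc a
  at-head a c = trans (count-replicate e (suc a) (bag c)) (trans
    (cong (suc a ℕ.+_) (count-∉ λ f∈ f≡e → All.lookup e∉ (bag⊆ c f∈) (sym f≡e))) (ℕ.+-identityʳ _))

Leaves : (Vertex n → Bool) → Edge n → Set
Leaves χ e = χ (src e) ≡ true × χ (tgt e) ≡ false

leaves? : ∀ χ (e : Edge n) → Dec (Leaves χ e)
leaves? χ e = χ (src e) Bool.≟ true ×-dec χ (tgt e) Bool.≟ false

drop-in≤0 : ∀ χ (e : Edge n) → ¬ Leaves χ e → drop-in (indicator χ) e ℤ.≤ + 0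
drop-in≤0 χ e ¬l with χ (src e) | χ (tgt e)
... | true  | true  = ℤ.+≤+ z≤n
... | true  | false = contradiction (refl , refl) ¬l
... | false | true  = ℤ.-≤+
... | false | false = ℤ.+≤+ z≤n

pairing≤0 : ∀ χ (D : Graph n) → (∀ {e} → e ∈ D → ¬ Leaves χ e) → pairing (indicator χ) D ℤ.≤ + 0
pairing≤0 χ []      h = ℤ.+≤+ z≤n
pairing≤0 χ (e ∷ D) h = ℤ.+-mono-≤ (drop-in≤0 χ e (h (here refl))) (pairing≤0 χ D (h ∘ there))

drop-in≥0 : ∀ χ (e : Edge n) → (χ (tgt e) ≡ true → χ (src e) ≡ true) → + 0 ℤ.≤ drop-in (indicator χ) e
drop-in≥0 χ e h with χ (src e) | χ (tgt e)
... | true  | true  = ℤ.+≤+ z≤n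
... | true  | false = ℤ.+≤+ z≤n
... | false | true  = contradiction (h refl) λ ()
... | false | false = ℤ.+≤+ z≤n

pairing≥0 : ∀ χ (D : Graph n) → (∀ {e} → e ∈ D → χ (tgt e) ≡ true → χ (src e) ≡ true) →
            + 0 ℤ.≤ pairing (indicator χ) D
pairing≥0 χ []      h = ℤ.+≤+ z≤n
pairing≥0 χ (e ∷ D) h = ℤ.+-mono-≤ (drop-in≥0 χ e (h (here refl))) (pairing≥0 χ D (h ∘ there))

pairing≥1 : ∀ χ (D : Graph n) → (∀ {e} → e ∈ D → χ (tgt e) ≡ true → χ (src e) ≡ true) →
            Any (Leaves χ) D → + 1 ℤ.≤ pairing (indicator χ) D
pairing≥1 χ (e ∷ D) h (here (p , q)) = ℤ.+-mono-≤ (leaving (p , q)) (pairing≥0 χ D (h ∘ there))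
  where
  leaving : Leaves χ e → + 1 ℤ.≤ drop-in (indicator χ) e
  leaving (p , q) rewrite p | q = ℤ.+≤+ (s≤s z≤n)
pairing≥1 χ (e ∷ D) h (there l) = ℤ.+-mono-≤ (drop-in≥0 χ e (h (here refl))) (pairing≥1 χ D (h ∘ there) l)

-- If no edge of `D` enters the set `χ`, its pairing with the indicator counts the edges leaving the
-- set and is positive. A bag without leaving edges has pairing at most 0.
leaves-transfer : ∀ χ {D E : Graph n} → D ~ E → (∀ {e} → e ∈ D → χ (tgt e) ≡ true → χ (src e) ≡ true) →
                  Any (Leaves χ) D → Any (Leaves χ) E
leaves-transfer χ {D} {E} D~E h l with Any.any? (leaves? χ) E
... | yes l′ = l′
... | no ¬l′ = contradiction
  (ℤ.≤-trans (pairing≥1 χ D h l) (ℤ.≤-trans (ℤ.≤-reflexive (at D~E _))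
    (pairing≤0 χ E λ e∈ l → ¬l′ (lose e∈ l)))) λ { (ℤ.+≤+ ()) }

does⇒ : ∀ {P : Set} (d : Dec P) → does d ≡ true → P
does⇒ (yes p) _ = p

-- The set is the single vertex `src e`; alternation says that no edge of `D` enters it.
source-transfer : ∀ {D E : Graph n} {e} → D ~ E → Alternating D → e ∈ D → ∃[ g ] g ∈ E × src g ≡ src e
source-transfer {D = D} {E} {e} D~E alt e∈
  with g , g∈ , p , _ ← find (leaves-transfer (λ v → does (v ≟ src e)) D~E
    (λ {f} f∈ p → contradiction (does⇒ (tgt f ≟ src e) p) (alt f e f∈ e∈))
    (lose e∈ (dec-true (src e ≟ src e) refl ,
              dec-false (tgt e ≟ src e) (alt e e e∈ e∈)))) = g , g∈ , does⇒ (src g ≟ src e) p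

-- The set is the complement of `tgt e`; entering it would mean starting at `tgt e`, which
-- alternation forbids.
target-transfer : ∀ {D E : Graph n} {e} → D ~ E → Alternating D → e ∈ D → ∃[ h ] h ∈ E × tgt h ≡ tgt e
target-transfer {D = D} {E} {e} D~E alt e∈
  with h , h∈ , _ , q ← find (leaves-transfer (λ v → does (¬? (v ≟ tgt e))) D~E
    (λ {f} f∈ _ → dec-true (¬? (src f ≟ tgt e)) (alt e f e∈ f∈ ∘ sym))
    (lose e∈ (dec-true (¬? (src e ≟ tgt e)) (alt e e e∈ e∈ ∘ sym) ,
              dec-false (¬? (tgt e ≟ tgt e)) (λ ¬p → ¬p refl)))) with tgt h ≟ tgt e
... | yes p = h , h∈ , p

infix 4 _∈ᴱ?_
_∈ᴱ?_ : (e : Edge n) (D : Graph n) → Dec (e ∈ D)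
e ∈ᴱ? D = Any.any? (e ≟ᴱ_) D

-- `E` has an edge starting at the source of `e` and one ending at its target. If neither is `e`,
-- both are longer, so each reaches beyond `e` at its other end and they cross.
shortest∈ : ∀ {D E : Graph n} {e} → D ~ E → Alternating D → NonCrossing E → e ∈ D →
            (∀ {f} → f ∈ E → span e ℕ.≤ span f) → e ∈ E
shortest∈ {E = E} {e} D~E alt nc e∈ short
  with g , g∈ , p ← source-transfer D~E alt e∈ | h , h∈ , q ← target-transfer D~E alt e∈
  with g ≟ᴱ e | h ≟ᴱ e
... | yes refl | _        = g∈
... | no  _    | yes refl = h∈
... | no g≢e   | no h≢e   = contradiction
  (subst (src h <_) (sym p) (extends-left q (short h∈) h≢e) , subst₂ _<_ (sym p) (sym q) (src<tgt! e) ,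
   subst (_< tgt g) (sym q) (extends-right p (short g∈) g≢e))
  (nc h g h∈ g∈)

cancel : ∀ {e : Edge n} {D E D′ E′} → D ~ E → D ↭ e ∷ D′ → E ↭ e ∷ E′ → D′ ~ E′
cancel {e = e} {D} {E} {D′} {E′} D~E p q .at φ = ∙-cancelˡ (AbelianGroup.group ℤ.+-0-abelianGroup)
  (drop-in φ e) (pairing φ D′) (pairing φ E′)
  (trans (sym (at (↭⇒~ p) φ)) (trans (at D~E φ) (at (↭⇒~ q) φ)))

noncrossing-alternating-unique : ∀ {D E : Graph n} → NonCrossing D → Alternating D →
  NonCrossing E → Alternating E → D ~ E → D ↭ E
noncrossing-alternating-unique {D = D} = go (length D) D refl
  where
  go : ∀ m (D : Graph _) {E} → length D ≡ m → NonCrossing D → Alternating D → NonCrossing E →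
       Alternating E → D ~ E → D ↭ E
  go m [] {[]}    _ _ _ _ _ _ = ↭-refl
  go m [] {_ ∷ _} _ _ _ _ altE D~E = contradiction (alternating⇒length≤ altE (~-sym D~E)) λ ()
  go (suc m) D@(_ ∷ _) {E} len ncD altD ncE altE D~E
    -- Minimality over both bags together lets `shortest∈` apply whichever of the two contains the
    -- edge.
    with e , e∈ , _ , short ← minimal span (λ e → e ∈ᴱ? (D ++ E)) {D ++ E} (here (here refl))
    with e∈D , e∈E ← (case ∈-++⁻ D e∈ of λ
      { (inj₁ e∈D) → e∈D , shortest∈ D~E altD ncE e∈D λ f∈ → short (∈-++⁺ʳ D f∈) (∈-++⁺ʳ D f∈)
      ; (inj₂ e∈E) → shortest∈ (~-sym D~E) altE ncD e∈E (λ f∈ → short (∈-++⁺ˡ f∈) (∈-++⁺ˡ f∈)) , e∈E })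
    with D′ , p ← ∈⇒↭ e∈D | E′ , q ← ∈⇒↭ e∈E =
    ↭-trans p (↭-trans (prep e (go m D′ (ℕ.suc-injective (trans (sym (↭-length p)) len))
      (noncrossing-⊆ (inside p) ncD) (alternating-⊆ (inside p) altD)
      (noncrossing-⊆ (inside q) ncE) (alternating-⊆ (inside q) altE) (cancel D~E p q))) (↭-sym q))
    where
    inside : ∀ {e} {D D′ : Graph _} → D ↭ e ∷ D′ → ∀ {f} → f ∈ D′ → f ∈ D
    inside p f∈ = ∈-resp-↭ (↭-sym p) (there f∈)

-- Among the edges at j, replacing the longest incoming edge (i,j) and the
-- longest outgoing edge (j,k) by (i,k) creates no crossing.
noncrossing-replace : ∀ {D E : Graph n} {e f} (e∘f : tgt e ≡ src f) → NonCrossing D → e ∈ D → f ∈ D →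
  (∀ {g} → g ∈ D → tgt g ≡ tgt e → src e ≤ src g) →
  (∀ {g} → g ∈ D → src g ≡ tgt e → tgt g ≤ tgt f) →
  (∀ {g} → g ∈ E → g ∈ D ⊎ (src g ≡ src e × tgt g ≡ tgt f)) → NonCrossing E
noncrossing-replace {D = D} {e = e} {f} e∘f nc e∈ f∈ min max new g h g∈ h∈ (p , q , r)
  with new g∈ | new h∈
... | inj₁ g∈D | inj₁ h∈D = nc g h g∈D h∈D (p , q , r)
... | inj₂ (refl , refl) | inj₂ (s , _) = ℕ.<-irrefl (cong toℕ (sym s)) p
... | inj₂ (refl , refl) | inj₁ h∈D with <-cmp (src h) (tgt e)
...   | tri< a _ _ = nc e h e∈ h∈D (p , a , ℕ.<-trans (subst (_< tgt f) (sym e∘f) (src<tgt! f)) r)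
...   | tri≈ _ b _ = ℕ.<⇒≱ r (max h∈D b)
...   | tri> _ _ c = nc f h f∈ h∈D (subst (_< src h) e∘f c , q , r)
noncrossing-replace {D = D} {e = e} {f} e∘f nc e∈ f∈ min max new g h g∈ h∈ (p , q , r)
    | inj₁ g∈D | inj₂ (refl , refl) with <-cmp (tgt g) (tgt e)
...   | tri< a _ _ = nc g e g∈D e∈ (p , q , a)
...   | tri≈ _ b _ = ℕ.<⇒≱ p (min g∈D b)
...   | tri> _ _ c = nc g f g∈D f∈ (ℕ.<-trans p (subst (src e <_) e∘f (src<tgt! e)) , subst (_< tgt g) e∘f c , r)

noncrossing-alternating-exists : ∀ {T : Graph n} D → NonCrossing D → All (InClosure T) D →
  ∃[ E ] NonCrossing E × Alternating E × All (InClosure T) E × E ~ D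
noncrossing-alternating-exists {n} {T} D = go (length D) D refl
  where
  go : ∀ m D → length D ≡ m → NonCrossing D → All (InClosure T) D →
       ∃[ E ] NonCrossing E × Alternating E × All (InClosure T) E × E ~ D
  go m D len nc cl with Any.any? (λ e → Any.any? (λ f → tgt e ≟ src f) D) D
  ... | no ¬p = D , nc , (λ e f e∈ f∈ eq → ¬p (lose e∈ (lose f∈ eq))) , cl , ~-refl
  ... | yes p with e₀ , e₀∈ , p′ ← find p with f₀ , f₀∈ , q ← find p′
    -- The longest incoming edge has the least source. The longest outgoing edge has the greatest
    -- target, hence the complement in the second measure. Each contraction replaces two edges by
    -- one, so the recursion on the length ends.
    with e , e∈ , e≡ , min ← minimal (λ e → toℕ (src e)) (λ e → tgt e ≟ tgt e₀) (lose e₀∈ refl)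
    with f , f∈ , f≡ , max ← minimal (λ f → suc n ℕ.∸ toℕ (tgt f)) (λ f → src f ≟ tgt e₀) (lose f₀∈ (sym q))
    with D₁ , r ← ∈⇒↭ e∈
    with f∈D₁ ← (case ∈-resp-↭ r f∈ of λ
      { (here refl) → contradiction (cong toℕ (trans f≡ (sym e≡))) (ℕ.<⇒≢ (src<tgt! f))
      ; (there f∈) → f∈ })
    with D₂ , s ← ∈⇒↭ f∈D₁ = contract m len
    where
    e∘f = trans e≡ (sym f≡)
    perm : D ↭ e ∷ f ∷ D₂
    perm = ↭-trans r (prep e s)
    i<k : src e < tgt f
    i<k = ℕ.<-trans (src<tgt! e) (subst (_< tgt f) (sym e∘f) (src<tgt! f))
    ik = edge (src e) (tgt f) i<k
    E = ik ∷ D₂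
    E~D : E ~ D
    E~D .at φ = trans (trans (cong (λ t → t ℤ.+ pairing φ D₂) (telescope (φ (src e)) (φ (tgt e)) (φ (tgt f))))
      (trans (cong (λ v → (drop-in φ e ℤ.+ (φ v ℤ.- φ (tgt f))) ℤ.+ pairing φ D₂) e∘f)
      (ℤ.+-assoc (drop-in φ e) (drop-in φ f) _))) (sym (at (↭⇒~ perm) φ))
    ik-closure : InClosure T ik
    ik-closure = All.lookup cl e∈ TransClosure.++
      subst (λ v → TransClosure.TransClosure (HasEdge T) v (tgt f)) (sym e∘f) (All.lookup cl f∈)
    rest : ∀ {g} → g ∈ D₂ → g ∈ D
    rest g∈ = ∈-resp-↭ (↭-sym perm) (there (there g∈))
    ncE : NonCrossing E
    ncE = noncrossing-replace e∘f nc e∈ f∈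
      (λ g∈ g≡ → min g∈ (trans g≡ e≡))
      (λ {g} g∈ g≡ → ℕ.∸-cancelʳ-≤ (ℕ.<⇒≤ (toℕ<n (tgt g))) (max g∈ (trans g≡ e≡)))
      λ { (here refl) → inj₂ (refl , refl) ; (there g∈) → inj₁ (rest g∈) }
    contract : ∀ m → length D ≡ m → _
    contract zero    len = contradiction (trans (sym (↭-length perm)) len) λ ()
    contract (suc m) len
      with E′ , nc′ , alt′ , cl′ , E′~E ← go m E (ℕ.suc-injective (trans (sym (↭-length perm)) len)) ncE
                                            (ik-closure ∷ All.tabulate (All.lookup cl ∘ rest)) =
      E′ , nc′ , alt′ , cl′ , ~-trans E′~E E~D

open Cut

-- Pseudo-components

unique-↭ : ∀ {A : Set} {xs ys : List A} → xs ↭ ys → Unique xs → Unique ys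
unique-↭ {A} p = Permutationₛ.Unique-resp-↭ (setoid A) (↭⇒↭ₛ p)

unique-++⁻ˡ : ∀ {A : Set} (xs : List A) {ys} → Unique (xs ++ ys) → Unique xs
unique-++⁻ˡ []       _        = []
unique-++⁻ˡ (x ∷ xs) (x∉ ∷ U) = All.++⁻ˡ xs x∉ ∷ unique-++⁻ˡ xs U

concat-↭ : ∀ {A : Set} {xss yss : List (List A)} → xss ↭ yss → concat xss ↭ concat yss
concat-↭ ↭.refl           = ↭-refl
concat-↭ (↭.prep xs p)    = ++⁺ˡ xs (concat-↭ p)
concat-↭ (↭.swap xs ys p) = ↭-trans (shifts xs ys) (++⁺ˡ ys (++⁺ˡ xs (concat-↭ p)))
concat-↭ (↭.trans p q)    = ↭-trans (concat-↭ p) (concat-↭ q)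

src∈vertices : ∀ {G : Graph n} {e} → e ∈ G → src e ∈ vertices G
src∈vertices (here refl) = here refl
src∈vertices (there e∈)  = there (there (src∈vertices e∈))

tgt∈vertices : ∀ {G : Graph n} {e} → e ∈ G → tgt e ∈ vertices G
tgt∈vertices (here refl) = there (here refl)
tgt∈vertices (there e∈)  = there (there (tgt∈vertices e∈))

Touches : Edge n → Vertex n → Set
Touches e v = src e ≡ v ⊎ tgt e ≡ v

touches∈vertices : ∀ {G : Graph n} {e v} → e ∈ G → Touches e v → v ∈ vertices G
touches∈vertices e∈ (inj₁ refl) = src∈vertices e∈
touches∈vertices e∈ (inj₂ refl) = tgt∈vertices e∈

∈vertices⁻ : ∀ {G : Graph n} {v} → v ∈ vertices G → ∃[ e ] e ∈ G × Touches e v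
∈vertices⁻ {G = e ∷ G} (here refl)         = e , here refl , inj₁ refl
∈vertices⁻ {G = e ∷ G} (there (here refl)) = e , here refl , inj₂ refl
∈vertices⁻ {G = e ∷ G} (there (there v∈)) with f , f∈ , t ← ∈vertices⁻ v∈ = f , there f∈ , t

joins⇒touches : ∀ (e : Edge n) {u v} → Joins e u v → Touches e u × Touches e v
joins⇒touches _ (inj₁ (p , q)) = inj₁ p , inj₂ q
joins⇒touches _ (inj₂ (p , q)) = inj₂ q , inj₁ p

adj∈vertices : ∀ {G : Graph n} {u v} → Adj G u v → u ∈ vertices G × v ∈ vertices G
adj∈vertices a with e , e∈ , j ← find a =
  touches∈vertices e∈ (proj₁ (joins⇒touches e j)) , touches∈vertices e∈ (proj₂ (joins⇒touches e j))

min-unique : ∀ {G : Graph n} {u v} → IsMin G u → IsMin G v → u ≡ v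
min-unique (u∈ , u≤) (v∈ , v≤) = toℕ-injective (ℕ.≤-antisym (All.lookup u≤ v∈) (All.lookup v≤ u∈))

max-unique : ∀ {G : Graph n} {u v} → IsMax G u → IsMax G v → u ≡ v
max-unique (u∈ , ≤u) (v∈ , ≤v) = toℕ-injective (ℕ.≤-antisym (All.lookup ≤v u∈) (All.lookup ≤u v∈))

module _ {A : Set} where
  head∈ : ∀ {xs : List A} {x} → head xs ≡ just x → x ∈ xs
  head∈ {_ ∷ _} refl = here refl

  last∈ : ∀ {xs : List A} {x} → last xs ≡ just x → x ∈ xs
  last∈ {_ ∷ []}    refl = here refl
  last∈ {_ ∷ _ ∷ _} p    = there (last∈ p)

  linked-exit : ∀ {R : A → A → Set} {Q : A → Set} → (∀ x → Dec (Q x)) → ∀ {xs u p} → Linked R xs →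
                head xs ≡ just u → p ∈ xs → Q u → ¬ Q p →
                ∃[ x ] ∃[ y ] x ∈ xs × y ∈ xs × R x y × Q x × ¬ Q y
  linked-exit Q? {x ∷ _} _ refl (here refl) q ¬q = contradiction q ¬q
  linked-exit Q? {x ∷ y ∷ _} (r ∷ L) refl (there p∈) q ¬q with Q? y
  ... | no ¬qy = x , y , here refl , there (here refl) , r , q , ¬qy
  ... | yes qy with x′ , y′ , x∈ , y∈ , rest ← linked-exit Q? L refl p∈ qy ¬q =
    x′ , y′ , there x∈ , there y∈ , rest

traverses∈ : ∀ (e : Edge n) {vs v} → Traverses vs e → Touches e v → v ∈ vs
traverses∈ e {_ ∷ _ ∷ _} (here (inj₁ (refl , refl))) (inj₁ refl) = here refl
traverses∈ e {_ ∷ _ ∷ _} (here (inj₁ (refl , refl))) (inj₂ refl) = there (here refl)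
traverses∈ e {_ ∷ _ ∷ _} (here (inj₂ (refl , refl))) (inj₁ refl) = there (here refl)
traverses∈ e {_ ∷ _ ∷ _} (here (inj₂ (refl , refl))) (inj₂ refl) = here refl
traverses∈ e {_ ∷ _ ∷ _} (there t) x = there (traverses∈ e t x)

-- Cuts along paths, and minimal decompositions

module _ {T : Graph n} {e : Edge n} (χ : Cut T e) where

  side-joins : ∀ {u v} → Joins e u v → side χ u ≢ side χ v
  side-joins (inj₁ (refl , refl)) p = contradiction (trans (sym (side-src χ)) (trans p (side-tgt χ))) λ ()
  side-joins (inj₂ (refl , refl)) p = contradiction (trans (sym (side-src χ)) (trans (sym p) (side-tgt χ))) λ ()

  side-adj : ∀ {f u v} → f ∈ T → f ≢ e → Joins f u v → side χ u ≡ side χ v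
  side-adj f∈ f≢e (inj₁ (refl , refl)) = side-other χ f∈ f≢e
  side-adj f∈ f≢e (inj₂ (refl , refl)) = sym (side-other χ f∈ f≢e)

  side-connected : ∀ {G : Graph n} → (∀ {f} → f ∈ G → f ∈ T × f ≢ e) → ∀ {u v} → Connected G u v →
                   side χ u ≡ side χ v
  side-connected G⊆ ε = refl
  side-connected G⊆ (a ◅ as) with f , f∈ , j ← find a =
    trans (side-adj (proj₁ (G⊆ f∈)) (proj₂ (G⊆ f∈)) j) (side-connected G⊆ as)

  side-avoiding : ∀ {a} → Touches e a → ∀ {w vs} → Linked (Adj T) (w ∷ vs) → a ∉ w ∷ vs →
                  ∀ {x} → x ∈ w ∷ vs → side χ w ≡ side χ x
  side-avoiding t L a∉ (here refl) = refl
  side-avoiding t (r ∷ L) a∉ (there x∈) with f , f∈ , j ← find r =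
    trans (side-adj f∈ (λ { refl → a∉ (traverses∈ e (here j) t) }) j) (side-avoiding t L (a∉ ∘ there) x∈)

  -- Since its vertices are distinct, the path uses `e` only once, and so it changes sides only
  -- once.
  path-separates : ∀ {vs u v} → Linked (Adj T) vs → Unique vs → head vs ≡ just u → last vs ≡ just v →
                   Traverses vs e → side χ u ≢ side χ v
  path-separates {x ∷ y ∷ vs} (r ∷ L) (x∉ ∷ U) refl l (here j) p =
    side-joins j (trans p (sym (side-avoiding (proj₁ (joins⇒touches e j)) L
      (λ x∈ → All.lookup x∉ x∈ refl) (last∈ l))))
  path-separates {x ∷ y ∷ vs} (r ∷ L) (x∉ ∷ U) refl l (there t) p with f , f∈ , j ← find r =
    path-separates L U refl l t (trans (sym (side-adj f∈ (λ { refl →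
      All.lookup x∉ (traverses∈ f t (proj₁ (joins⇒touches f j))) refl }) j)) p)

-- The edge with which the path leaves the earlier of the two vertices works: the rest of the path
-- never returns to that vertex, hence never uses this edge again.
path-cut : ∀ {T : Graph n} {vs a b} → Linked (Adj T) vs → Unique vs → a ∈ vs → b ∈ vs → a ≢ b →
           ∃[ e ] e ∈ T × Traverses vs e × ((χ : Cut T e) → side χ a ≢ side χ b)
path-cut {vs = _ ∷ _} _ _ (here refl) (here refl) a≢b = contradiction refl a≢b
path-cut {vs = x ∷ y ∷ vs} (r ∷ L) (x∉ ∷ U) (here refl) (there b∈) a≢b with e , e∈ , j ← find r =
  e , e∈ , here j , λ χ p → side-joins χ j (trans p (sym
    (side-avoiding χ (proj₁ (joins⇒touches e j)) L (λ x∈ → All.lookup x∉ x∈ refl) b∈)))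
path-cut {vs = x ∷ y ∷ vs} (r ∷ L) (x∉ ∷ U) (there a∈) (here refl) a≢b with e , e∈ , j ← find r =
  e , e∈ , here j , λ χ p → side-joins χ j (trans (sym p) (sym
    (side-avoiding χ (proj₁ (joins⇒touches e j)) L (λ x∈ → All.lookup x∉ x∈ refl) a∈)))
path-cut {vs = x ∷ y ∷ vs} (r ∷ L) (x∉ ∷ U) (there a∈) (there b∈) a≢b
  with e , e∈ , t , c ← path-cut L U a∈ b∈ a≢b = e , e∈ , there t , c

vertices-++⁻ : ∀ (G : Graph n) {H v} → v ∈ vertices (G ++ H) → v ∈ vertices G ⊎ v ∈ vertices H
vertices-++⁻ G v∈ with e , e∈ , t ← ∈vertices⁻ v∈ =
  Sum.map (λ e∈ → touches∈vertices {e = e} e∈ t) (λ e∈ → touches∈vertices {e = e} e∈ t) (∈-++⁻ G e∈)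

forest-⊆ : ∀ {G H : Graph n} → (∀ {e} → e ∈ G → e ∈ H) → Unique G → IsForest H → IsForest G
forest-⊆ ⊆ U (_ , acyclic) = U , λ vs c → acyclic vs (isCycle-⊆ ⊆ c)

∖⁻ : ∀ (T : Graph n) P {e} → e ∈ T ∖ P → e ∈ T × ¬ Traverses P e
∖⁻ T P = ∈-filter⁻ (¬? ∘ traverses? P) {xs = T}

-- Some edge of `P` has a cut separating `a` from `b`, and no edge off `P` crosses that cut.
off-path : ∀ {S U : Graph n} {P a b} → IsForest S → Linked (Adj S) P → Unique P → (∀ {e} → e ∈ U → e ∈ S ∖ P) →
           a ∈ P → b ∈ P → a ≢ b → ¬ Connected U a b
off-path {S = S} {P = P} forest L uP U⊆ a∈ b∈ a≢b c with e , e∈ , t , sep ← path-cut L uP a∈ b∈ a≢b =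
  sep (cut forest e∈) (side-connected (cut forest e∈)
    (λ f∈ → proj₁ (∖⁻ S P (U⊆ f∈)) , λ { refl → proj₂ (∖⁻ S P (U⊆ f∈)) t }) c)

-- An edge off the main path passing over a vertex of the path would be crossed by the path.
no-jump : ∀ {S U : Graph n} {P p f} → NonCrossing S → IsForest S → IsMainPath S P →
          (∀ {e} → e ∈ U → e ∈ S ∖ P) → (∀ {x} → x ∈ vertices U → Connected U x p) → p ∈ P →
          f ∈ U → ¬ (src f < p × p < tgt f)
no-jump {S = S} {U} {P} {p} {f} nc forest (u , _ , (_ , u≤) , _ , h , _ , L , uP) U⊆ conn p∈ f∈ (a<p , p<b) =
  crossed (linked-exit (λ x → ¬? (src f <? x ×-dec x <? tgt f)) L h p∈
            (λ (a<u , _) → ℕ.<⇒≱ a<u (All.lookup u≤ (src∈vertices f∈S))) (λ ¬p → ¬p (a<p , p<b)))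
  where
  f∈S : f ∈ S
  f∈S = proj₁ (∖⁻ S P (U⊆ f∈))
  a∉ : src f ∉ P
  a∉ a∈ = off-path forest L uP U⊆ a∈ p∈ (ℕ.<⇒≢ a<p ∘ cong toℕ) (conn (src∈vertices f∈))
  b∉ : tgt f ∉ P
  b∉ b∈ = off-path forest L uP U⊆ b∈ p∈ (ℕ.<⇒≢ p<b ∘ cong toℕ ∘ sym) (conn (tgt∈vertices f∈))
  outside : ∀ {x} → x ∈ P → ¬ (src f < x × x < tgt f) → x < src f ⊎ tgt f < x
  outside {x} x∈ ¬x with <-cmp x (src f) | <-cmp x (tgt f)
  ... | tri< x<a _ _  | _             = inj₁ x<a
  ... | tri≈ _ refl _ | _             = contradiction x∈ a∉
  ... | tri> _ _ _    | tri> _ _ b<x  = inj₂ b<x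
  ... | tri> _ _ _    | tri≈ _ refl _ = contradiction x∈ b∉
  ... | tri> _ _ a<x  | tri< x<b _ _  = contradiction (a<x , x<b) ¬x
  crossed : ¬ (∃[ x ] ∃[ y ] x ∈ P × y ∈ P × Adj S x y × ¬ (src f < x × x < tgt f) ×
               ¬ ¬ (src f < y × y < tgt f))
  crossed (x , y , x∈ , y∈ , r , ¬x , ¬¬y) with g , g∈ , j ← find r
    with a<y , y<b ← decidable-stable (src f <? y ×-dec y <? tgt f) ¬¬y | outside x∈ ¬x | j
  ... | inj₁ x<a | inj₁ (refl , refl) = nc g f g∈ f∈S (x<a , a<y , y<b)
  ... | inj₁ x<a | inj₂ (refl , refl) = ℕ.<-asym (ℕ.<-trans x<a a<y) (src<tgt! g)
  ... | inj₂ b<x | inj₁ (refl , refl) = ℕ.<-asym (ℕ.<-trans y<b b<x) (src<tgt! g)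
  ... | inj₂ b<x | inj₂ (refl , refl) = nc f g f∈S g∈ (a<y , y<b , b<x)

one-sided : ∀ {W : Graph n} {p} (Q : Vertex n → Set) → (∀ {y z} → Adj W y z → Q y → z ≢ p → Q z) →
            p ∉ vertices W → ∀ {v x} → Connected W v x → Q v → Q x
one-sided Q step p∉ ε        q = q
one-sided Q step p∉ (a ◅ as) q = one-sided Q step p∉ as
  (step a q (λ { refl → p∉ (proj₂ (adj∈vertices a)) }))

module _ {S : Graph n} {P : List (Vertex n)} {Ts : List (Graph n)} {S₁ : Graph n}
         (nc : NonCrossing S) (forest : IsForest S) (mp : IsMainPath S P)
         (minimalDec : IsMinimalDecomposition S P Ts) (S₁∈ : S₁ ∈ Ts) where
  open DecMembership (_≟_ {suc n}) using (_∈?_)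

  -- Otherwise merging the two trees that meet at v would give a smaller decomposition.
  saturated : ∀ {v e} → v ∈ vertices S₁ → v ∉ P → e ∈ S → Touches e v → e ∈ S₁
  saturated {v} {e} v∈ v∉P e∈ t with R , p ← ∈⇒↭ S₁∈ =
    split (∈-++⁻ S₁ (∈-resp-↭ (↭-trans (↭-sym (proj₁ (proj₁ minimalDec))) (concat-↭ p))
      (∈-filter⁺ (¬? ∘ traverses? P) e∈ (λ tr → v∉P (traverses∈ e tr t)))))
    where
    split : e ∈ S₁ ⊎ e ∈ concat R → e ∈ S₁
    split (inj₁ e∈S₁) = e∈S₁
    split (inj₂ e∈R) with S₂ , e∈S₂ , S₂∈ ← ∈-concat⁻′ R e∈R with R′ , q ← ∈⇒↭ S₂∈ =
      contradiction ((U ∷ R′) , (perm , (Utree , Umeets) ∷ rest) , sym (↭-length Ts↭)) (proj₂ minimalDec)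
      where
      U = S₁ ++ S₂
      Ts↭ : Ts ↭ S₁ ∷ S₂ ∷ R′
      Ts↭ = ↭-trans p (prep S₁ q)
      perm : concat (U ∷ R′) ↭ S ∖ P
      perm = ↭-trans (↭-trans (↭-reflexive (List.++-assoc S₁ S₂ (concat R′))) (concat-↭ (↭-sym Ts↭)))
                     (proj₁ (proj₁ minimalDec))
      parts : All (λ S → IsNonemptyTree S × MeetsAtExtremes P S) (S₁ ∷ S₂ ∷ R′)
      parts = All-resp-↭ Ts↭ (proj₂ (proj₁ minimalDec))
      tree₁ = proj₂ (proj₁ (All.head parts))
      tree₂ = proj₂ (proj₁ (All.head (All.tail parts)))
      meets₁ = proj₂ (All.head parts)
      meets₂ = proj₂ (All.head (All.tail parts))
      rest = All.tail (All.tail parts)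
      U⊆ : ∀ {f} → f ∈ U → f ∈ S ∖ P
      U⊆ f∈ = ∈-resp-↭ perm (∈-++⁺ˡ f∈)
      v∈₂ : v ∈ vertices S₂
      v∈₂ = touches∈vertices e∈S₂ t
      conn₁ : ∀ {x} → x ∈ vertices S₁ → Connected S₁ v x
      conn₁ x∈ = path⇒connected (proj₂ (proj₂ tree₁ v _ v∈ x∈))
      conn₂ : ∀ {x} → x ∈ vertices S₂ → Connected S₂ v x
      conn₂ x∈ = path⇒connected (proj₂ (proj₂ tree₂ v _ v∈₂ x∈))
      conn : ∀ {x} → x ∈ vertices U → Connected U v x
      conn x∈ with vertices-++⁻ S₁ x∈
      ... | inj₁ x∈₁ = Star.map (adj-⊆ ∈-++⁺ˡ) (conn₁ x∈₁)
      ... | inj₂ x∈₂ = Star.map (adj-⊆ (∈-++⁺ʳ S₁)) (conn₂ x∈₂)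
      connU : ∀ {x y} → x ∈ vertices U → y ∈ vertices U → Connected U x y
      connU x∈ y∈ = Star.reverse adj-sym (conn x∈) ◅◅ conn y∈
      nonempty : U ≢ []
      nonempty eq with ∈-++⁺ʳ S₁ e∈S₂
      ... | e∈U rewrite eq = contradiction e∈U λ ()
      Utree : IsNonemptyTree U
      Utree = nonempty , forest-⊆ (λ f∈ → proj₁ (∖⁻ S P (U⊆ f∈)))
        (unique-++⁻ˡ U (unique-↭ (↭-sym perm) (Unique.filter⁺ (¬? ∘ traverses? P) (proj₁ forest)))) forest ,
        λ x y x∈ y∈ → connected⇒path (connU x∈ y∈)
      module _ {p : Vertex n} (p∈P : p ∈ P) (p∈U : p ∈ vertices U) where
        noJump : ∀ {f} → f ∈ U → ¬ (src f < p × p < tgt f)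
        noJump = no-jump nc forest mp U⊆ (λ x∈ → connU x∈ p∈U) p∈P
        stay-below : ∀ {W} → (∀ {f} → f ∈ W → f ∈ U) → ∀ {y z} → Adj W y z → y < p → z ≢ p → z < p
        stay-below W⊆ {y} {z} a y<p z≢p with <-cmp z p | find a
        ... | tri< z<p _ _ | _ = z<p
        ... | tri≈ _ z≡p _ | _ = contradiction z≡p z≢p
        ... | tri> _ _ p<z | f , f∈ , inj₁ (refl , refl) = contradiction (y<p , p<z) (noJump (W⊆ f∈))
        ... | tri> _ _ p<z | f , f∈ , inj₂ (refl , refl) =
          contradiction (src<tgt! f) (ℕ.<-asym (ℕ.<-trans y<p p<z))
        stay-above : ∀ {W} → (∀ {f} → f ∈ W → f ∈ U) → ∀ {y z} → Adj W y z → p < y → z ≢ p → p < z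
        stay-above W⊆ {y} {z} a p<y z≢p with <-cmp z p | find a
        ... | tri> _ _ p<z | _ = p<z
        ... | tri≈ _ z≡p _ | _ = contradiction z≡p z≢p
        ... | tri< z<p _ _ | f , f∈ , inj₂ (refl , refl) = contradiction (z<p , p<y) (noJump (W⊆ f∈))
        ... | tri< z<p _ _ | f , f∈ , inj₁ (refl , refl) =
          contradiction (src<tgt! f) (ℕ.<-asym (ℕ.<-trans z<p p<y))
        -- `W` is one of the two merged trees, both of which contain `v`. If `p` is not in `W`, no
        -- walk from `v` gets past `p`, because no edge jumps over it. If `p` is in `W`, it is
        -- extreme there, and having `v` below it makes it the maximum.
        below : ∀ {W} → (∀ {f} → f ∈ W → f ∈ U) → MeetsAtExtremes P W → v ∈ vertices W → v < p →
                ∀ {x} → x ∈ vertices W → Connected W v x → x ≤ p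
        below {W} W⊆ meets v∈ v<p x∈ c with p ∈? vertices W
        ... | no p∉ = ℕ.<⇒≤ (one-sided (_< p) (stay-below W⊆) p∉ c v<p)
        ... | yes p∈ with All.lookup meets p∈P p∈
        ...   | inj₁ (_ , p≤) = contradiction (All.lookup p≤ v∈) (ℕ.<⇒≱ v<p)
        ...   | inj₂ (_ , ≤p) = All.lookup ≤p x∈
        above : ∀ {W} → (∀ {f} → f ∈ W → f ∈ U) → MeetsAtExtremes P W → v ∈ vertices W → p < v →
                ∀ {x} → x ∈ vertices W → Connected W v x → p ≤ x
        above {W} W⊆ meets v∈ p<v x∈ c with p ∈? vertices W
        ... | no p∉ = ℕ.<⇒≤ (one-sided (p <_) (stay-above W⊆) p∉ c p<v)
        ... | yes p∈ with All.lookup meets p∈P p∈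
        ...   | inj₁ (_ , p≤) = All.lookup p≤ x∈
        ...   | inj₂ (_ , ≤p) = contradiction (All.lookup ≤p v∈) (ℕ.<⇒≱ p<v)
        extreme : IsMin U p ⊎ IsMax U p
        extreme with <-cmp v p
        ... | tri≈ _ refl _ = contradiction p∈P v∉P
        ... | tri< v<p _ _ = inj₂ (p∈U , All.tabulate λ x∈ → case vertices-++⁻ S₁ x∈ of λ
          { (inj₁ x∈) → below ∈-++⁺ˡ meets₁ v∈ v<p x∈ (conn₁ x∈)
          ; (inj₂ x∈) → below (∈-++⁺ʳ S₁) meets₂ v∈₂ v<p x∈ (conn₂ x∈) })
        ... | tri> _ _ p<v = inj₁ (p∈U , All.tabulate λ x∈ → case vertices-++⁻ S₁ x∈ of λ
          { (inj₁ x∈) → above ∈-++⁺ˡ meets₁ v∈ p<v x∈ (conn₁ x∈)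
          ; (inj₂ x∈) → above (∈-++⁺ʳ S₁) meets₂ v∈₂ p<v x∈ (conn₂ x∈) })
      Umeets : MeetsAtExtremes P U
      Umeets = All.tabulate extreme

min-exists : ∀ {S : Graph n} → S ≢ [] → ∃[ i ] IsMin S i
min-exists {S = []}    ne = contradiction refl ne
min-exists {S = e ∷ S} ne with i , i∈ , _ , least ← minimal toℕ {λ _ → ⊤} (λ _ → yes tt)
                                  {vertices (e ∷ S)} (here tt) =
  i , i∈ , All.tabulate λ v∈ → least v∈ tt

max-exists : ∀ {S : Graph n} → S ≢ [] → ∃[ j ] IsMax S j
max-exists {S = []}        ne = contradiction refl ne
max-exists {n} {S = e ∷ S} ne with j , j∈ , _ , least ← minimal (λ v → suc n ℕ.∸ toℕ v) {λ _ → ⊤}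
                                      (λ _ → yes tt) {vertices (e ∷ S)} (here tt) =
  j , j∈ , All.tabulate λ {v} v∈ → ℕ.∸-cancelʳ-≤ (ℕ.<⇒≤ (toℕ<n v)) (least v∈ tt)

mainPath-exists : ∀ {S : Graph n} → IsNonemptyTree S → ∃[ P ] IsMainPath S P
mainPath-exists {S = S} (ne , _ , connected) with i , min ← min-exists {S = S} ne | j , max ← max-exists {S = S} ne
  with P , path ← connected i j (proj₁ min) (proj₁ max) = P , i , j , min , max , path

mainPath-ends : ∀ {S : Graph n} {P i j} → IsMainPath S P → head P ≡ just i → last P ≡ just j →
                IsMin S i × IsMax S j
mainPath-ends (u , v , min , max , h , l , _) h′ l′
  with refl ← just-injective (trans (sym h) h′) | refl ← just-injective (trans (sym l) l′) = min , max

singleton-tree : ∀ (e : Edge n) → IsNonemptyTree (e ∷ [])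
singleton-tree {n} e = (λ ()) , noncrossing-alternating⇒forest ([] ∷ []) nc alt , λ u v u∈ v∈ →
  connected⇒path (conn u∈ ◅◅ Star.reverse adj-sym (conn v∈))
  where
  nc : NonCrossing (e ∷ [])
  nc _ _ (here refl) (here refl) (p , _) = ℕ.<-irrefl refl p
  alt : Alternating (e ∷ [])
  alt _ _ (here refl) (here refl) p = ℕ.<-irrefl (cong toℕ (sym p)) (src<tgt! e)
  conn : ∀ {u} → u ∈ vertices (e ∷ []) → Connected (e ∷ []) u (src e)
  conn (here refl)         = ε
  conn (there (here refl)) = adj-sym (adj-edge (here refl)) ◅ ε

-- Each edge off the path may be its own tree, since both of its ends are extreme.
decomposition-exists : ∀ (S : Graph n) P → ∃[ Ts ] IsDecomposition S P Ts
decomposition-exists S P = map (_∷ []) (S ∖ P) , ↭-reflexive (concat-map-[ S ∖ P ]) ,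
  All.map⁺ (All.universal (λ e → singleton-tree e , All.universal (λ { v → extremes e v }) P) (S ∖ P))
  where
  extremes : ∀ e v → v ∈ vertices (e ∷ []) → IsMin (e ∷ []) v ⊎ IsMax (e ∷ []) v
  extremes e _ (here refl)         = inj₁ (here refl , ℕ.≤-refl ∷ ℕ.<⇒≤ (src<tgt! e) ∷ [])
  extremes e _ (there (here refl)) = inj₂ (there (here refl) , ℕ.<⇒≤ (src<tgt! e) ∷ ℕ.≤-refl ∷ [])

-- `IsMinimalDecomposition` excludes only decompositions with exactly one tree fewer, so descending
-- one tree at a time reaches a minimal one.
minimalDecomposition-exists : ∀ (S : Graph n) P → ∃[ Ts ] IsMinimalDecomposition S P Ts
minimalDecomposition-exists S P with Ts , dec ← decomposition-exists S P = go _ Ts refl dec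
  where
  go : ∀ m Ts → length Ts ≡ m → IsDecomposition S P Ts → ∃[ Ts ] IsMinimalDecomposition S P Ts
  go m Ts len dec with anyDecomposition? S P proj₁
    (λ Ts′ → isDecomposition? S P Ts′ ×-dec suc (length Ts′) ℕ.≟ length Ts)
  ... | no ¬smaller = Ts , dec , ¬smaller
  go zero    Ts len dec | yes (Ts′ , dec′ , len′) = contradiction (trans len′ len) λ ()
  go (suc m) Ts len dec | yes (Ts′ , dec′ , len′) = go m Ts′ (ℕ.suc-injective (trans len′ len)) dec′

-- Increasing chains, blocks and coverings

hasEdge⁺ : ∀ {T : Graph n} {e} → e ∈ T → HasEdge T (src e) (tgt e)
hasEdge⁺ e∈ = lose e∈ (refl , refl)

star-≤ : ∀ {T : Graph n} {a b} → Star (HasEdge T) a b → a ≤ b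
star-≤ ε = ℕ.≤-refl
star-≤ {T = T} (p ◅ ps) = ℕ.≤-trans (ℕ.<⇒≤ (hasEdge⇒< T p)) (star-≤ ps)

route : ∀ {T : Graph n} {a b} → TransClosure (HasEdge T) a b → Graph n
route [ p ]   = proj₁ (find p) ∷ []
route (p ∷ c) = proj₁ (find p) ∷ route c

route-split : ∀ {T : Graph n} {a b e} (c : TransClosure (HasEdge T) a b) → e ∈ route c →
              Star (HasEdge T) a (src e) × Star (HasEdge T) (tgt e) b
route-split [ p ] (here refl) with _ , _ , refl , refl ← find p = ε , ε
route-split {T = T} (p ∷ c) (here refl) with _ , _ , refl , refl ← find p = ε , star c
  where
  star : ∀ {a b} → TransClosure (HasEdge T) a b → Star (HasEdge T) a b
  star [ p ]   = p ◅ ε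
  star (p ∷ c) = p ◅ star c
route-split (p ∷ c) (there e∈) with l , r ← route-split c e∈ = p ◅ l , r

module _ (T : Graph n) where

  Full : Graph n → Vertex n → Set
  Full S v = ∀ {e} → e ∈ T → Touches e v → e ∈ S

  -- A subtree of T attached to the rest of T at one of its extreme vertices at most.
  record Block (S : Graph n) : Set where
    field
      sub      : ∀ {e} → e ∈ S → e ∈ T
      tree     : IsNonemptyTree S
      interior : ∀ {v} → v ∈ vertices S → ¬ IsMin S v → ¬ IsMax S v → Full S v
      end      : ∀ {i j} → IsMin S i → IsMax S j → Full S i ⊎ Full S j

open Block

module _ {T : Graph n} (nc : NonCrossing T) where
  open DecMembership (_≟_ {suc n}) using (_∈?_)

  -- The main path contains both extreme vertices of `S`, so a vertex of the part off the path is
  -- interior to `S` and keeps all its edges there; `saturated` keeps them in the part. One end of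
  -- the part must lie off the path, because two vertices of the path are not connected outside it.
  block-part : ∀ {S P Ts S₁} → Block T S → IsMainPath S P → IsMinimalDecomposition S P Ts → S₁ ∈ Ts →
               Block T S₁
  block-part {S} {P} {Ts} {S₁} b mp@(u , v , min , max , h , l , L , U) dec S₁∈ = record
    { sub = sub b ∘ proj₁ ∘ ∖⁻ S P ∘ S₁⊆
    ; tree = proj₁ (All.lookup (proj₂ (proj₁ dec)) S₁∈)
    ; interior = λ v∈ ¬min ¬max → full v∈ (λ v∈P →
        Sum.[ ¬min , ¬max ] (All.lookup (proj₂ (All.lookup (proj₂ (proj₁ dec)) S₁∈)) v∈P v∈))
    ; end = ends
    }
    where
    S₁⊆ : ∀ {e} → e ∈ S₁ → e ∈ S ∖ P
    S₁⊆ e∈ = ∈-resp-↭ (proj₁ (proj₁ dec)) (∈-concat⁺′ e∈ S₁∈)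
    forest : IsForest S
    forest = proj₁ (proj₂ (tree b))
    full : ∀ {v} → v ∈ vertices S₁ → v ∉ P → Full T S₁ v
    full {w} v∈ v∉ e∈ t = saturated (noncrossing-⊆ (sub b) nc) forest mp dec S₁∈ v∈ v∉
      (interior b v∈S (λ min′ → v∉ (subst (_∈ P) (min-unique {G = S} min min′) (head∈ h)))
                      (λ max′ → v∉ (subst (_∈ P) (max-unique {G = S} max max′) (last∈ l))) e∈ t) t
      where
      v∈S : w ∈ vertices S
      v∈S with f , f∈ , s ← ∈vertices⁻ v∈ = touches∈vertices {e = f} (proj₁ (∖⁻ S P (S₁⊆ f∈))) s
    ends : ∀ {i j} → IsMin S₁ i → IsMax S₁ j → Full T S₁ i ⊎ Full T S₁ j
    ends {i} {j} min₁ max₁ with i ∈? P | j ∈? P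
    ... | no i∉ | _     = inj₁ (full (proj₁ min₁) i∉)
    ... | yes _ | no j∉ = inj₂ (full (proj₁ max₁) j∉)
    ... | yes i∈ | yes j∈ = contradiction
      (path⇒connected (proj₂ (proj₂ (proj₂ (proj₁ (All.lookup (proj₂ (proj₁ dec)) S₁∈))) i j
        (proj₁ min₁) (proj₁ max₁))))
      (off-path forest L U S₁⊆ i∈ j∈ (min≢max S₁ min₁ max₁))

  pseudoComponent⇒block : ∀ {C S} → Block T S → PseudoComponent C S → ∃[ S′ ] Block T S′ × IsMainPath S′ C
  pseudoComponent⇒block b (main m)        = _ , b , m
  pseudoComponent⇒block b (part m d S∈ p) = pseudoComponent⇒block (block-part b m d S∈) p

  pseudoComponent-through : ∀ {S e} → Block T S → e ∈ S →
    ∃[ C ] PseudoComponent C S × ∃[ S′ ] Block T S′ × IsMainPath S′ C × Traverses C e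
  pseudoComponent-through {S} = go S (ℕ.<-wellFounded (length S))
    where
    go : ∀ S → Acc ℕ._<_ (length S) → ∀ {e} → Block T S → e ∈ S →
         ∃[ C ] PseudoComponent C S × ∃[ S′ ] Block T S′ × IsMainPath S′ C × Traverses C e
    go S (acc rs) {e} b e∈ with P , m ← mainPath-exists {S = S} (tree b) with traverses? P e
    ... | yes t = P , main m , S , b , m , t
    ... | no ¬t with Ts , d ← minimalDecomposition-exists S P
      with S₁ , e∈₁ , S₁∈ ← ∈-concat⁻′ Ts
             (∈-resp-↭ (↭-sym (proj₁ (proj₁ d))) (∈-filter⁺ (¬? ∘ traverses? P) e∈ ¬t))
      with C , p , S′ , rest ← go S₁ (rs (subtree-shorter m (proj₁ d) S₁∈)) (block-part b m d S₁∈) e∈₁ =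
      C , part m d S₁∈ p , S′ , rest

  module _ {S : Graph n} {i j : Vertex n} (b : Block T S) (min : IsMin S i) (max : IsMax S j) where

    full-inside : ∀ {v} → v ∈ vertices S → v ≢ i → v ≢ j → Full T S v
    full-inside v∈ v≢i v≢j = interior b v∈
      (λ min′ → v≢i (min-unique {G = S} min′ min)) (λ max′ → v≢j (max-unique {G = S} max′ max))

    -- An increasing chain can leave the block only at `i` or `j`: it starts above `i`, and no edge
    -- of `T` leads upwards from `j`. The mirror image is `confined-left`.
    confined-right : (∀ s → j < s → ¬ HasEdge T j s) → ∀ {w x} → w ∈ vertices S → i < w →
                     Star (HasEdge T) w x → x ∈ vertices S
    confined-right ¬out w∈ i<w ε = w∈
    confined-right ¬out {w} w∈ i<w (p ◅ ps) with w ≟ j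
    ... | yes refl = contradiction p (¬out _ (hasEdge⇒< T p))
    ... | no  w≢j with e , e∈ , refl , refl ← find p =
      confined-right ¬out (tgt∈vertices (full-inside w∈ (λ { refl → ℕ.<-irrefl refl i<w }) w≢j e∈ (inj₁ refl)))
        (ℕ.<-trans i<w (src<tgt! e)) ps

    confined-left : (∀ s → s < i → ¬ HasEdge T s i) → ∀ {x w} → w ∈ vertices S → w < j →
                    Star (HasEdge T) x w → x ∈ vertices S
    confined-left ¬in w∈ w<j ε = w∈
    confined-left ¬in w∈ w<j (_◅_ {j = y} p ps) with y ≟ i
    ... | yes refl = contradiction p (¬in _ (hasEdge⇒< T p))
    ... | no  y≢i with e , e∈ , refl , refl ← find p =
      src∈vertices (full-inside (confined-left ¬in w∈ w<j ps) y≢i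
        (λ { refl → ℕ.<⇒≱ w<j (star-≤ ps) }) e∈ (inj₂ refl))

    module _ {e : Edge n} (χ : Cut T e) (separated : side χ i ≢ side χ j) where

      full-left : Full T S i → ∀ {v} → v ∈ vertices S → side χ v ≢ side χ j → Full T S v
      full-left full {v} v∈ v≁j with v ≟ i
      ... | yes refl = full
      ... | no  v≢i  = full-inside v∈ v≢i (λ { refl → v≁j refl })

      -- Until it uses `e`, the chain stays on the side away from `j`, where every vertex of the
      -- block is full. It thus remains inside the block, and cannot reach `j` or pass beyond it.
      route-right : Full T S i → ∀ {v x} → v ∈ vertices S → side χ v ≢ side χ j → j ≤ x →
                    (c : TransClosure (HasEdge T) v x) → e ∈ route c
      route-right full v∈ v≁j j≤x [ p ] with g , g∈ , refl , refl ← find p with g ≟ᴱ e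
      ... | yes refl = here refl
      ... | no  g≢e  = contradiction (trans (side-other χ g∈ g≢e) (cong (side χ) (toℕ-injective
        (ℕ.≤-antisym (All.lookup (proj₂ max) (tgt∈vertices (full-left full v∈ v≁j g∈ (inj₁ refl)))) j≤x)))) v≁j
      route-right full v∈ v≁j j≤x (p ∷ c) with g , g∈ , refl , refl ← find p with g ≟ᴱ e
      ... | yes refl = here refl
      ... | no  g≢e  = there (route-right full (tgt∈vertices (full-left full v∈ v≁j g∈ (inj₁ refl)))
                                (λ q → v≁j (trans (side-other χ g∈ g≢e) q)) j≤x c)

      -- Read backwards from `j`: until `e` is met, the chain stays on the side of `j`, hence away
      -- from `i` and among full vertices of the block.
      route-left : Full T S j → ∀ {v} (c : TransClosure (HasEdge T) v j) →
                   e ∈ route c ⊎ (v ∈ vertices S × side χ v ≡ side χ j)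
      route-left full [ p ] with g , g∈ , refl , refl ← find p with g ≟ᴱ e
      ... | yes refl = inj₁ (here refl)
      ... | no  g≢e  = inj₂ (src∈vertices (full g∈ (inj₂ refl)) , side-other χ g∈ g≢e)
      route-left full (p ∷ c) with g , g∈ , refl , refl ← find p with g ≟ᴱ e | route-left full c
      ... | yes refl | _               = inj₁ (here refl)
      ... | no  g≢e  | inj₁ e∈         = inj₁ (there e∈)
      ... | no  g≢e  | inj₂ (w∈ , w∼j) = inj₂
        (src∈vertices (full-inside w∈ (λ { refl → separated w∼j }) (λ { refl → ends c }) g∈ (inj₂ refl)) ,
         trans (side-other χ g∈ g≢e) w∼j)
        where
        ends : ∀ {v} → ¬ TransClosure (HasEdge T) v v
        ends c = ℕ.<-irrefl refl (closure-< c)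
          where
          closure-< : ∀ {a b} → TransClosure (HasEdge T) a b → a < b
          closure-< [ p ]   = hasEdge⇒< T p
          closure-< (p ∷ c) = ℕ.<-trans (hasEdge⇒< T p) (closure-< c)

-- When `T` is a forest, the chain behind an edge of the closure is unique. Quantifying over all
-- chains then loses nothing and avoids fixing a choice.
Covers : (F T : Graph n) → Set
Covers F T = ∀ {e} → e ∈ T → ∃[ f ] f ∈ F × (∀ (c : InClosure T f) → e ∈ route c)

module _ {T F : Graph n} (nc : NonCrossing T) (block : Block T T) where

  -- The edge `e` lies on a pseudo-component, the main path of a block. One end of the block is
  -- full: if it is the minimum, the pseudo-component is left, otherwise it is right. The forest
  -- edge given by that condition has a chain spanning the block, and `e` separates the two ends of
  -- the block.
  conditions⇒covers : All (InClosure T) F →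
    (∀ i j → RightPseudoComponentOn T i j → ∃[ i₁ ] i₁ ≤ i × HasEdge F i₁ j) →
    (∀ i j → LeftPseudoComponentOn T i j → ∃[ j₁ ] j ≤ j₁ × HasEdge F i j₁) → Covers F T
  conditions⇒covers cl right left {e} e∈
    with C , pc , S , b , mp@(i , j , min , max , h , l , L , U) , t ← pseudoComponent-through nc block e∈ =
    by-end (end b min max)
    where
    χ = cut (proj₁ (proj₂ (tree block))) e∈
    separated : side χ i ≢ side χ j
    separated = path-separates χ (Linked.map (adj-⊆ (sub b)) L) U h l t
    i≢j = min≢max S min max
    i<j : i < j
    i<j = ℕ.≤∧≢⇒< (All.lookup (proj₂ min) (proj₁ max)) (i≢j ∘ toℕ-injective)
    on : PseudoComponentOn T i j
    on = i<j , C , pc , h , l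
    by-end : Full T S i ⊎ Full T S j → ∃[ f ] f ∈ F × (∀ (c : InClosure T f) → e ∈ route c)
    by-end (inj₁ full) with j₁ , j≤j₁ , p ← left i j (on , λ s s<i q → case find q of λ
        { (g , g∈ , refl , refl) → ℕ.<⇒≱ s<i (All.lookup (proj₂ min) (src∈vertices (full g∈ (inj₂ refl)))) })
      with f , f∈ , refl , refl ← find p =
      f , f∈ , route-right nc b min max χ separated full (proj₁ min) separated j≤j₁
    by-end (inj₂ full) with i₁ , i₁≤i , p ← right i j (on , λ s j<s q → case find q of λ
        { (g , g∈ , refl , refl) → ℕ.<⇒≱ j<s (All.lookup (proj₂ max) (tgt∈vertices (full g∈ (inj₁ refl)))) })
      with f , f∈ , refl , refl ← find p =
      f , f∈ , λ c → case route-left nc b min max χ separated full c of λ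
        { (inj₁ e∈c) → e∈c
        ; (inj₂ (v∈ , v∼j)) → contradiction (trans (cong (side χ) (toℕ-injective
            (ℕ.≤-antisym (All.lookup (proj₂ min) v∈) i₁≤i))) v∼j) separated }

  module _ (ncF : NonCrossing F) (altF : Alternating F) (cl : All (InClosure T) F) (cov : Covers F T) where

    private
      cover : ∀ {e} → e ∈ T →
              ∃[ f ] f ∈ F × Star (HasEdge T) (src f) (src e) × Star (HasEdge T) (tgt e) (tgt f)
      cover e∈ with f , f∈ , h ← cov e∈ = f , f∈ , route-split (All.lookup cl f∈) (h (All.lookup cl f∈))

      located : ∀ {i j} → PseudoComponentOn T i j → ∃[ S ] ∃[ C ] Block T S × IsMin S i × IsMax S j ×
                head C ≡ just i × last C ≡ just j × Linked (Adj S) C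
      located (_ , C , pc , h , l) with S , b , m@(_ , _ , _ , _ , _ , _ , L , _) ← pseudoComponent⇒block nc block pc
        with min , max ← mainPath-ends {S = S} m h l = S , C , b , min , max , h , l , L

      joins-exit : ∀ {e : Edge n} {x y a : Vertex n} → Joins e x y → x < a → a ≤ y → src e < a × a ≤ tgt e
      joins-exit (inj₁ (refl , refl)) x<a a≤y = x<a , a≤y
      joins-exit {e} (inj₂ (refl , refl)) x<a a≤y =
        contradiction (src<tgt! e) (ℕ.<-asym (ℕ.<-≤-trans x<a a≤y))

      joins-leave : ∀ {e : Edge n} {x y a : Vertex n} → Joins e x y → x ≤ a → a < y → src e ≤ a × a < tgt e
      joins-leave (inj₁ (refl , refl)) x≤a a<y = x≤a , a<y
      joins-leave {e} (inj₂ (refl , refl)) x≤a a<y =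
        contradiction (src<tgt! e) (ℕ.<-asym (ℕ.≤-<-trans x≤a a<y))

    -- Starting from `a` equal to `j`, take an edge of the pseudo-component reaching from below `a`
    -- to `a` or beyond, and a forest edge `f` covering it. A target beyond `j` would make its chain
    -- leave the block at `j`. A target below `j` would make `f` cross the edge from `a` to `j` or
    -- break alternation there. So `f` ends at `j` and starts below `a`, and the start descends
    -- until it is at most `i`.
    covers⇒right : ∀ i j → RightPseudoComponentOn T i j → ∃[ i₁ ] i₁ ≤ i × HasEdge F i₁ j
    covers⇒right i j (on@(i<j , _) , ¬out) with S , C , b , min , max , h , l , L ← located on =
      descend j (<-wellFounded j) i<j ℕ.≤-refl (inj₁ refl)
      where
      descend : ∀ a → Acc _<_ a → i < a → a ≤ j → a ≡ j ⊎ HasEdge F a j → ∃[ i₁ ] i₁ ≤ i × HasEdge F i₁ j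
      descend a (acc rs) i<a a≤j a∼j
        with x , y , _ , _ , r , x<a , y≮a ← linked-exit (_<? a) L h (last∈ l) i<a (ℕ.≤⇒≯ a≤j)
        with g , g∈ , k ← find r
        with f , f∈ , to , from ← cover (sub b g∈) = by-target (<-cmp (tgt f) j) a∼j
        where
        s<a : src g < a
        s<a = proj₁ (joins-exit {g} k x<a (ℕ.≮⇒≥ y≮a))
        a≤t : a ≤ tgt g
        a≤t = proj₂ (joins-exit {g} k x<a (ℕ.≮⇒≥ y≮a))
        f<a : src f < a
        f<a = ℕ.≤-<-trans (star-≤ to) s<a
        a≤f : a ≤ tgt f
        a≤f = ℕ.≤-trans a≤t (star-≤ from)
        by-target : _ → a ≡ j ⊎ HasEdge F a j → ∃[ i₁ ] i₁ ≤ i × HasEdge F i₁ j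
        by-target (tri≈ _ refl _) _ with src f ≤? i
        ... | yes f≤i = src f , f≤i , hasEdge⁺ f∈
        ... | no  f≰i = descend (src f) (rs f<a) (ℕ.≰⇒> f≰i) (ℕ.<⇒≤ (src<tgt! f)) (inj₂ (hasEdge⁺ f∈))
        by-target (tri> _ _ j<f) _ = contradiction
          (All.lookup (proj₂ max) (confined-right nc b min max ¬out (tgt∈vertices g∈) (ℕ.<-≤-trans i<a a≤t) from))
          (ℕ.<⇒≱ j<f)
        by-target (tri< f<j _ _) (inj₁ refl) = contradiction a≤f (ℕ.<⇒≱ f<j)
        by-target (tri< f<j _ _) (inj₂ p) with e , e∈ , refl , refl ← find p = contradiction
          (f<a , ℕ.≤∧≢⇒< a≤f (altF f e f∈ e∈ ∘ sym ∘ toℕ-injective) , f<j) (ncF f e f∈ e∈)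

    -- The mirror image: forest edges starting at `i` get longer until one reaches `j` or beyond.
    covers⇒left : ∀ i j → LeftPseudoComponentOn T i j → ∃[ j₁ ] j ≤ j₁ × HasEdge F i j₁
    covers⇒left i j (on@(i<j , _) , ¬in) with S , C , b , min , max , h , l , L ← located on =
      ascend i (>-wellFounded i) ℕ.≤-refl i<j (inj₁ refl)
      where
      ascend : ∀ a → Acc (λ u v → v < u) a → i ≤ a → a < j → a ≡ i ⊎ HasEdge F i a →
               ∃[ j₁ ] j ≤ j₁ × HasEdge F i j₁
      ascend a (acc rs) i≤a a<j a∼i
        with x , y , _ , _ , r , x≤a , y≰a ← linked-exit (_≤? a) L h (last∈ l) i≤a (ℕ.<⇒≱ a<j)
        with g , g∈ , k ← find r
        with f , f∈ , to , from ← cover (sub b g∈) = by-source (<-cmp (src f) i) a∼i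
        where
        s≤a : src g ≤ a
        s≤a = proj₁ (joins-leave {g} k x≤a (ℕ.≰⇒> y≰a))
        f≤a : src f ≤ a
        f≤a = ℕ.≤-trans (star-≤ to) s≤a
        a<f : a < tgt f
        a<f = ℕ.<-≤-trans (proj₂ (joins-leave {g} k x≤a (ℕ.≰⇒> y≰a))) (star-≤ from)
        by-source : _ → a ≡ i ⊎ HasEdge F i a → ∃[ j₁ ] j ≤ j₁ × HasEdge F i j₁
        by-source (tri≈ _ refl _) _ with j ≤? tgt f
        ... | yes j≤f = tgt f , j≤f , hasEdge⁺ f∈
        ... | no  j≰f = ascend (tgt f) (rs a<f) (ℕ.<⇒≤ (src<tgt! f)) (ℕ.≰⇒> j≰f) (inj₂ (hasEdge⁺ f∈))
        by-source (tri< f<i _ _) _ = contradiction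
          (All.lookup (proj₂ min) (confined-left nc b min max ¬in (src∈vertices g∈) (ℕ.≤-<-trans s≤a a<j) to))
          (ℕ.<⇒≱ f<i)
        by-source (tri> _ _ i<f) (inj₁ refl) = contradiction f≤a (ℕ.<⇒≱ i<f)
        by-source (tri> _ _ i<f) (inj₂ p) with e , e∈ , refl , refl ← find p = contradiction
          (i<f , ℕ.≤∧≢⇒< f≤a (altF e f e∈ f∈ ∘ sym ∘ toℕ-injective) , a<f) (ncF e f e∈ f∈)

-- The counted forests form a model of T

∈-edgesFrom⁻ : ∀ i (vs : List (Vertex n)) {e} → e ∈ mapMaybe (edge? i) vs → src e ≡ i × tgt e ∈ vs
∈-edgesFrom⁻ i (v ∷ vs) e∈ with i <? v
... | no _ with p , q ← ∈-edgesFrom⁻ i vs e∈ = p , there q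
∈-edgesFrom⁻ i (v ∷ vs) (here refl) | yes _ = refl , here refl
∈-edgesFrom⁻ i (v ∷ vs) (there e∈)  | yes _ with p , q ← ∈-edgesFrom⁻ i vs e∈ = p , there q

∈-edgesFrom⁺ : ∀ (e : Edge n) {vs} → tgt e ∈ vs → e ∈ mapMaybe (edge? (src e)) vs
∈-edgesFrom⁺ e {v ∷ vs} t∈ with src e <? v | t∈
... | yes _ | here refl = here refl
... | yes _ | there t∈  = there (∈-edgesFrom⁺ e t∈)
... | no ¬p | here refl = contradiction (src<tgt! e) ¬p
... | no _  | there t∈  = ∈-edgesFrom⁺ e t∈

unique-edgesFrom : ∀ i {vs : List (Vertex n)} → Unique vs → Unique (mapMaybe (edge? i) vs)
unique-edgesFrom i []                = []
unique-edgesFrom i {v ∷ vs} (v∉ ∷ U) with i <? v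
... | no _  = unique-edgesFrom i U
... | yes _ = All.tabulate (λ f∈ → λ { refl → All.lookup v∉ (proj₂ (∈-edgesFrom⁻ i vs f∈)) refl }) ∷
              unique-edgesFrom i U

∈-edges : ∀ (e : Edge n) → e ∈ edges n
∈-edges e = ∈-concatMap⁺ (λ i → mapMaybe (edge? i) (allFin _))
  (lose (∈-allFin (src e)) (∈-edgesFrom⁺ e (∈-allFin (tgt e))))

unique-concatMap : ∀ {A B : Set} {g : A → List B} {xs} → Unique xs → (∀ {x} → x ∈ xs → Unique (g x)) →
                   (∀ {x y b} → x ∈ xs → y ∈ xs → b ∈ g x → b ∈ g y → x ≡ y) → Unique (concatMap g xs)
unique-concatMap [] Ug h = []
unique-concatMap {g = g} {x ∷ xs} (x∉ ∷ U) Ug h = Unique.++⁺ (Ug (here refl))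
  (unique-concatMap U (Ug ∘ there) (λ y∈ z∈ → h (there y∈) (there z∈)))
  λ (b∈ , b∈′) → case find (∈-concatMap⁻ g {xs = xs} b∈′) of λ
    (y , y∈ , b∈y) → All.lookup x∉ y∈ (h (here refl) (there y∈) b∈ b∈y)

unique-edges : ∀ n → Unique (edges n)
unique-edges n = unique-concatMap (Unique.allFin⁺ _) (λ {i} _ → unique-edgesFrom i (Unique.allFin⁺ _))
  λ {i} {j} _ _ e∈ e∈′ → trans (sym (proj₁ (∈-edgesFrom⁻ i (allFin _) e∈))) (proj₁ (∈-edgesFrom⁻ j (allFin _) e∈′))

module _ {A : Set} where
  ∈-sublists⁻ : ∀ {xs ys : List A} → ys ∈ sublists xs → ∀ {y} → y ∈ ys → y ∈ xs
  ∈-sublists⁻ {[]}     (here refl) ()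
  ∈-sublists⁻ {x ∷ xs} ys∈ y∈ with ∈-++⁻ (map (x ∷_) (sublists xs)) ys∈
  ... | inj₂ ys∈′ = there (∈-sublists⁻ ys∈′ y∈)
  ... | inj₁ ys∈′ with zs , zs∈ , refl ← ∈-map⁻ (x ∷_) ys∈′ | y∈
  ...   | here refl = here refl
  ...   | there y∈′ = there (∈-sublists⁻ zs∈ y∈′)

  unique-sublist : ∀ {xs ys : List A} → Unique xs → ys ∈ sublists xs → Unique ys
  unique-sublist []       (here refl) = []
  unique-sublist {x ∷ xs} (x∉ ∷ U) ys∈ with ∈-++⁻ (map (x ∷_) (sublists xs)) ys∈
  ... | inj₂ ys∈′ = unique-sublist U ys∈′
  ... | inj₁ ys∈′ with zs , zs∈ , refl ← ∈-map⁻ (x ∷_) ys∈′ =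
    All.tabulate (λ y∈ → All.lookup x∉ (∈-sublists⁻ zs∈ y∈)) ∷ unique-sublist U zs∈

  unique-sublists : ∀ {xs : List A} → Unique xs → Unique (sublists xs)
  unique-sublists []       = [] ∷ []
  unique-sublists {x ∷ xs} (x∉ ∷ U) = Unique.++⁺
    (Unique.map⁺ (λ { refl → refl }) (unique-sublists U)) (unique-sublists U)
    λ (p , q) → case ∈-map⁻ (x ∷_) p of λ { (_ , _ , refl) → All.lookup x∉ (∈-sublists⁻ q (here refl)) refl }

  sublist-ext : ∀ {xs ys zs : List A} → Unique xs → ys ∈ sublists xs → zs ∈ sublists xs →
                (∀ {x} → x ∈ ys → x ∈ zs) → (∀ {x} → x ∈ zs → x ∈ ys) → ys ≡ zs
  sublist-ext {[]} _ (here refl) (here refl) _ _ = refl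
  sublist-ext {x ∷ xs} (x∉ ∷ U) ys∈ zs∈ ⊆ ⊇
    with ∈-++⁻ (map (x ∷_) (sublists xs)) ys∈ | ∈-++⁻ (map (x ∷_) (sublists xs)) zs∈
  ... | inj₂ p | inj₂ q = sublist-ext U p q ⊆ ⊇
  ... | inj₁ p | inj₂ q with _ , _ , refl ← ∈-map⁻ (x ∷_) p =
    contradiction refl (All.lookup x∉ (∈-sublists⁻ q (⊆ (here refl))))
  ... | inj₂ p | inj₁ q with _ , _ , refl ← ∈-map⁻ (x ∷_) q =
    contradiction refl (All.lookup x∉ (∈-sublists⁻ p (⊇ (here refl))))
  ... | inj₁ p | inj₁ q with ys , ys∈ , refl ← ∈-map⁻ (x ∷_) p | zs , zs∈ , refl ← ∈-map⁻ (x ∷_) q =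
    cong (x ∷_) (sublist-ext U ys∈ zs∈ (drop-x ys∈ ⊆) (drop-x zs∈ ⊇))
    where
    drop-x : ∀ {as bs} → as ∈ sublists xs → (∀ {y} → y ∈ x ∷ as → y ∈ x ∷ bs) → ∀ {y} → y ∈ as → y ∈ bs
    drop-x as∈ h y∈ with h (there y∈)
    ... | here refl = contradiction refl (All.lookup x∉ (∈-sublists⁻ as∈ y∈))
    ... | there y∈′ = y∈′

  filter∈sublists : ∀ {P : A → Set} (P? : ∀ x → Dec (P x)) xs → filter P? xs ∈ sublists xs
  filter∈sublists P? []       = here refl
  filter∈sublists P? (x ∷ xs) with P? x
  ... | yes p = ∈-++⁺ˡ (∈-map⁺ (x ∷_) (filter∈sublists P? xs))
  ... | no ¬p = ∈-++⁺ʳ (map (x ∷_) (sublists xs)) (filter∈sublists P? xs)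

member : ∀ {Gs : List (Graph n)} (q : Any Flow Gs) → ∃[ G ] G ∈ Gs × ∃[ c ] bagᴾ q ≡ bag {G = G} c
member (here c)  = _ , here refl , c , refl
member (there q) with G , G∈ , c , eq ← member q = G , there G∈ , c , eq

inject : ∀ {Gs : List (Graph n)} {G} → G ∈ Gs → (c : Flow G) → ∃[ q ] bagᴾ {Gs = Gs} q ≡ bag c
inject (here refl) c = here c , refl
inject (there G∈)  c with q , eq ← inject G∈ c = there q , eq

-- Flows are positive, so the edges that occur in a bag are those of its graph and identify the
-- member; the multiplicities then give the flow.
bagᴾ-injective : ∀ {Gs : List (Graph n)} → Unique Gs → All Unique Gs →
  (∀ {G H} → G ∈ Gs → H ∈ Gs → (∀ {e} → e ∈ G → e ∈ H) → (∀ {e} → e ∈ H → e ∈ G) → G ≡ H) →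
  ∀ {q q′ : Any Flow Gs} → bagᴾ q ↭ bagᴾ q′ → q ≡ q′
bagᴾ-injective _ (u ∷ _) ext {here c} {here d} p =
  cong here (flow-ext u λ {e} _ → ↭-length (filter-↭ (_≟ᴱ e) p))
bagᴾ-injective (_ ∷ U) (_ ∷ us) ext {there q} {there q′} p =
  cong there (bagᴾ-injective U us (λ G∈ H∈ → ext (there G∈) (there H∈)) p)
bagᴾ-injective (G∉ ∷ _) _ ext {here c} {there q} p with H , H∈ , d , eq ← member q =
  contradiction (ext (here refl) (there H∈)
      (λ e∈ → bag⊆ d (subst (_ ∈_) eq (∈-resp-↭ p (⊆bag c e∈))))
      (λ e∈ → bag⊆ c (∈-resp-↭ (↭-sym p) (subst (_ ∈_) (sym eq) (⊆bag d e∈)))))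
    (All.lookup G∉ H∈)
bagᴾ-injective (G∉ ∷ _) _ ext {there q} {here c} p with H , H∈ , d , eq ← member q =
  contradiction (ext (here refl) (there H∈)
      (λ e∈ → bag⊆ d (subst (_ ∈_) eq (∈-resp-↭ (↭-sym p) (⊆bag c e∈))))
      (λ e∈ → bag⊆ c (∈-resp-↭ p (subst (_ ∈_) (sym eq) (⊆bag d e∈)))))
    (All.lookup G∉ H∈)

pairing-cut : ∀ {T : Graph n} {e} (χ : Cut T e) D → (∀ {f} → f ∈ D → f ∈ T) →
              pairing (indicator (side χ)) D ≡ + count e D
pairing-cut χ [] _ = refl
pairing-cut {e = e} χ (f ∷ D) ⊆ = trans
  (cong (λ t → drop-in (indicator (side χ)) f ℤ.+ t) (pairing-cut χ D (⊆ ∘ there)))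
  (case f ≟ᴱ e of λ
    { (yes f≡e) → trans (cong (λ t → t ℤ.+ + count e D) (crossing f≡e))
        (cong (λ D → + length D) (sym (filter-accept (_≟ᴱ e) f≡e)))
    ; (no f≢e) → trans (cong (λ t → t ℤ.+ + count e D) (staying f≢e)) (trans (ℤ.+-identityˡ _)
        (cong (λ D → + length D) (sym (filter-reject (_≟ᴱ e) f≢e)))) })
  where
  crossing : f ≡ e → drop-in (indicator (side χ)) f ≡ + 1
  crossing refl rewrite side-src χ | side-tgt χ = refl
  staying : f ≢ e → drop-in (indicator (side χ)) f ≡ + 0
  staying f≢e rewrite side-other χ (⊆ (here refl)) f≢e = ℤ.+-inverseʳ (indicator (side χ) (tgt f))

-- Uniqueness holds because the cut at each edge recovers its flow from the vector.
forest-model : ∀ {T : Graph n} → IsForest T → Model T (T ∷ [])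
forest-model forest .onto c        = here c , ~-refl
forest-model forest .into (here c) = c , ~-refl
forest-model {T = T} forest .unique {here c} {here d} c~d = cong here (flow-ext (proj₁ forest) λ {e} e∈ →
  ℤ.+-injective (trans (sym (pairing-cut (cut forest e∈) (bag c) (bag⊆ c)))
    (trans (at c~d _) (pairing-cut (cut forest e∈) (bag d) (bag⊆ d)))))

route⊆ : ∀ {T : Graph n} {a b} (c : TransClosure (HasEdge T) a b) → ∀ {e} → e ∈ route c → e ∈ T
route⊆ [ p ]   (here refl) = proj₁ (proj₂ (find p))
route⊆ (p ∷ c) (here refl) = proj₁ (proj₂ (find p))
route⊆ (p ∷ c) (there e∈)  = route⊆ c e∈

pairing-route : ∀ {T : Graph n} {a b} (c : TransClosure (HasEdge T) a b) φ → pairing φ (route c) ≡ φ a ℤ.- φ b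
pairing-route [ p ] φ with _ , _ , refl , refl ← find p = ℤ.+-identityʳ _
pairing-route {b = b} (p ∷ c) φ with e , _ , refl , refl ← find p =
  trans (cong (λ t → drop-in φ e ℤ.+ t) (pairing-route c φ)) (sym (telescope (φ (src e)) (φ (tgt e)) (φ b)))

route-leaves : ∀ {T : Graph n} {e a b} (χ : Cut T e) → side χ a ≡ true → side χ b ≡ false →
               (c : TransClosure (HasEdge T) a b) → e ∈ route c
route-leaves {e = e} χ p q [ r ] with g , g∈ , refl , refl ← find r with g ≟ᴱ e
... | yes refl = here refl
... | no g≢e   = contradiction (trans (sym p) (trans (side-other χ g∈ g≢e) q)) λ ()
route-leaves {e = e} χ p q (r ∷ c) with g , g∈ , refl , refl ← find r with g ≟ᴱ e
... | yes refl = here refl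
... | no g≢e   = there (route-leaves χ (trans (sym (side-other χ g∈ g≢e)) p) q c)

-- The way back from contraction: every edge of the closure becomes its chain in `T`, with the same
-- vector.
expand : ∀ {T D : Graph n} → All (InClosure T) D → Graph n
expand []       = []
expand (c ∷ cs) = route c ++ expand cs

expand-~ : ∀ {T D : Graph n} (cs : All (InClosure T) D) → expand cs ~ D
expand-~ [] = ~-refl
expand-~ (c ∷ cs) .at φ = trans (pairing-++ φ (route c) (expand cs))
  (cong₂ ℤ._+_ (pairing-route c φ) (at (expand-~ cs) φ))

expand⊆ : ∀ {T D : Graph n} (cs : All (InClosure T) D) → ∀ {e} → e ∈ expand cs → e ∈ T
expand⊆ (c ∷ cs) e∈ = Sum.[ route⊆ c , expand⊆ cs ] (∈-++⁻ (route c) e∈)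

∈-expand : ∀ {T D : Graph n} (cs : All (InClosure T) D) {f e} → f ∈ D →
           (∀ (c : InClosure T f) → e ∈ route c) → e ∈ expand cs
∈-expand (c ∷ cs) (here refl) h = ∈-++⁺ˡ (h c)
∈-expand (c ∷ cs) (there f∈)  h = ∈-++⁺ʳ (route c) (∈-expand cs f∈ h)

ofSize : (T : Graph n) → ℕ → List (Graph n)
ofSize {n} T m = filter (counted? T (n ∸ m)) (sublists (edges n))

-- Listed in the order of the sum in the theorem, the exponent m of `β` belonging to the forests
-- with n-m edges.
countedForests : Graph n → List (Graph n)
countedForests {n} T = concatMap (ofSize T) (upTo n)

∈-ofSize⁻ : ∀ (T : Graph n) m {F} → F ∈ ofSize T m → F ∈ sublists (edges n) × Counted T (n ∸ m) F
∈-ofSize⁻ {n} T m = ∈-filter⁻ (counted? T (n ∸ m)) {xs = sublists (edges n)}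

∈-countedForests⁻ : ∀ (T : Graph n) {F} → F ∈ countedForests T →
                    F ∈ sublists (edges n) × ∃[ k ] Counted T k F
∈-countedForests⁻ {n} T F∈ = case find (∈-concatMap⁻ (ofSize T) {xs = upTo n} F∈) of λ
  (m , _ , F∈m) → proj₁ (∈-ofSize⁻ T m F∈m) , n ∸ m , proj₂ (∈-ofSize⁻ T m F∈m)

unique-countedForests : ∀ (T : Graph n) → Unique (countedForests T)
unique-countedForests {n} T = unique-concatMap (Unique.upTo⁺ n)
  (λ {m} _ → Unique.filter⁺ (counted? T (n ∸ m)) (unique-sublists (unique-edges n)))
  λ {m} {m′} m∈ m′∈ F∈ F∈′ → ℕ.∸-cancelˡ-≡ (ℕ.<⇒≤ (∈-upTo⁻ m∈)) (ℕ.<⇒≤ (∈-upTo⁻ m′∈))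
    (trans (sym (Counted.size (proj₂ (∈-ofSize⁻ T m F∈)))) (Counted.size (proj₂ (∈-ofSize⁻ T m′ F∈′))))

alternating-countedForests : ∀ (T : Graph n) → All Alternating (countedForests T)
alternating-countedForests T = All.tabulate λ F∈ → Counted.alternating (proj₂ (proj₂ (∈-countedForests⁻ T F∈)))

module _ {T : Graph n} (n≥1 : n ≥ 1) (ncT : NonCrossing T) (tree : IsTreeOn (allFin _) T) where
  private
    forest : IsForest T
    forest = proj₁ tree

    connected : ∀ u v → Connected T u v
    connected u v = path⇒connected (proj₂ (proj₂ tree u v (∈-allFin u) (∈-allFin v)))

    connected-vertex : ∀ {u v} → u ≢ v → u ∈ vertices T
    connected-vertex {u} {v} u≢v with connected u v
    ... | ε     = contradiction refl u≢v
    ... | a ◅ _ = proj₁ (adj∈vertices a)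

    0<n : zero {n} < fromℕ n
    0<n = ℕ.≤∧≢⇒< z≤n (ends≢ n≥1)
      where
      ends≢ : ∀ {n} → n ≥ 1 → 0 ≢ toℕ (fromℕ n)
      ends≢ (s≤s _) ()

    0≢n : zero ≢ fromℕ n
    0≢n = ℕ.<⇒≢ 0<n ∘ cong toℕ

    block : Block T T
    block = record
      { sub      = id
      ; tree     = (λ { refl → contradiction (connected-vertex 0≢n) λ () }) , forest ,
                   λ u v _ _ → proj₂ tree u v (∈-allFin u) (∈-allFin v)
      ; interior = λ _ _ _ e∈ _ → e∈
      ; end      = λ _ _ → inj₁ λ e∈ _ → e∈
      }

    whole : PseudoComponentOn T zero (fromℕ n)
    whole with P , path@(h , l , _) ← proj₂ tree zero (fromℕ n) (∈-allFin _) (∈-allFin _) =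
      0<n , P , main (zero , fromℕ n , (connected-vertex 0≢n , All.universal (λ _ → z≤n) _) ,
                      (connected-vertex (0≢n ∘ sym) , All.universal ≤fromℕ _) , path) , h , l

  counted-covers : ∀ {k F} → Counted T k F → Covers F T
  counted-covers c = conditions⇒covers ncT block (Counted.inClosure c) (Counted.right c) (Counted.left c)

  covers-counted : ∀ {F} → Unique F → NonCrossing F → Alternating F → All (InClosure T) F → Covers F T →
                   Counted T (length F) F
  covers-counted U nc alt cl cov = record
    { size        = refl
    ; forest      = noncrossing-alternating⇒forest U nc alt
    ; noncrossing = nc
    ; alternating = alt
    ; inClosure   = cl
    -- The path from the first to the last vertex is a right pseudo-component of the whole tree; its
    -- condition asks for an edge into the last vertex from a vertex at most the first, hence from
    -- the first.
    ; longest     = longest (right zero (fromℕ n) (whole , λ s n<s → contradiction (≤fromℕ s) (ℕ.<⇒≱ n<s)))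
    ; right       = right
    ; left        = covers⇒left ncT block nc alt cl cov
    }
    where
    right = covers⇒right ncT block nc alt cl cov
    longest : ∀ {F} → ∃[ i ] i ≤ zero {n} × HasEdge F i (fromℕ n) → HasEdge F zero (fromℕ n)
    longest (zero , _ , p) = p

  -- For `into`, expanding chains gives a bag on `T`, and covering makes every edge of `T` occur in
  -- it. For `onto`, the forest is the set of edges left after contracting the flow on `T`.
  counted-model : ∀ {Gs} → Unique Gs → (∀ {F} → F ∈ Gs → F ∈ sublists (edges n) × ∃[ k ] Counted T k F) →
                  (∀ {F} → F ∈ sublists (edges n) → Counted T (length F) F → F ∈ Gs) → Model T Gs
  counted-model _ sound _ .into q with F , F∈ , d , eq ← member q
    with _ , k , c ← sound F∈ = flow , ~-trans (subst (_~ bag d) (sym eq) ~-refl)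
      (~-trans (~-sym (expand-~ closure)) (~-sym (↭⇒~ perm)))
    where
    closure : All (InClosure T) (bag d)
    closure = All.tabulate (All.lookup (Counted.inClosure c) ∘ bag⊆ d)
    covered : ∀ {e} → e ∈ T → e ∈ expand closure
    covered e∈ with f , f∈ , h ← counted-covers c e∈ = ∈-expand closure (⊆bag d f∈) h
    regrouped = regroup {G = T} {expand closure} (proj₁ forest) (expand⊆ closure) covered
    flow = proj₁ regrouped
    perm = proj₂ regrouped
  counted-model _ _ complete .onto c
    with E , ncE , altE , clE , E~c ← noncrossing-alternating-exists (bag c) (noncrossing-⊆ (bag⊆ c) ncT)
           (All.tabulate λ e∈ → [ hasEdge⁺ (bag⊆ c e∈) ]) =
    q , ~-trans (subst (_~ bag d) (sym eq) ~-refl) (~-trans (↭⇒~ perm) E~c)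
    where
    F : Graph n
    F = filter (_∈ᴱ? E) (edges n)
    F⊆E : ∀ {e} → e ∈ F → e ∈ E
    F⊆E = proj₂ ∘ ∈-filter⁻ (_∈ᴱ? E) {xs = edges n}
    E⊆F : ∀ {e} → e ∈ E → e ∈ F
    E⊆F = ∈-filter⁺ (_∈ᴱ? E) (∈-edges _)
    unique-F : Unique F
    unique-F = Unique.filter⁺ (_∈ᴱ? E) (unique-edges n)
    covers : Covers F T
    -- The flow on `T` sends something through the cut at `e` and nothing back, so an edge of `E`
    -- leaves across this cut, and its chain must use `e`.
    covers {e} e∈ = leaving (find (leaves-transfer (side χ) (~-sym E~c) inward
        (lose (⊆bag c e∈) (side-src χ , side-tgt χ))))
      where
      χ = cut forest e∈
      inward : ∀ {f} → f ∈ bag c → side χ (tgt f) ≡ true → side χ (src f) ≡ true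
      inward {f} f∈ p with f ≟ᴱ e
      ... | yes refl = side-src χ
      ... | no f≢e   = trans (side-other χ (bag⊆ c f∈) f≢e) p
      leaving : ∃[ f ] f ∈ E × Leaves (side χ) f → ∃[ f ] f ∈ F × (∀ (c : InClosure T f) → e ∈ route c)
      leaving (f , f∈ , p , q) = f , E⊆F f∈ , route-leaves χ p q
    is-counted : Counted T (length F) F
    is-counted = covers-counted unique-F (noncrossing-⊆ F⊆E ncE) (alternating-⊆ F⊆E altE)
      (All.tabulate (All.lookup clE ∘ F⊆E)) covers
    F∈ = complete (filter∈sublists (_∈ᴱ? E) (edges n)) is-counted
    regrouped = regroup {G = F} {E} unique-F E⊆F F⊆E
    d = proj₁ regrouped
    perm = proj₂ regrouped
    q = proj₁ (inject F∈ d)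
    eq = proj₂ (inject F∈ d)
  counted-model {Gs} distinct sound _ .unique {q} {q′} q~q′ = bagᴾ-injective distinct
    (All.tabulate λ F∈ → unique-sublist (unique-edges n) (proj₁ (sound F∈)))
    (λ F∈ F′∈ → sublist-ext (unique-edges n) (proj₁ (sound F∈)) (proj₁ (sound F′∈)))
    (noncrossing-alternating-unique (nc q) (alt q) (nc q′) (alt q′) q~q′)
    where
    alt : (q : Any Flow Gs) → Alternating (bagᴾ q)
    alt = alternating-bagᴾ (All.tabulate λ F∈ → Counted.alternating (proj₂ (proj₂ (sound F∈))))
    nc : (q : Any Flow Gs) → NonCrossing (bagᴾ q)
    nc q with F , F∈ , d , eq ← member q = subst NonCrossing (sym eq)
      (noncrossing-⊆ (bag⊆ d) (Counted.noncrossing (proj₂ (proj₂ (sound F∈)))))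

  ∈-countedForests⁺ : ∀ {F} → F ∈ sublists (edges n) → Counted T (length F) F → F ∈ countedForests T
  ∈-countedForests⁺ {F} F∈ c = ∈-concatMap⁺ (ofSize T)
    -- The exponent is n minus the number of edges of `F`. It is below n because `F` has an edge,
    -- and subtracting it from n returns the size because a forest has at most n edges.
    (lose (∈-upTo⁺ (smaller (positive (Counted.longest c)) n≥1))
      (∈-filter⁺ (counted? T (n ∸ (n ∸ length F))) F∈
        (subst (λ k → Counted T k F) (sym (ℕ.m∸[m∸n]≡n (forest-size (Counted.forest c)))) c)))
    where
    positive : ∀ {F : Graph n} {i j} → HasEdge F i j → 1 ℕ.≤ length F
    positive {_ ∷ _} _ = s≤s z≤n
    smaller : ∀ {n k} → 1 ℕ.≤ k → n ≥ 1 → n ∸ k ℕ.< n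
    smaller {suc n} {suc k} _ _ = s≤s (ℕ.m∸n≤m n k)

  countedForests-model : Model T (countedForests T)
  countedForests-model = counted-model (unique-countedForests T) (∈-countedForests⁻ T) ∈-countedForests⁺

-- Setting x = 1

∈-edgesOf⁻ : ∀ {M : Monomial n} {e} → e ∈ edgesOf M → x[ e ] ∈ M
∈-edgesOf⁻ {M = x[ _ ] ∷ M} (here refl) = here refl
∈-edgesOf⁻ {M = x[ _ ] ∷ M} (there e∈)  = there (∈-edgesOf⁻ e∈)
∈-edgesOf⁻ {M = β ∷ M} e∈               = there (∈-edgesOf⁻ e∈)

reduced⇒alternating : ∀ {P : Polynomial n} → IsReduced P → All Alternating (map edgesOf P)
reduced⇒alternating red = All.map⁺ (All.map alternating′ red)
  where
  alternating′ : ∀ {M : Monomial _} → (∀ e f → tgt e ≡ src f → ¬ (∃[ N ] M ↭ x[ e ] ∷ x[ f ] ∷ N)) →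
                 Alternating (edgesOf M)
  alternating′ red e f e∈ f∈ eq with N , p ← ∈⇒↭ (∈-edgesOf⁻ e∈) with ∈-resp-↭ p (∈-edgesOf⁻ f∈)
  ... | here refl = ℕ.<⇒≢ (src<tgt! f) (cong toℕ (sym eq))
  ... | there f∈N with N′ , q ← ∈⇒↭ f∈N = red e f eq (N′ , ↭-trans p (prep _ q))

-- With `β` counted in degree one, the three terms of the rule have the degree of the monomial they
-- replace. The exponent of `β` is thus n minus the number of edges.
Homogeneous : ℕ → Polynomial n → Set
Homogeneous d = All (λ M → length M ≡ d)

homogeneous-≈ : ∀ {d} {P Q : Polynomial n} → P ≈ Q → Homogeneous d P → Homogeneous d Q
homogeneous-≈ = Permutationₛ.All-resp-↭ ↭-setoid (λ p eq → trans (sym (↭-length p)) eq)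

homogeneous-⟶* : ∀ {d} {P Q : Polynomial n} → P ⟶* Q → Homogeneous d P → Homogeneous d Q
homogeneous-⟶* ε hom = hom
homogeneous-⟶* (reduce _ _ N R P≈ Q≈ ◅ steps) hom with eq ∷ rest ← homogeneous-≈ P≈ hom =
  homogeneous-⟶* steps (homogeneous-≈ (H.sym ↭-sym Q≈) (eq ∷ eq ∷ eq ∷ rest))

length-edgesOf : ∀ (M : Monomial n) → length (edgesOf M) ℕ.≤ length M
length-edgesOf []           = z≤n
length-edgesOf (x[ _ ] ∷ M) = s≤s (length-edgesOf M)
length-edgesOf (β ∷ M)      = ℕ.m≤n⇒m≤1+n (length-edgesOf M)

dropX-β : ∀ (M : Monomial n) → dropX M ≡ β^ (length M ∸ length (edgesOf M))
dropX-β []           = refl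
dropX-β (x[ _ ] ∷ M) = dropX-β M
dropX-β (β ∷ M)      = trans (cong (β ∷_) (dropX-β M))
  (cong β^_ (sym (ℕ.+-∸-assoc 1 (length-edgesOf M))))

x=1-sizes : ∀ {d} {P : Polynomial n} → Homogeneous d P →
            P ∣x=1 ≡ map (λ k → β^ (d ∸ k)) (map length (map edgesOf P))
x=1-sizes []                    = refl
x=1-sizes {P = M ∷ _} (refl ∷ hom) = cong₂ _∷_ (dropX-β M) (x=1-sizes hom)

Σ-sizes : ∀ (T : Graph n) ms → All (ℕ._< n) ms → concatMap (λ m → f T (n ∸ m) · β^ m) ms ≡
          map (λ k → β^ (n ∸ k)) (map length (concatMap (ofSize T) ms))
Σ-sizes T []       []           = refl
Σ-sizes {n} T (m ∷ ms) (m<n ∷ ms<n) = trans (cong₂ _++_ (row (ofSize T m) (All.tabulate λ F∈ →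
    Counted.size (proj₂ (∈-ofSize⁻ T m F∈)))) (Σ-sizes T ms ms<n))
  (sym (trans (cong (map g) (map-++ length (ofSize T m) _)) (map-++ g (map length (ofSize T m)) _)))
  where
  g : ℕ → Monomial n
  g k = β^ (n ∸ k)
  row : ∀ (Fs : List (Graph n)) → All (λ F → length F ≡ n ∸ m) Fs →
        length Fs · β^ m ≡ map g (map length Fs)
  row []       []         = refl
  row (F ∷ Fs) (eq ∷ eqs) = cong₂ _∷_
    (cong β^_ (sym (trans (cong (n ∸_) eq) (ℕ.m∸[m∸n]≡n (ℕ.<⇒≤ m<n))))) (row Fs eqs)

↭⇒≈ : ∀ {P Q : Polynomial n} → P ↭ Q → P ≈ Q
↭⇒≈ ↭.refl         = H.refl (Pointwise.refl ↭-refl)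
↭⇒≈ (↭.prep M p)   = H.prep ↭-refl (↭⇒≈ p)
↭⇒≈ (↭.swap M N p) = H.swap ↭-refl ↭-refl (↭⇒≈ p)
↭⇒≈ (↭.trans p q)  = H.trans (↭⇒≈ p) (↭⇒≈ q)

theorem2 : (n : ℕ) → n ≥ 1 → (T : Graph n) → IsGoodTree T →
    (P : Polynomial n) → IsReducedFormOf P m[ T ] →
    P ∣x=1 ≈ Σ[ m < n ] f T (n ∸ m) · β^ m
theorem2 n n≥1 T (good , tree) P (Q , steps , Q≈P , reduced) =
  subst₂ _≈_ (sym (x=1-sizes homogeneous)) (sym (Σ-sizes T (upTo n) (All.all-upTo n)))
    (↭⇒≈ (map⁺ (λ k → β^ (n ∸ k)) (alternating-models model
      (countedForests-model n≥1 (IsGoodForest.noncrossing good) tree)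
      (reduced⇒alternating reduced) (alternating-countedForests T))))
  where
  model : Model T (map edgesOf P)
  model = model-reindex (subst (λ G → Model T (G ∷ [])) (sym (edgesOf-m T)) (forest-model (proj₁ tree)))
    (reindex-trans (reindex-⟶* steps) (reindex-≈ Q≈P))
  homogeneous : Homogeneous n P
  homogeneous = homogeneous-≈ Q≈P (homogeneous-⟶* steps
    (trans (length-map x[_] T) (tree-size tree) ∷ []))
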